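{- Let $H=(V,E)$ be a $3$-uniform hypergraph on vertex set $\{1,\dots,t\}$. Consider the test which, given oracle access to $f:\{0,1\}^n\to\{ -1,1\}$, chooses $x_1,\dots,x_t\in\{0,1\}^n$ independently and uniformly at random and accepts iff for every edge $e=\{i,j,k\}\in E$ $$f(x_i)f(x_j)f(x_k)f(x_i+x_j)f(x_i+x_k)f(x_j+x_k)f(x_i+x_j+x_k)=f(0).$$ Then: (1) (perfect completeness) every quadratic polynomial function $f$ is accepted with probability $1$; (2) (soundness $1/2^{|E|}$) there is a function $\phi$ with $\phi(\epsilon)\to0$ as $\epsilon\to0$, independent of $n$ and $f$, such that every $f$ whose distance from every quadratic polynomial function is at least $\frac12-\epsilon$ is accepted with probability at most $\frac1{2^{|E|}}+\phi(\epsilon)$.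
   Context: Addition in $\{0,1\}^n$ is in $\mathbb{F}_2^n$. A quadratic polynomial function is $g(x)=(-1)^{P(x)}$ with $P$ an $n$-variate polynomial of degree at most $2$ over $\mathbb{F}_2$. The distance between $f,g$ is the fraction of points where they differ. -}

module Defs where

open import Function using (_∘_)
open import Data.Bool using (Bool; true; false; _xor_; _∧_; not; if_then_else_)
open import Data.Nat as ℕ using (ℕ; zero; suc; _^_; _*_)
open import Data.Nat.Properties using (m^n≢0)
open import Data.Fin using (Fin; _<_) renaming (zero to Fz; suc to Fs)
open import Data.Vec using (Vec; []; _∷_; zipWith; replicate; lookup)
open import Data.List as L using (List; []; _∷_; length)
open import Data.List.Relation.Unary.All using (All)
open import Data.List.Relation.Unary.Unique.Propositional using (Unique)
open import Data.Sign as S using (Sign)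
open import Data.Rational as ℚ using (ℚ; _/_)
open import Data.Integer using (+_)
open import Data.Product using (Σ; ∃; _×_; _,_)
open import Relation.Nullary.Decidable using (⌊_⌋)
open import Relation.Binary.PropositionalEquality using (_≡_)

Cube : ℕ → Set
Cube n = Vec Bool n

_⊕_ : ∀ {n} → Cube n → Cube n → Cube n
_⊕_ = zipWith _xor_

𝟎 : ∀ {n} → Cube n
𝟎 = replicate _ false

allCube : ∀ n → List (Cube n)
allCube zero = [] ∷ []
allCube (suc n) = L.map (false ∷_) (allCube n) L.++ L.map (true ∷_) (allCube n)

allTuples : ∀ n t → List (Vec (Cube n) t)
allTuples n zero = [] ∷ []
allTuples n (suc t) = L.concatMap (λ x → L.map (x ∷_) (allTuples n t)) (allCube n)

count : ∀ {A : Set} → (A → Bool) → List A → ℕ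
count p = length ∘ L.filterᵇ p

prob : ℕ → ℕ → ℚ
prob c k = _/_ (+ c) (2 ^ k) {{m^n≢0 2 k}}

xorSum : ∀ n → (Fin n → Bool) → Bool
xorSum zero    g = false
xorSum (suc n) g = g Fz xor xorSum n (g ∘ Fs)

record QuadPoly (n : ℕ) : Set where
  field
    const : Bool
    lin   : Fin n → Bool
    quad  : Fin n → Fin n → Bool

evalPoly : ∀ {n} → QuadPoly n → Cube n → Bool
evalPoly {n} P x =
  const xor xorSum n (λ i → lin i ∧ lookup x i)
        xor xorSum n (λ i → xorSum n (λ j → quad i j ∧ (lookup x i ∧ lookup x j)))
  where open QuadPoly P

quadFn : ∀ {n} → QuadPoly n → Cube n → Sign
quadFn P x = if evalPoly P x then S.- else S.+

IsQuadratic : ∀ {n} → (Cube n → Sign) → Set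
IsQuadratic {n} f = ∃ λ (P : QuadPoly n) → ∀ x → f x ≡ quadFn P x

distance : ∀ {n} → (Cube n → Sign) → (Cube n → Sign) → ℚ
distance {n} f g = prob (count (λ x → not ⌊ f x S.≟ g x ⌋) (allCube n)) n

-- A 3-uniform hypergraph on vertex set {1,…,t} (represented by Fin t):
-- each edge {i,j,k} is stored once, as a triple with i < j < k.
record Hypergraph3 (t : ℕ) : Set where
  field
    edges  : List (Fin t × Fin t × Fin t)
    sorted : All (λ { (i , j , k) → i < j × j < k }) edges
    unique : Unique edges

numEdges : ∀ {t} → Hypergraph3 t → ℕ
numEdges H = length (Hypergraph3.edges H)

edgeTest : ∀ {n t} → (Cube n → Sign) → Vec (Cube n) t → Fin t × Fin t × Fin t → Bool
edgeTest f xs (i , j , k) =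
  ⌊ (f a S.* f b S.* f c S.* f (a ⊕ b) S.* f (a ⊕ c) S.* f (b ⊕ c) S.* f ((a ⊕ b) ⊕ c))
      S.≟ f 𝟎 ⌋
  where
    a = lookup xs i
    b = lookup xs j
    c = lookup xs k

accepts : ∀ {n t} → Hypergraph3 t → (Cube n → Sign) → Vec (Cube n) t → Bool
accepts H f xs = L.foldr (λ e r → edgeTest f xs e ∧ r) true (Hypergraph3.edges H)

acceptProb : ∀ {n t} → Hypergraph3 t → (Cube n → Sign) → ℚ
acceptProb {n} {t} H f = prob (count (accepts H f) (allTuples n t)) (n * t)

{-# OPTIONS --safe #-}
module Submission where

-- Write the acceptance probability as an average of indicators 𝟙[edge e passes] = (1 + F_e)/2.  Any other
-- edge meets e in at most two vertices, so three applications of Cauchy–Schwarz bound the average of F_e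
-- times the other indicators by the U³ norm of f.  Soundness is thus the inverse theorem for U³ over 𝔽₂.
--
-- Let w(h,ξ) = |𝔼ₓ f(x) f(x+h) (−1)^(ξ·x)|² on G = 𝔽₂ⁿ × 𝔽₂ⁿ, where G carries 𝔼_h Σ_ξ.  It has mass 1, its
-- square has integral ‖f‖⁸, and it is its own symplectic Fourier transform; in particular w is positive
-- definite.  If ∫w² ≥ δ, a random neighbourhood b(x) = w(x) w(x+y) has almost all of its sums in the set
-- {w∗w ≥ η} (dependent random choice), while positive definiteness gives a heavy set S of popular
-- differences of b; counting 4-cycles shows that S+S+S+S is small, and Ruzsa's covering argument encloses
-- S in a subspace V with w(V) large and |V|/2ⁿ bounded.  V is covered by boundedly many
-- translates of the graph of a linear map M, none of which outweighs the graph, by self-duality.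
-- The form Mx·y − My·x then has a large radical, so boundedly many rank one changes of M, each costing at
-- most a factor 2 by self-duality, make M symmetric and then alternating.  A primitive q of M turns
-- 𝔼_h w(h,Mh) into the U² norm of f (−1)^q, and f correlates with a quadratic.

open import Defs
open import Algebra.Structures using (IsCommutativeRing)
open import Algebra.Bundles using (CommutativeRing)
import Algebra.Solver.Ring
import Algebra.Solver.Ring.AlmostCommutativeRing as ACR
open import Data.Bool using (Bool; true; false; _xor_; _∧_; not; if_then_else_)
import Data.Bool.Properties as 𝔹ₚ
open import Data.Bool.Solver using (module xor-∧-Solver)
open import Data.Empty using (⊥; ⊥-elim)
open import Data.Fin using (Fin) renaming (zero to Fz; suc to Fs)
open import Data.List as L using (List; []; _∷_; _++_; length)
open import Data.List.Membership.Propositional using (_∈_; lose; find)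
open import Data.List.Membership.Propositional.Properties using (∈-++⁺ˡ; ∈-++⁺ʳ; ∈-++⁻; ∈-map⁺; ∈-map⁻; ∈-concatMap⁺)
open import Data.List.Relation.Unary.Any using (Any; here; there; any?; satisfied)
open import Data.Nat using (ℕ; zero; suc)
import Data.Nat as ℕ
import Data.Nat.Properties as ℕₚ
open import Data.Product using (∃; _×_; _,_; proj₁; proj₂; uncurry)
open import Data.Rational using (ℚ; 0ℚ; 1ℚ; ½; _<_; _≤_; _+_; _-_; ∣_∣)
import Data.Rational.Base as ℚ
import Data.Rational.Properties as ℚₚ
open import Data.Rational.Properties using (≤-refl; ≤-reflexive; ≤-trans; <⇒≤; <-≤-trans; ≤-<-trans; ≰⇒>; ≮⇒≥; <-trans; <-irrefl)
open import Data.Sign as S using (Sign)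
open import Data.Sum using (_⊎_; inj₁; inj₂)
open import Data.Vec using (Vec; []; _∷_; lookup; _[_]≔_)
import Data.Vec.Properties as Vₚ
open import Function using (_∘_; id)
open import Relation.Nullary using (¬_; Dec; yes; no)
open import Relation.Nullary.Decidable using (dec⇒maybe; ⌊_⌋; _×-dec_)
open import Relation.Binary.PropositionalEquality
open ℚₚ.≤-Reasoning
import Data.Rational.Unnormalised as ℚᵘ
import Data.Rational.Unnormalised.Properties as ℚᵘₚ
import Data.Integer as ℤ
import Data.Integer.Properties as ℤₚ
import Data.Fin as F
import Data.Fin.Properties as Fₚ
open import Data.List.Relation.Unary.All as All using (All; []; _∷_)
open import Data.List.Relation.Unary.AllPairs using ([]; _∷_)
open import Data.List.Relation.Unary.Unique.Propositional using (Unique)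

-- The textbook route picks one large Fourier coefficient ξ(h) of each derivative and works with the
-- graph of h ↦ ξ(h). The weight `w` stands in for that graph: no choice is made, the combinatorial
-- steps use only the axioms of `SelfDualWeight`, and self-duality supplies every positivity
-- argument. No rate is asked of φ, so the exponential loss of the covering argument is harmless and
-- the constants may depend on δ in any explicit way. Characters of 𝔽₂ⁿ are signs, so all analysis
-- stays inside ℚ; where a root would be natural, powers are compared instead. Symmetry of M is not
-- enough at the end: the form obtained by polarising a quadratic polynomial over 𝔽₂ vanishes on the
-- diagonal, and a symmetric form that does not vanish there has no such polynomial as primitive.
-- Finally, the inverse theorem gives a threshold for ε for each tolerated error, whereas φ must
-- give an error for each ε; it is found by searching through the powers of one half, with the
-- trivial error 1 as a fallback.

infixl 6 _⊞_ _⊟_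
infixl 7 _·_
infix  8 ⊖_

-- Opaque copies of the operations of ℚ: being neutral, they let Agda infer their arguments.
opaque
  _⊞_ _·_ : ℚ → ℚ → ℚ
  _⊞_ = ℚ._+_
  _·_ = ℚ._*_

  ⊖_ : ℚ → ℚ
  ⊖_ = ℚ.-_

  ⊞-def : ∀ p q → p ⊞ q ≡ p ℚ.+ q
  ⊞-def _ _ = refl

  ·-def : ∀ p q → p · q ≡ p ℚ.* q
  ·-def _ _ = refl

  ⊖-def : ∀ p → ⊖ p ≡ ℚ.- p
  ⊖-def _ = refl

  isCommRing : IsCommutativeRing _≡_ _⊞_ _·_ ⊖_ 0ℚ 1ℚ
  isCommRing = ℚₚ.+-*-isCommutativeRing

  ⊞-mono : ∀ {p q r s} → p ≤ q → r ≤ s → p ⊞ r ≤ q ⊞ s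
  ⊞-mono = ℚₚ.+-mono-≤

  ⊞-mono-<-≤ : ∀ {p q r s} → p < q → r ≤ s → p ⊞ r < q ⊞ s
  ⊞-mono-<-≤ = ℚₚ.+-mono-<-≤

  ·-monoˡ : ∀ {r p q} → 0ℚ ≤ r → p ≤ q → r · p ≤ r · q
  ·-monoˡ {r} h = ℚₚ.*-monoˡ-≤-nonNeg r {{ℚ.nonNegative h}}

  ·-monoˡ-< : ∀ {r p q} → 0ℚ < r → p < q → r · p < r · q
  ·-monoˡ-< {r} h = ℚₚ.*-monoʳ-<-pos r {{ℚ.positive h}}

  ·-cancelˡ-< : ∀ {r p q} → 0ℚ ≤ r → r · p < r · q → p < q
  ·-cancelˡ-< {r} h = ℚₚ.*-cancelˡ-<-nonNeg r {{ℚ.nonNegative h}}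

_⊟_ : ℚ → ℚ → ℚ
p ⊟ q = p ⊞ ⊖ q

ℚ-ring : CommutativeRing _ _
ℚ-ring = record { isCommutativeRing = isCommRing }

open CommutativeRing ℚ-ring using () renaming
  ( *-identityˡ to ·-idˡ
  ; *-identityʳ to ·-idʳ
  ; +-identityˡ to ⊞-idˡ
  ; +-identityʳ to ⊞-idʳ
  ; *-assoc to ·-assoc
  ; +-assoc to ⊞-assoc
  ; *-comm to ·-comm
  ; +-comm to ⊞-comm
  ; zeroˡ to ·-zeroˡ
  ; zeroʳ to ·-zeroʳ
  ; distribˡ to ·-distribˡ
  ; -‿inverseʳ to ⊞-inverseʳ
  )

almostRing : ACR.AlmostCommutativeRing _ _
almostRing = ACR.fromCommutativeRing ℚ-ring

coefficients : ℚ.+-*-rawRing ACR.-Raw-AlmostCommutative⟶ almostRing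
coefficients = record
  { ⟦_⟧    = id
  ; +-homo = λ p q → sym (⊞-def p q)
  ; *-homo = λ p q → sym (·-def p q)
  ; -‿homo = λ p → sym (⊖-def p)
  ; 0-homo = refl
  ; 1-homo = refl
  }

open Algebra.Solver.Ring ℚ.+-*-rawRing almostRing coefficients (λ p q → dec⇒maybe (p ℚₚ.≟ q)) public
  using (solve; _:=_; _:+_; _:*_; _:-_; :-_; con)


-- Order and squares in ℚ; indicators and signs

two : ℚ
two = 1ℚ ⊞ 1ℚ

0≤1 : 0ℚ ≤ 1ℚ
0≤1 = ℚₚ.<⇒≤ (ℚₚ.positive⁻¹ 1ℚ)

0<1 : 0ℚ < 1ℚ
0<1 = ℚₚ.positive⁻¹ 1ℚ

0<½ : 0ℚ < ½
0<½ = ℚₚ.positive⁻¹ ½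

0≤½ : 0ℚ ≤ ½
0≤½ = <⇒≤ 0<½

·-nonNeg : ∀ {p q} → 0ℚ ≤ p → 0ℚ ≤ q → 0ℚ ≤ p · q
·-nonNeg {p} {q} hp hq = subst (_≤ p · q) (·-zeroʳ p) (·-monoˡ hp hq)

·-pos : ∀ {p q} → 0ℚ < p → 0ℚ < q → 0ℚ < p · q
·-pos {p} {q} hp hq = subst (_< p · q) (·-zeroʳ p) (·-monoˡ-< hp hq)

⊞-nonNeg : ∀ {p q} → 0ℚ ≤ p → 0ℚ ≤ q → 0ℚ ≤ p ⊞ q
⊞-nonNeg {p} {q} hp hq = subst (_≤ p ⊞ q) (⊞-idˡ 0ℚ) (⊞-mono hp hq)

·-monoʳ : ∀ {r p q} → 0ℚ ≤ r → p ≤ q → p · r ≤ q · r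
·-monoʳ {r} {p} {q} hr h = subst₂ _≤_ (·-comm r p) (·-comm r q) (·-monoˡ hr h)

·-mono : ∀ {p q r s} → 0ℚ ≤ p → 0ℚ ≤ s → p ≤ q → r ≤ s → p · r ≤ q · s
·-mono hp hs h k = ≤-trans (·-monoˡ hp k) (·-monoʳ hs h)

·-mono-sq : ∀ {p q} → 0ℚ ≤ p → p ≤ q → p · p ≤ q · q
·-mono-sq hp h = ·-mono hp (≤-trans hp h) h h

·-≤ˡ : ∀ {p q} → 0ℚ ≤ p → q ≤ 1ℚ → p · q ≤ p
·-≤ˡ {p} {q} hp h = subst (p · q ≤_) (·-idʳ p) (·-monoˡ hp h)

·-≤ʳ : ∀ {p q} → 0ℚ ≤ q → p ≤ 1ℚ → p · q ≤ q
·-≤ʳ {p} {q} hq h = subst (p · q ≤_) (·-idˡ q) (·-monoʳ hq h)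

·-≤1 : ∀ {p q} → 0ℚ ≤ p → p ≤ 1ℚ → q ≤ 1ℚ → p · q ≤ 1ℚ
·-≤1 hp h k = ≤-trans (·-≤ˡ hp k) h

≤-by : ∀ {p q} d → 0ℚ ≤ d → q ≡ p ⊞ d → p ≤ q
≤-by {p} d hd eq = subst₂ _≤_ (⊞-idʳ p) (sym eq) (⊞-mono (≤-refl {p}) hd)

diff-nonNeg : ∀ {p q} → p ≤ q → 0ℚ ≤ q ⊟ p
diff-nonNeg {p} {q} h = subst (_≤ q ⊟ p) (⊞-inverseʳ p) (⊞-mono h (≤-refl {⊖ p}))

⊖-mono : ∀ {p q} → p ≤ q → ⊖ q ≤ ⊖ p
⊖-mono {p} {q} h = ≤-by (q ⊟ p) (diff-nonNeg h)
  (solve 2 (λ p q → :- p := :- q :+ (q :- p)) refl p q)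

⊟-mono : ∀ {p q r s} → p ≤ q → s ≤ r → p ⊟ r ≤ q ⊟ s
⊟-mono h k = ⊞-mono h (⊖-mono k)

0≤sq : ∀ p → 0ℚ ≤ p · p
0≤sq p with ℚₚ.≤-total 0ℚ p
... | inj₁ h = ·-nonNeg h h
... | inj₂ h = subst (0ℚ ≤_) (solve 1 (λ p → (con 0ℚ :- p) :* (con 0ℚ :- p) := p :* p) refl p)
          (·-nonNeg (diff-nonNeg h) (diff-nonNeg h))

½+½ : ∀ p → ½ · p ⊞ ½ · p ≡ p
½+½ = solve 1 (λ p → con ½ :* p :+ con ½ :* p := p) refl

½-nonNeg : ∀ {p} → 0ℚ ≤ p ⊞ p → 0ℚ ≤ p
½-nonNeg {p} h = subst (0ℚ ≤_) (solve 1 (λ p → con ½ :* (p :+ p) := p) refl p) (·-nonNeg 0≤½ h)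

½-≤ : ∀ {p} → 0ℚ ≤ p → ½ · p ≤ p
½-≤ {p} h = ≤-by (½ · p) (·-nonNeg 0≤½ h) (sym (½+½ p))

½-< : ∀ {p} → 0ℚ < p → ½ · p < p
½-< {p} h = subst₂ _<_ (⊞-idˡ (½ · p)) (½+½ p) (⊞-mono-<-≤ (·-pos 0<½ h) (≤-refl {½ · p}))

𝟙 : Bool → ℚ
𝟙 false = 0ℚ
𝟙 true  = 1ℚ

𝟙≥0 : ∀ b → 0ℚ ≤ 𝟙 b
𝟙≥0 false = ≤-refl
𝟙≥0 true  = 0≤1

𝟙≤1 : ∀ b → 𝟙 b ≤ 1ℚ
𝟙≤1 false = 0≤1
𝟙≤1 true  = ≤-refl

sgn : Bool → ℚ
sgn false = 1ℚ
sgn true  = ⊖ 1ℚ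

sgn-xor : ∀ a b → sgn (a xor b) ≡ sgn a · sgn b
sgn-xor false b     = sym (·-idˡ (sgn b))
sgn-xor true  false = sym (·-idʳ (⊖ 1ℚ))
sgn-xor true  true  = solve 0 (con 1ℚ := (:- con 1ℚ) :* (:- con 1ℚ)) refl

sgn-sq : ∀ a → sgn a · sgn a ≡ 1ℚ
sgn-sq false = ·-idˡ 1ℚ
sgn-sq true  = sym (sgn-xor true true)

sgn≤1 : ∀ a → sgn a ≤ 1ℚ
sgn≤1 false = ≤-refl
sgn≤1 true  = ≤-by two (⊞-nonNeg 0≤1 0≤1) (solve 0 (con 1ℚ := :- con 1ℚ :+ (con 1ℚ :+ con 1ℚ)) refl)

-- Finite sums and integrals

sumL : ∀ {X : Set} → List X → (X → ℚ) → ℚ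
sumL []       F = 0ℚ
sumL (x ∷ xs) F = F x ⊞ sumL xs F

sumL-cong : ∀ {X : Set} (xs : List X) {F G : X → ℚ} → (∀ x → F x ≡ G x) → sumL xs F ≡ sumL xs G
sumL-cong []       h = refl
sumL-cong (x ∷ xs) h = cong₂ _⊞_ (h x) (sumL-cong xs h)

sumL-⊞ : ∀ {X : Set} (xs : List X) (F G : X → ℚ) → sumL xs (λ x → F x ⊞ G x) ≡ sumL xs F ⊞ sumL xs G
sumL-⊞ []       F G = sym (⊞-idˡ 0ℚ)
sumL-⊞ (x ∷ xs) F G = trans (cong (F x ⊞ G x ⊞_) (sumL-⊞ xs F G))
  (solve 4 (λ a b c d → (a :+ b) :+ (c :+ d) := (a :+ c) :+ (b :+ d)) refl (F x) (G x) (sumL xs F) (sumL xs G))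

sumL-· : ∀ {X : Set} (xs : List X) c (F : X → ℚ) → sumL xs (λ x → c · F x) ≡ c · sumL xs F
sumL-· []       c F = sym (·-zeroʳ c)
sumL-· (x ∷ xs) c F = trans (cong (c · F x ⊞_) (sumL-· xs c F)) (sym (·-distribˡ c (F x) (sumL xs F)))

sumL-mono : ∀ {X : Set} (xs : List X) {F G : X → ℚ} → (∀ x → F x ≤ G x) → sumL xs F ≤ sumL xs G
sumL-mono []       h = ≤-refl
sumL-mono (x ∷ xs) h = ⊞-mono (h x) (sumL-mono xs h)

sumL-0 : ∀ {X : Set} (xs : List X) → sumL xs (λ _ → 0ℚ) ≡ 0ℚ
sumL-0 []       = refl
sumL-0 (x ∷ xs) = trans (⊞-idˡ _) (sumL-0 xs)

sumL-swap : ∀ {X Y : Set} (xs : List X) (ys : List Y) (F : X → Y → ℚ) →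
  sumL xs (λ x → sumL ys (F x)) ≡ sumL ys (λ y → sumL xs (λ x → F x y))
sumL-swap []       ys F = sym (sumL-0 ys)
sumL-swap (x ∷ xs) ys F = trans (cong (sumL ys (F x) ⊞_) (sumL-swap xs ys F))
  (sym (sumL-⊞ ys (F x) (λ y → sumL xs (λ x → F x y))))

sumL-++ : ∀ {X : Set} (xs ys : List X) (F : X → ℚ) → sumL (xs ++ ys) F ≡ sumL xs F ⊞ sumL ys F
sumL-++ []       ys F = sym (⊞-idˡ _)
sumL-++ (x ∷ xs) ys F = trans (cong (F x ⊞_) (sumL-++ xs ys F)) (sym (⊞-assoc (F x) (sumL xs F) (sumL ys F)))

sumL-map : ∀ {X Y : Set} (h : X → Y) (xs : List X) (F : Y → ℚ) → sumL (L.map h xs) F ≡ sumL xs (F ∘ h)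
sumL-map h []       F = refl
sumL-map h (x ∷ xs) F = cong (F (h x) ⊞_) (sumL-map h xs F)

sumL-concatMap : ∀ {X Y : Set} (h : X → List Y) (xs : List X) (F : Y → ℚ) →
  sumL (L.concatMap h xs) F ≡ sumL xs (λ x → sumL (h x) F)
sumL-concatMap h []       F = refl
sumL-concatMap h (x ∷ xs) F =
  trans (sumL-++ (h x) (L.concatMap h xs) F) (cong (sumL (h x) F ⊞_) (sumL-concatMap h xs F))

sumL-pos : ∀ {X : Set} (xs : List X) (F : X → ℚ) → 0ℚ < sumL xs F → ∃ λ x → 0ℚ < F x
sumL-pos []       F h = ⊥-elim (<-irrefl refl h)
sumL-pos (x ∷ xs) F h with 0ℚ ℚₚ.<? F x
... | yes p = x , p
... | no ¬p = sumL-pos xs F (<-≤-trans h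
  (≤-trans (⊞-mono (≮⇒≥ ¬p) (≤-refl {sumL xs F})) (≤-reflexive (⊞-idˡ _))))

-- One weight for all points: averages over a group, sums over its dual and products of the two are
-- then instances of a single integral.
record Measure (X : Set) : Set where
  constructor measure
  field
    wt   : ℚ
    wt≥0 : 0ℚ ≤ wt
    pts  : List X

open Measure public

opaque
  ∫ : ∀ {X : Set} → Measure X → (X → ℚ) → ℚ
  ∫ μ F = wt μ · sumL (pts μ) F

  ∫-def : ∀ {X : Set} (μ : Measure X) F → ∫ μ F ≡ wt μ · sumL (pts μ) F
  ∫-def μ F = refl

  ∫-cong : ∀ {X : Set} {μ : Measure X} {F G} → (∀ x → F x ≡ G x) → ∫ μ F ≡ ∫ μ G
  ∫-cong {μ = μ} h = cong (wt μ ·_) (sumL-cong (pts μ) h)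

  ∫-⊞ : ∀ {X : Set} {μ : Measure X} F G → ∫ μ (λ x → F x ⊞ G x) ≡ ∫ μ F ⊞ ∫ μ G
  ∫-⊞ {μ = μ} F G = trans (cong (wt μ ·_) (sumL-⊞ (pts μ) F G)) (·-distribˡ (wt μ) _ _)

  ∫-· : ∀ {X : Set} {μ : Measure X} c F → ∫ μ (λ x → c · F x) ≡ c · ∫ μ F
  ∫-· {μ = μ} c F = trans (cong (wt μ ·_) (sumL-· (pts μ) c F))
    (solve 3 (λ a b c → a :* (b :* c) := b :* (a :* c)) refl (wt μ) c (sumL (pts μ) F))

  ∫-mono : ∀ {X : Set} {μ : Measure X} {F G} → (∀ x → F x ≤ G x) → ∫ μ F ≤ ∫ μ G
  ∫-mono {μ = μ} h = ·-monoˡ (wt≥0 μ) (sumL-mono (pts μ) h)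

  ∫-swap : ∀ {X Y : Set} {μ : Measure X} {ν : Measure Y} (F : X → Y → ℚ) →
    (∫ μ λ x → ∫ ν λ y → F x y) ≡ (∫ ν λ y → ∫ μ λ x → F x y)
  ∫-swap {μ = μ} {ν} F = trans (cong (wt μ ·_) (sumL-· (pts μ) (wt ν) _))
    (trans (cong (λ s → wt μ · (wt ν · s)) (sumL-swap (pts μ) (pts ν) F))
    (trans (solve 3 (λ a b c → a :* (b :* c) := b :* (a :* c)) refl (wt μ) (wt ν) _)
    (cong (wt ν ·_) (sym (sumL-· (pts ν) (wt μ) _)))))

  ∫-pos : ∀ {X : Set} {μ : Measure X} (F : X → ℚ) → 0ℚ < ∫ μ F → ∃ λ x → 0ℚ < F x
  ∫-pos {μ = μ} F h = sumL-pos (pts μ) F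
    (·-cancelˡ-< (wt≥0 μ) (subst (_< ∫ μ F) (sym (·-zeroʳ (wt μ))) h))

∫-·ʳ : ∀ {X : Set} {μ : Measure X} c F → ∫ μ (λ x → F x · c) ≡ ∫ μ F · c
∫-·ʳ c F = trans (∫-cong λ x → ·-comm (F x) c) (trans (∫-· c F) (·-comm c _))

∫-⊟ : ∀ {X : Set} {μ : Measure X} F G → ∫ μ (λ x → F x ⊟ G x) ≡ ∫ μ F ⊟ ∫ μ G
∫-⊟ {μ = μ} F G = begin-equality
  ∫ μ (λ x → F x ⊟ G x) ≡⟨ ∫-⊞ F (λ x → ⊖ G x) ⟩
  ∫ μ F ⊞ ∫ μ (λ x → ⊖ G x) ≡⟨ cong (∫ μ F ⊞_) (∫-cong λ x → solve 1 (λ a → :- a := (:- con 1ℚ) :* a) refl (G x)) ⟩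
  ∫ μ F ⊞ ∫ μ (λ x → ⊖ 1ℚ · G x) ≡⟨ cong (∫ μ F ⊞_) (∫-· (⊖ 1ℚ) G) ⟩
  ∫ μ F ⊞ ⊖ 1ℚ · ∫ μ G ≡⟨ solve 2 (λ a b → a :+ (:- con 1ℚ) :* b := a :- b) refl (∫ μ F) (∫ μ G) ⟩
  ∫ μ F ⊟ ∫ μ G ∎

∫-0 : ∀ {X : Set} {μ : Measure X} → ∫ μ (λ _ → 0ℚ) ≡ 0ℚ
∫-0 {μ = μ} = trans (∫-cong λ _ → sym (·-zeroˡ 0ℚ)) (trans (∫-· 0ℚ (λ _ → 0ℚ)) (·-zeroˡ _))

∫-nonNeg : ∀ {X : Set} {μ : Measure X} {F : X → ℚ} → (∀ x → 0ℚ ≤ F x) → 0ℚ ≤ ∫ μ F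
∫-nonNeg {μ = μ} {F} h = subst (_≤ ∫ μ F) ∫-0 (∫-mono h)

∫-sep : ∀ {X Y : Set} {μ : Measure X} {ν : Measure Y} (F : X → ℚ) (G : Y → ℚ) →
  (∫ μ λ x → ∫ ν λ y → F x · G y) ≡ ∫ μ F · ∫ ν G
∫-sep F G = trans (∫-cong λ x → ∫-· (F x) G) (∫-·ʳ _ F)

∫-linear₃ : ∀ {X : Set} {μ : Measure X} (F G H : X → ℚ) →
  ∫ μ (λ x → (F x ⊞ G x) ⊟ H x) ≡ (∫ μ F ⊞ ∫ μ G) ⊟ ∫ μ H
∫-linear₃ F G H = trans (∫-⊟ _ H) (cong (_⊟ _) (∫-⊞ F G))

IsProb : ∀ {X : Set} → Measure X → Set
IsProb μ = ∫ μ (λ _ → 1ℚ) ≡ 1ℚ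

∫-const : ∀ {X : Set} {μ : Measure X} → IsProb μ → ∀ c → ∫ μ (λ _ → c) ≡ c
∫-const {μ = μ} hμ c = trans (∫-cong λ _ → sym (·-idʳ c)) (trans (∫-· c (λ _ → 1ℚ)) (trans (cong (c ·_) hμ) (·-idʳ c)))

-- Lagrange's identity: the double integral of `w x · w y` times the square of
-- `F x · G y ⊟ F y · G x` is twice the right side minus the left side, and it is nonnegative.
cauchy-schwarz-weighted : ∀ {X : Set} {μ : Measure X} (w F G : X → ℚ) → (∀ x → 0ℚ ≤ w x) →
  ∫ μ (λ x → w x · (F x · G x)) · ∫ μ (λ x → w x · (F x · G x)) ≤
  ∫ μ (λ x → w x · (F x · F x)) · ∫ μ (λ x → w x · (G x · G x))
cauchy-schwarz-weighted {μ = μ} w F G hw =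
  ≤-by (P · Q ⊟ R · R) (½-nonNeg (subst (0ℚ ≤_) expand (∫-nonNeg λ x → ∫-nonNeg λ y → ·-nonNeg (·-nonNeg (hw x) (hw y)) (0≤sq (F x · G y ⊟ F y · G x)))))
    (solve 2 (λ a b → a := b :+ (a :- b)) refl (P · Q) (R · R))
  where
  P = ∫ μ (λ x → w x · (F x · F x))
  Q = ∫ μ (λ x → w x · (G x · G x))
  R = ∫ μ (λ x → w x · (F x · G x))
  expand : (∫ μ λ x → ∫ μ λ y → (w x · w y) · ((F x · G y ⊟ F y · G x) · (F x · G y ⊟ F y · G x)))
         ≡ (P · Q ⊟ R · R) ⊞ (P · Q ⊟ R · R)
  expand = begin-equality
    (∫ μ λ x → ∫ μ λ y → (w x · w y) · ((F x · G y ⊟ F y · G x) · (F x · G y ⊟ F y · G x)))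
      ≡⟨ (∫-cong λ x → ∫-cong λ y → solve 6 (λ a b f f' g g' →
           (a :* b) :* ((f :* g' :- f' :* g) :* (f :* g' :- f' :* g)) :=
           ((a :* (f :* f)) :* (b :* (g' :* g')) :+ (a :* (g :* g)) :* (b :* (f' :* f'))) :-
           (con 1ℚ :+ con 1ℚ) :* (a :* (f :* g)) :* (b :* (f' :* g')))
           refl (w x) (w y) (F x) (F y) (G x) (G y)) ⟩
    (∫ μ λ x → ∫ μ λ y → (A x · B y ⊞ B x · A y) ⊟ two · C x · C y)
      ≡⟨ (∫-cong λ x → ∫-linear₃ (λ y → A x · B y) (λ y → B x · A y) (λ y → two · C x · C y)) ⟩
    (∫ μ λ x → (∫ μ (λ y → A x · B y) ⊞ ∫ μ (λ y → B x · A y)) ⊟ ∫ μ (λ y → two · C x · C y))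
      ≡⟨ ∫-linear₃ _ _ _ ⟩
    (∫ μ (λ x → ∫ μ (λ y → A x · B y)) ⊞ ∫ μ (λ x → ∫ μ (λ y → B x · A y))) ⊟ ∫ μ (λ x → ∫ μ (λ y → two · C x · C y))
      ≡⟨ cong₂ _⊟_ (cong₂ _⊞_ (∫-sep A B) (∫-sep B A)) (trans (∫-sep (λ x → two · C x) C) (cong (_· R) (∫-· two C))) ⟩
    (P · Q ⊞ Q · P) ⊟ two · R · R
      ≡⟨ solve 3 (λ p q r → (p :* q :+ q :* p) :- (con 1ℚ :+ con 1ℚ) :* r :* r := (p :* q :- r :* r) :+ (p :* q :- r :* r)) refl P Q R ⟩
    (P · Q ⊟ R · R) ⊞ (P · Q ⊟ R · R) ∎
    where
    A B C : _ → ℚ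
    A x = w x · (F x · F x)
    B x = w x · (G x · G x)
    C x = w x · (F x · G x)

cauchy-schwarz : ∀ {X : Set} {μ : Measure X} (F G : X → ℚ) →
  ∫ μ (λ x → F x · G x) · ∫ μ (λ x → F x · G x) ≤ ∫ μ (λ x → F x · F x) · ∫ μ (λ x → G x · G x)
cauchy-schwarz {μ = μ} F G = subst₂ _≤_ (cong₂ _·_ e e) (cong₂ _·_ e e)
  (cauchy-schwarz-weighted (λ _ → 1ℚ) F G (λ _ → 0≤1))
  where
  e : ∀ {H : _ → ℚ} → ∫ μ (λ x → 1ℚ · H x) ≡ ∫ μ H
  e = ∫-cong λ x → ·-idˡ _

-- The form in which Cauchy-Schwarz strips a bounded factor `F` from a mean of products.
cauchy-schwarz-≤1 : ∀ {X : Set} {μ : Measure X} → IsProb μ → (F G : X → ℚ) → (∀ x → F x · F x ≤ 1ℚ) →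
  ∫ μ (λ x → F x · G x) · ∫ μ (λ x → F x · G x) ≤ ∫ μ (λ x → G x · G x)
cauchy-schwarz-≤1 {μ = μ} hμ F G hF = ≤-trans (cauchy-schwarz F G)
  (·-≤ʳ (∫-nonNeg λ x → 0≤sq (G x)) (≤-trans (∫-mono hF) (≤-reflexive hμ)))

jensen : ∀ {X : Set} {μ : Measure X} → IsProb μ → (F : X → ℚ) → ∫ μ F · ∫ μ F ≤ ∫ μ (λ x → F x · F x)
jensen {μ = μ} hμ F = subst (λ s → s · s ≤ ∫ μ (λ x → F x · F x)) (∫-cong λ x → ·-idˡ (F x))
  (cauchy-schwarz-≤1 hμ (λ _ → 1ℚ) F (λ _ → ≤-reflexive (·-idˡ 1ℚ)))

infixr 5 _⊗_

_⊗_ : ∀ {X Y : Set} → Measure X → Measure Y → Measure (X × Y)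
μ ⊗ ν = measure (wt μ · wt ν) (·-nonNeg (wt≥0 μ) (wt≥0 ν))
          (L.concatMap (λ x → L.map (x ,_) (pts ν)) (pts μ))

∫-⊗ : ∀ {X Y : Set} {μ : Measure X} {ν : Measure Y} (F : X × Y → ℚ) →
  ∫ (μ ⊗ ν) F ≡ (∫ μ λ x → ∫ ν λ y → F (x , y))
∫-⊗ {μ = μ} {ν} F = begin-equality
  ∫ (μ ⊗ ν) F
    ≡⟨ ∫-def (μ ⊗ ν) F ⟩
  wt μ · wt ν · sumL (pts (μ ⊗ ν)) F
    ≡⟨ cong (wt μ · wt ν ·_) (trans (sumL-concatMap _ (pts μ) F) (sumL-cong (pts μ) λ x → sumL-map (x ,_) (pts ν) F)) ⟩
  wt μ · wt ν · sumL (pts μ) (λ x → sumL (pts ν) (λ y → F (x , y)))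
    ≡⟨ ·-assoc (wt μ) (wt ν) _ ⟩
  wt μ · (wt ν · sumL (pts μ) (λ x → sumL (pts ν) (λ y → F (x , y))))
    ≡⟨ cong (wt μ ·_) (sym (sumL-· (pts μ) (wt ν) _)) ⟩
  wt μ · sumL (pts μ) (λ x → wt ν · sumL (pts ν) (λ y → F (x , y)))
    ≡⟨ cong (wt μ ·_) (sumL-cong (pts μ) λ x → sym (∫-def ν _)) ⟩
  wt μ · sumL (pts μ) (λ x → ∫ ν (λ y → F (x , y)))
    ≡⟨ sym (∫-def μ _) ⟩
  (∫ μ λ x → ∫ ν λ y → F (x , y)) ∎

ind : ∀ {P : Set} → Dec P → ℚ
ind d = 𝟙 ⌊ d ⌋

ind≥0 : ∀ {P : Set} (d : Dec P) → 0ℚ ≤ ind d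
ind≥0 d = 𝟙≥0 ⌊ d ⌋

ind≤1 : ∀ {P : Set} (d : Dec P) → ind d ≤ 1ℚ
ind≤1 d = 𝟙≤1 ⌊ d ⌋

ind-yes : ∀ {P : Set} (d : Dec P) → P → ind d ≡ 1ℚ
ind-yes (yes _) _ = refl
ind-yes (no ¬p) p = ⊥-elim (¬p p)

ind-no : ∀ {P : Set} (d : Dec P) → ¬ P → ind d ≡ 0ℚ
ind-no (yes p) ¬p = ⊥-elim (¬p p)
ind-no (no _)  _  = refl

ind-≤ : ∀ {P : Set} (d : Dec P) {q} → 0ℚ ≤ q → (P → 1ℚ ≤ q) → ind d ≤ q
ind-≤ (yes p) _ h = h p
ind-≤ (no _)  h _ = h

-- Self-dual weights and positive definiteness

-- An elementary abelian 2-group with an invariant measure and a weight equal to its own Fourier transform.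
record SelfDualWeight (G : Set) : Set where
  infixr 7 _∙_
  field
    _∙_       : G → G → G
    ε         : G
    ∙-assoc   : ∀ x y z → (x ∙ y) ∙ z ≡ x ∙ (y ∙ z)
    ∙-comm    : ∀ x y → x ∙ y ≡ y ∙ x
    ∙-idˡ     : ∀ x → ε ∙ x ≡ x
    ∙-self    : ∀ x → x ∙ x ≡ ε
    μ         : Measure G
    complete  : ∀ x → x ∈ pts μ
    invariant : ∀ a (F : G → ℚ) → ∫ μ (λ x → F (a ∙ x)) ≡ ∫ μ F
    w         : G → ℚ
    w≥0       : ∀ x → 0ℚ ≤ w x
    w≤1       : ∀ x → w x ≤ 1ℚ
    w-mass    : ∫ μ w ≡ 1ℚ
    char      : G → G → ℚ
    char-sym  : ∀ x y → char x y ≡ char y x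
    char-∙    : ∀ x y z → char (x ∙ y) z ≡ char x z · char y z
    self-dual : ∀ x → w x ≡ ∫ μ (λ y → w y · char x y)

energy : ∀ {G : Set} → SelfDualWeight G → ℚ
energy D = ∫ μ (λ x → w x · w x)
  where open SelfDualWeight D

module SelfDual {G : Set} (D : SelfDualWeight G) where
  open SelfDualWeight D

  ∙-cancel : ∀ x y → x ∙ (x ∙ y) ≡ y
  ∙-cancel x y = trans (sym (∙-assoc x x y)) (trans (cong (_∙ y) (∙-self x)) (∙-idˡ y))

  ∙-idʳ : ∀ x → x ∙ ε ≡ x
  ∙-idʳ x = trans (∙-comm x ε) (∙-idˡ x)

  ∙-swap : ∀ x y z → x ∙ (y ∙ z) ≡ y ∙ (x ∙ z)
  ∙-swap x y z = trans (sym (∙-assoc x y z)) (trans (cong (_∙ z) (∙-comm x y)) (∙-assoc y x z))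

  ∙-telescope : ∀ x y z → (x ∙ y) ∙ (x ∙ z) ≡ y ∙ z
  ∙-telescope x y z = trans (∙-assoc x y (x ∙ z)) (trans (cong (x ∙_) (∙-swap y x z)) (∙-cancel x (y ∙ z)))

  -- Elements are their own inverses, so `x ∙ y` is a difference and this is the ordinary
  -- convolution.
  conv : (G → ℚ) → (G → ℚ) → G → ℚ
  conv p q x = ∫ μ (λ y → p y · q (x ∙ y))

  conv≥0 : ∀ {p q} → (∀ x → 0ℚ ≤ p x) → (∀ x → 0ℚ ≤ q x) → ∀ x → 0ℚ ≤ conv p q x
  conv≥0 hp hq x = ∫-nonNeg λ y → ·-nonNeg (hp y) (hq (x ∙ y))

  ∫-conv : ∀ p q → ∫ μ (conv p q) ≡ ∫ μ p · ∫ μ q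
  ∫-conv p q = begin-equality
    (∫ μ λ x → ∫ μ λ y → p y · q (x ∙ y)) ≡⟨ ∫-swap _ ⟩
    (∫ μ λ y → ∫ μ λ x → p y · q (x ∙ y)) ≡⟨ (∫-cong λ y → trans (∫-cong λ x → cong (λ t → p y · q t) (∙-comm x y)) (invariant y (λ t → p y · q t))) ⟩
    (∫ μ λ y → ∫ μ λ x → p y · q x) ≡⟨ ∫-sep p q ⟩
    ∫ μ p · ∫ μ q ∎

  conv-shift : ∀ p q u v → ∫ μ (λ y → p (u ∙ y) · q (y ∙ v)) ≡ conv p q (u ∙ v)
  conv-shift p q u v = begin-equality
    ∫ μ (λ y → p (u ∙ y) · q (y ∙ v)) ≡⟨ sym (invariant u _) ⟩
    ∫ μ (λ y → p (u ∙ (u ∙ y)) · q ((u ∙ y) ∙ v)) ≡⟨ (∫-cong λ y → cong₂ (λ s t → p s · q t) (∙-cancel u y)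
            (trans (∙-assoc u y v) (trans (cong (u ∙_) (∙-comm y v)) (sym (∙-assoc u v y))))) ⟩
    conv p q (u ∙ v) ∎

  ∫-charʳ : ∀ x → ∫ μ (λ y → w y · char y x) ≡ w x
  ∫-charʳ x = trans (∫-cong λ y → cong (w y ·_) (char-sym y x)) (sym (self-dual x))

  ft : (G → ℚ) → G → ℚ
  ft u z = ∫ μ (λ x → u x · char x z)

  -- Positive definiteness of w.
  w-form : ∀ u v → (∫ μ λ x → ∫ μ λ y → (u x · v y) · w (x ∙ y)) ≡ ∫ μ (λ z → w z · (ft u z · ft v z))
  w-form u v = begin-equality
    (∫ μ λ x → ∫ μ λ y → (u x · v y) · w (x ∙ y))
      ≡⟨ (∫-cong λ x → ∫-cong λ y → trans (cong ((u x · v y) ·_) (self-dual (x ∙ y))) (sym (∫-· (u x · v y) _))) ⟩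
    (∫ μ λ x → ∫ μ λ y → ∫ μ λ z → (u x · v y) · (w z · char (x ∙ y) z))
      ≡⟨ (∫-cong λ x → ∫-swap _) ⟩
    (∫ μ λ x → ∫ μ λ z → ∫ μ λ y → (u x · v y) · (w z · char (x ∙ y) z))
      ≡⟨ ∫-swap _ ⟩
    (∫ μ λ z → ∫ μ λ x → ∫ μ λ y → (u x · v y) · (w z · char (x ∙ y) z))
      ≡⟨ (∫-cong λ z → ∫-cong λ x → ∫-cong λ y → trans (cong (λ t → (u x · v y) · (w z · t)) (char-∙ x y z))
           (solve 5 (λ a b c d e → (a :* b) :* (c :* (d :* e)) := (c :* (a :* d)) :* (b :* e)) refl (u x) (v y) (w z) (char x z) (char y z))) ⟩
    (∫ μ λ z → ∫ μ λ x → ∫ μ λ y → (w z · (u x · char x z)) · (v y · char y z))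
      ≡⟨ (∫-cong λ z → trans (∫-sep (λ x → w z · (u x · char x z)) (λ y → v y · char y z))
           (trans (cong (_· ft v z) (∫-· (w z) _)) (·-assoc (w z) (ft u z) (ft v z)))) ⟩
    ∫ μ (λ z → w z · (ft u z · ft v z)) ∎

  w-square-mean : ∀ F → ∫ μ (λ x → w x · F x) · ∫ μ (λ x → w x · F x) ≤ ∫ μ (λ x → w x · (F x · F x))
  w-square-mean F = subst₂ _≤_ (cong₂ _·_ e e) e′ (cauchy-schwarz-weighted w F (λ _ → 1ℚ) w≥0)
    where
    e : ∫ μ (λ x → w x · (F x · 1ℚ)) ≡ ∫ μ (λ x → w x · F x)
    e = ∫-cong λ x → cong (w x ·_) (·-idʳ (F x))
    e′ : ∫ μ (λ x → w x · (F x · F x)) · ∫ μ (λ x → w x · (1ℚ · 1ℚ)) ≡ ∫ μ (λ x → w x · (F x · F x))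
    e′ = trans (cong (∫ μ (λ x → w x · (F x · F x)) ·_) (trans (∫-cong λ x → solve 1 (λ a → a :* (con 1ℚ :* con 1ℚ) := a) refl (w x)) w-mass)) (·-idʳ _)

  -- By `w-form` the right side is the `w`-mean of the squared transform of `u`, hence at least the
  -- square of its `w`-mean; self-duality turns that mean back into the integral of `u x · w x`.
  w-form-lower : ∀ u → ∫ μ (λ x → u x · w x) · ∫ μ (λ x → u x · w x) ≤ (∫ μ λ x → ∫ μ λ y → (u x · u y) · w (x ∙ y))
  w-form-lower u = subst₂ (λ s t → s · s ≤ t) e (sym (w-form u u)) (w-square-mean (ft u))
    where
    e : ∫ μ (λ z → w z · ft u z) ≡ ∫ μ (λ x → u x · w x)
    e = begin-equality
      ∫ μ (λ z → w z · ft u z) ≡⟨ (∫-cong λ z → sym (∫-· (w z) _)) ⟩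
      (∫ μ λ z → ∫ μ λ x → w z · (u x · char x z)) ≡⟨ ∫-swap _ ⟩
      (∫ μ λ x → ∫ μ λ z → w z · (u x · char x z)) ≡⟨ (∫-cong λ x → trans (∫-cong λ z →
            solve 3 (λ a b c → a :* (b :* c) := b :* (a :* c)) refl (w z) (u x) (char x z)) (∫-· (u x) _)) ⟩
      ∫ μ (λ x → u x · ∫ μ (λ z → w z · char x z)) ≡⟨ (∫-cong λ x → cong (u x ·_) (sym (self-dual x))) ⟩
      ∫ μ (λ x → u x · w x) ∎

  g : G → ℚ
  g = conv w w

  g≥0 : ∀ x → 0ℚ ≤ g x
  g≥0 = conv≥0 w≥0 w≥0

  g-mass : ∫ μ g ≡ 1ℚ
  g-mass = trans (∫-conv w w) (trans (cong₂ _·_ w-mass w-mass) (·-idˡ 1ℚ))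

  -- `w-form` with `u` and `v` both equal to `w`, whose transforms are `w` again.
  ∫wg : ∫ μ (λ x → w x · g x) ≡ ∫ μ (λ x → w x · (w x · w x))
  ∫wg = begin-equality
    ∫ μ (λ x → w x · g x) ≡⟨ (∫-cong λ x → trans (sym (∫-· (w x) _)) (∫-cong λ y → sym (·-assoc (w x) (w y) (w (x ∙ y))))) ⟩
    (∫ μ λ x → ∫ μ λ y → (w x · w y) · w (x ∙ y)) ≡⟨ w-form w w ⟩
    ∫ μ (λ z → w z · (ft w z · ft w z)) ≡⟨ (∫-cong λ z → cong (λ t → w z · (t · t)) (∫-charʳ z)) ⟩
    ∫ μ (λ x → w x · (w x · w x)) ∎

  -- The third moment of `w`, which is the integral of `w x · g x`, is at least the square of the
  -- second, hence at least `c = δ · δ`. As `g` has mass 1, integrating the nonnegative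
  -- `(w x ⊟ c) · (w x ⊟ c) · g x` then yields `c · c`.
  ∫wwg-lower : ∀ {δ} → 0ℚ ≤ δ → δ ≤ energy D →
    (δ · δ) · (δ · δ) ≤ ∫ μ (λ x → (w x · w x) · g x)
  ∫wwg-lower {δ} hδ h = begin
    c · c ≡⟨ solve 1 (λ c → c :* c := (c :+ c) :* c :- (c :* c) :* con 1ℚ) refl c ⟩
    (c ⊞ c) · c ⊟ (c · c) · 1ℚ ≤⟨ ⊟-mono (·-monoˡ (⊞-nonNeg (0≤sq δ) (0≤sq δ)) c≤W) ≤-refl ⟩
    (c ⊞ c) · ∫ μ (λ x → w x · g x) ⊟ (c · c) · 1ℚ ≡⟨ cong₂ _⊟_ (sym (∫-· (c ⊞ c) _)) (trans (cong ((c · c) ·_) (sym g-mass)) (sym (∫-· (c · c) g))) ⟩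
    ∫ μ (λ x → (c ⊞ c) · (w x · g x)) ⊟ ∫ μ (λ x → (c · c) · g x) ≡⟨ sym (∫-⊟ _ _) ⟩
    ∫ μ (λ x → (c ⊞ c) · (w x · g x) ⊟ (c · c) · g x) ≤⟨ (∫-mono λ x → ≤-by (((w x ⊟ c) · (w x ⊟ c)) · g x) (·-nonNeg (0≤sq (w x ⊟ c)) (g≥0 x))
            (solve 3 (λ c w g → (w :* w) :* g := ((c :+ c) :* (w :* g) :- (c :* c) :* g) :+ ((w :- c) :* (w :- c)) :* g) refl c (w x) (g x))) ⟩
    ∫ μ (λ x → (w x · w x) · g x) ∎
    where
    c = δ · δ
    c≤W : c ≤ ∫ μ (λ x → w x · g x)
    c≤W = begin
      δ · δ ≤⟨ ·-mono-sq hδ h ⟩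
      ∫ μ (λ x → w x · w x) · ∫ μ (λ x → w x · w x) ≤⟨ w-square-mean w ⟩
      ∫ μ (λ x → w x · (w x · w x)) ≡⟨ sym ∫wg ⟩
      ∫ μ (λ x → w x · g x) ∎

  -- The weighted neighbourhood of `y` in a Cayley graph: `x` counts when both `x` and its
  -- difference from `y` are heavy.
  b : G → G → ℚ
  b y x = w x · w (y ∙ x)

  b≥0 : ∀ y x → 0ℚ ≤ b y x
  b≥0 y x = ·-nonNeg (w≥0 x) (w≥0 (y ∙ x))

  b≤1 : ∀ y x → b y x ≤ 1ℚ
  b≤1 y x = ·-≤1 (w≥0 x) (w≤1 x) (w≤1 (y ∙ x))

  ∫b≤1 : ∀ y → ∫ μ (b y) ≤ 1ℚ
  ∫b≤1 y = ≤-trans (∫-mono λ x → ·-≤ˡ (w≥0 x) (w≤1 (y ∙ x))) (≤-reflexive w-mass)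

  -- By `w-form-lower` the popular differences of `b y` carry `w`-mass controlled by `γ y · γ y`; so
  -- it is `γ y`, and not the total mass of `b y`, that has to be large.
  γ : G → ℚ
  γ y = ∫ μ (λ x → b y x · w x)

  γ≥0 : ∀ y → 0ℚ ≤ γ y
  γ≥0 y = ∫-nonNeg λ x → ·-nonNeg (b≥0 y x) (w≥0 x)

  γ≤1 : ∀ y → γ y ≤ 1ℚ
  γ≤1 y = ≤-trans (∫-mono λ x → ·-≤ˡ (b≥0 y x) (w≤1 x)) (∫b≤1 y)

  ∫wγ : ∫ μ (λ y → w y · γ y) ≡ ∫ μ (λ x → (w x · w x) · g x)
  ∫wγ = begin-equality
    ∫ μ (λ y → w y · γ y) ≡⟨ (∫-cong λ y → sym (∫-· (w y) _)) ⟩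
    (∫ μ λ y → ∫ μ λ x → w y · ((w x · w (y ∙ x)) · w x)) ≡⟨ ∫-swap _ ⟩
    (∫ μ λ x → ∫ μ λ y → w y · ((w x · w (y ∙ x)) · w x)) ≡⟨ (∫-cong λ x → ∫-cong λ y → trans (cong (λ t → w y · ((w x · w t) · w x)) (∙-comm y x))
            (solve 3 (λ a b c → a :* ((b :* c) :* b) := (b :* b) :* (a :* c)) refl (w y) (w x) (w (x ∙ y)))) ⟩
    (∫ μ λ x → ∫ μ λ y → (w x · w x) · (w y · w (x ∙ y))) ≡⟨ (∫-cong λ x → ∫-· (w x · w x) _) ⟩
    ∫ μ (λ x → (w x · w x) · g x) ∎

  -- Dependent random choice

  module Threshold (η : ℚ) (η≥0 : 0ℚ ≤ η) where

    bad : G → ℚ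
    bad z = ind (g z ℚₚ.<? η)

    bad≥0 : ∀ z → 0ℚ ≤ bad z
    bad≥0 z = ind≥0 (g z ℚₚ.<? η)

    bad≤1 : ∀ z → bad z ≤ 1ℚ
    bad≤1 z = ind≤1 (g z ℚₚ.<? η)

    bad·g≤η : ∀ z → bad z · g z ≤ η
    bad·g≤η z with g z ℚₚ.<? η
    ... | yes p = ≤-trans (≤-reflexive (·-idˡ (g z))) (<⇒≤ p)
    ... | no _  = ≤-trans (≤-reflexive (·-zeroˡ (g z))) η≥0

    η·good≤g : ∀ z → η · (1ℚ ⊟ bad z) ≤ g z
    η·good≤g z with g z ℚₚ.<? η
    ... | yes _ = ≤-trans (≤-reflexive (solve 1 (λ a → a :* (con 1ℚ :- con 1ℚ) := con 0ℚ) refl η)) (g≥0 z)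
    ... | no ¬p = ≤-trans (≤-reflexive (solve 1 (λ a → a :* (con 1ℚ :- con 0ℚ) := a) refl η)) (≮⇒≥ ¬p)

    badMass : G → ℚ
    badMass y = ∫ μ λ x → ∫ μ λ x′ → (b y x · b y x′) · bad (x ∙ x′)

    badMass≥0 : ∀ y → 0ℚ ≤ badMass y
    badMass≥0 y = ∫-nonNeg λ x → ∫-nonNeg λ x′ → ·-nonNeg (·-nonNeg (b≥0 y x) (b≥0 y x′)) (bad≥0 (x ∙ x′))

    ∫ww-shift : ∀ x x′ → ∫ μ (λ y → w (y ∙ x) · w (y ∙ x′)) ≡ g (x ∙ x′)
    ∫ww-shift x x′ = trans (∫-cong λ y → cong (λ t → w t · w (y ∙ x′)) (∙-comm y x)) (conv-shift w w x x′)

    -- Integrated over `y` first, a pair gets the weight `w x · w x′ · g (x ∙ x′)`, and on a bad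
    -- pair the last factor is below `η`.
    ∫badMass : ∫ μ badMass ≤ η
    ∫badMass = begin
      (∫ μ λ y → ∫ μ λ x → ∫ μ λ x′ → (b y x · b y x′) · bad (x ∙ x′)) ≡⟨ ∫-swap _ ⟩
      (∫ μ λ x → ∫ μ λ y → ∫ μ λ x′ → (b y x · b y x′) · bad (x ∙ x′)) ≡⟨ (∫-cong λ x → ∫-swap _) ⟩
      (∫ μ λ x → ∫ μ λ x′ → ∫ μ λ y → (b y x · b y x′) · bad (x ∙ x′)) ≡⟨ (∫-cong λ x → ∫-cong λ x′ → trans (∫-cong λ y →
          solve 5 (λ p q r s t → ((p :* q) :* (r :* s)) :* t := ((p :* r) :* t) :* (q :* s)) refl (w x) (w (y ∙ x)) (w x′) (w (y ∙ x′)) (bad (x ∙ x′)))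
          (trans (∫-· ((w x · w x′) · bad (x ∙ x′)) _) (cong (((w x · w x′) · bad (x ∙ x′)) ·_) (∫ww-shift x x′)))) ⟩
      (∫ μ λ x → ∫ μ λ x′ → ((w x · w x′) · bad (x ∙ x′)) · g (x ∙ x′)) ≤⟨ (∫-mono λ x → ∫-mono λ x′ → ≤-trans (≤-reflexive (·-assoc (w x · w x′) _ _))
          (·-monoˡ (·-nonNeg (w≥0 x) (w≥0 x′)) (bad·g≤η (x ∙ x′)))) ⟩
      (∫ μ λ x → ∫ μ λ x′ → (w x · w x′) · η) ≡⟨ (∫-cong λ x → ∫-·ʳ η _) ⟩
      (∫ μ λ x → ∫ μ (λ x′ → w x · w x′) · η) ≡⟨ ∫-·ʳ η _ ⟩
      (∫ μ λ x → ∫ μ λ x′ → w x · w x′) · η ≡⟨ cong (_· η) (trans (∫-sep w w) (cong₂ _·_ w-mass w-mass)) ⟩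
      1ℚ · 1ℚ · η ≡⟨ solve 1 (λ a → con 1ℚ :* con 1ℚ :* a := a) refl η ⟩
      η ∎

    -- Averaging over the neighbourhoods b y: the weight w y favours the y with γ y large,
    -- while a pair x, x′ with g (x ∙ x′) small lies in few neighbourhoods.
    choose : ∀ {δ θ ρ} → 0ℚ ≤ δ → δ ≤ energy D → 0ℚ ≤ θ →
      η ⊞ ρ < θ · (((δ · δ) · (δ · δ)) · ((δ · δ) · (δ · δ))) →
      ∃ λ y → badMass y ⊞ ρ < θ · (γ y · γ y)
    choose {δ} {θ} {ρ} hδ h hθ hρ = conclude (∫-pos F (<-≤-trans gap lower))
      where
      d = (δ · δ) · (δ · δ)
      F : G → ℚ
      F y = w y · (θ · (γ y · γ y) ⊟ (badMass y ⊞ ρ))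
      -- Jensen once more, for the density `w`; this brings the exponent of `δ` to 8.
      d≤ : d · d ≤ ∫ μ (λ y → w y · (γ y · γ y))
      d≤ = ≤-trans (·-mono-sq (0≤sq (δ · δ)) (≤-trans (∫wwg-lower hδ h) (≤-reflexive (sym ∫wγ)))) (w-square-mean γ)
      gap : 0ℚ < θ · (d · d) ⊟ (η ⊞ ρ)
      gap = subst (_< θ · (d · d) ⊟ (η ⊞ ρ)) (⊞-inverseʳ (η ⊞ ρ)) (⊞-mono-<-≤ hρ ≤-refl)
      lower : θ · (d · d) ⊟ (η ⊞ ρ) ≤ ∫ μ F
      lower = begin
        θ · (d · d) ⊟ (η ⊞ ρ)
          -- `w y ≤ 1` lets the unweighted bound on `badMass` serve under the weight `w y`.
          ≤⟨ ⊟-mono (·-monoˡ hθ d≤) (⊞-mono (≤-trans (∫-mono λ y → ·-≤ʳ (badMass≥0 y) (w≤1 y)) ∫badMass) ≤-refl) ⟩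
        θ · ∫ μ (λ y → w y · (γ y · γ y)) ⊟ (∫ μ (λ y → w y · badMass y) ⊞ ρ)
          ≡⟨ cong₂ _⊟_ (sym (∫-· θ _)) (cong (∫ μ (λ y → w y · badMass y) ⊞_) (trans (sym (·-idˡ ρ)) (trans (cong (_· ρ) (sym w-mass)) (sym (∫-·ʳ ρ w))))) ⟩
        ∫ μ (λ y → θ · (w y · (γ y · γ y))) ⊟ (∫ μ (λ y → w y · badMass y) ⊞ ∫ μ (λ y → w y · ρ))
          ≡⟨ cong (∫ μ (λ y → θ · (w y · (γ y · γ y))) ⊟_) (sym (∫-⊞ _ _)) ⟩
        ∫ μ (λ y → θ · (w y · (γ y · γ y))) ⊟ ∫ μ (λ y → w y · badMass y ⊞ w y · ρ)
          ≡⟨ sym (∫-⊟ _ _) ⟩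
        ∫ μ (λ y → θ · (w y · (γ y · γ y)) ⊟ (w y · badMass y ⊞ w y · ρ))
          ≡⟨ (∫-cong λ y → solve 5 (λ θ w γ m ρ → θ :* (w :* (γ :* γ)) :- (w :* m :+ w :* ρ) := w :* (θ :* (γ :* γ) :- (m :+ ρ))) refl θ (w y) (γ y) (badMass y) ρ) ⟩
        ∫ μ F ∎
      conclude : (∃ λ y → 0ℚ < F y) → ∃ λ y → badMass y ⊞ ρ < θ · (γ y · γ y)
      conclude (y , p) = y , subst₂ _<_ (⊞-idˡ _)
        (solve 2 (λ a b → (a :- b) :+ b := a) refl (θ · (γ y · γ y)) (badMass y ⊞ ρ))
        (⊞-mono-<-≤ (·-cancelˡ-< (w≥0 y) (subst (_< F y) (sym (·-zeroʳ (w y))) p)) (≤-refl {badMass y ⊞ ρ}))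

-- Popular differences and the count of 4-cycles

module Popular {G : Set} (D : SelfDualWeight G) (η : ℚ) (η≥0 : 0ℚ ≤ η) (y : G) (κ θ : ℚ) (κ≥0 : 0ℚ ≤ κ)
  (κ≤ : κ ⊞ κ ≤ SelfDual.γ D y · SelfDual.γ D y) (bad≤θ : SelfDual.Threshold.badMass D η η≥0 y ≤ θ) where
  open SelfDualWeight D
  open SelfDual D
  open Threshold η η≥0

  β : G → ℚ
  β = b y

  β≥0 : ∀ x → 0ℚ ≤ β x
  β≥0 = b≥0 y

  β≤1 : ∀ x → β x ≤ 1ℚ
  β≤1 = b≤1 y

  ∫β·≤ : ∀ {q} → 0ℚ ≤ q → ∫ μ (λ x → β x · q) ≤ q
  ∫β·≤ {q} hq = ≤-trans (≤-reflexive (∫-·ʳ q β)) (·-≤ʳ hq (∫b≤1 y))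

  ρ : G → G → ℚ
  ρ s u = β u · β (u ∙ s)

  ρ≥0 : ∀ s u → 0ℚ ≤ ρ s u
  ρ≥0 s u = ·-nonNeg (β≥0 u) (β≥0 (u ∙ s))

  ρ≤β : ∀ s u → ρ s u ≤ β u
  ρ≤β s u = ·-≤ˡ (β≥0 u) (β≤1 (u ∙ s))

  ρ≤β′ : ∀ s u → ρ s u ≤ β (u ∙ s)
  ρ≤β′ s u = ·-≤ʳ (β≥0 (u ∙ s)) (β≤1 u)

  ρ≤1 : ∀ s u → ρ s u ≤ 1ℚ
  ρ≤1 s u = ≤-trans (ρ≤β s u) (β≤1 u)

  r : G → ℚ
  r x = ∫ μ (ρ x)

  r≤1 : ∀ x → r x ≤ 1ℚ
  r≤1 x = ≤-trans (∫-mono (ρ≤β x)) (∫b≤1 y)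

  -- Positive definiteness applied to `β`; the substitution of `u ∙ x` for `x` collects the pairs
  -- with a given difference.
  ∫rw-lower : γ y · γ y ≤ ∫ μ (λ x → r x · w x)
  ∫rw-lower = begin
    γ y · γ y ≤⟨ w-form-lower β ⟩
    (∫ μ λ u → ∫ μ λ x → (β u · β x) · w (u ∙ x)) ≡⟨ (∫-cong λ u → sym (invariant u _)) ⟩
    (∫ μ λ u → ∫ μ λ x → (β u · β (u ∙ x)) · w (u ∙ (u ∙ x))) ≡⟨ (∫-cong λ u → ∫-cong λ x → cong (λ t → ρ x u · w t) (∙-cancel u x)) ⟩
    (∫ μ λ u → ∫ μ λ x → ρ x u · w x) ≡⟨ ∫-swap _ ⟩
    (∫ μ λ x → ∫ μ λ u → ρ x u · w x) ≡⟨ (∫-cong λ x → ∫-·ʳ (w x) _) ⟩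
    ∫ μ (λ x → r x · w x) ∎

  S : G → Set
  S x = κ ≤ r x

  S? : ∀ x → Dec (S x)
  S? x = κ ℚₚ.≤? r x

  -- Outside `S` the integrand `r x · w x` is at most `κ · w x`, which accounts for at most `κ` of
  -- the total `κ ⊞ κ`; inside, `r x ≤ 1`.
  S-mass : κ ≤ ∫ μ (λ x → ind (S? x) · w x)
  S-mass = subst₂ _≤_ (solve 1 (λ k → (k :+ k) :- k := k) refl κ)
    (solve 2 (λ k a → (k :+ a) :- k := a) refl κ _)
    (⊟-mono (≤-trans κ≤ (≤-trans ∫rw-lower upper)) (≤-refl {κ}))
    where
    pointwise : ∀ x → r x · w x ≤ κ · w x ⊞ ind (S? x) · w x
    pointwise x with S? x
    ... | yes _ = ≤-trans (·-monoʳ (w≥0 x) (r≤1 x)) (≤-by (κ · w x) (·-nonNeg κ≥0 (w≥0 x)) (⊞-comm _ _))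
    ... | no ¬s = ≤-trans (·-monoʳ (w≥0 x) (<⇒≤ (≰⇒> ¬s))) (≤-reflexive (solve 2 (λ k a → k :* a := k :* a :+ con 0ℚ :* a) refl κ (w x)))
    upper : ∫ μ (λ x → r x · w x) ≤ κ ⊞ ∫ μ (λ x → ind (S? x) · w x)
    upper = begin
      ∫ μ (λ x → r x · w x) ≤⟨ ∫-mono pointwise ⟩
      ∫ μ (λ x → κ · w x ⊞ ind (S? x) · w x) ≡⟨ ∫-⊞ _ _ ⟩
      ∫ μ (λ x → κ · w x) ⊞ ∫ μ (λ x → ind (S? x) · w x) ≡⟨ cong (_⊞ ∫ μ (λ x → ind (S? x) · w x)) (trans (∫-· κ w) (trans (cong (κ ·_) w-mass) (·-idʳ κ))) ⟩
      κ ⊞ ∫ μ (λ x → ind (S? x) · w x) ∎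

  -- Chosen for their mass 1: where such a function is at least `ℓ`, the set has measure at most the
  -- reciprocal of `ℓ`.
  g² g³ g⁴ : G → ℚ
  g² = conv g g
  g³ = conv g g²
  g⁴ = conv g g³

  g⁴≥0 : ∀ x → 0ℚ ≤ g⁴ x
  g⁴≥0 = conv≥0 g≥0 (conv≥0 g≥0 (conv≥0 g≥0 g≥0))

  g⁴-mass : ∫ μ g⁴ ≡ 1ℚ
  g⁴-mass = begin-equality
    ∫ μ g⁴ ≡⟨ ∫-conv g g³ ⟩
    ∫ μ g · ∫ μ g³ ≡⟨ cong (∫ μ g ·_) (trans (∫-conv g g²) (cong (∫ μ g ·_) (∫-conv g g))) ⟩
    ∫ μ g · (∫ μ g · (∫ μ g · ∫ μ g)) ≡⟨ cong (λ t → t · (t · (t · t))) g-mass ⟩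
    1ℚ · (1ℚ · (1ℚ · 1ℚ)) ≡⟨ solve 0 (con 1ℚ :* (con 1ℚ :* (con 1ℚ :* con 1ℚ)) := con 1ℚ) refl ⟩
    1ℚ ∎

  ∫₄ : (G → G → G → G → ℚ) → ℚ
  ∫₄ F = ∫ μ λ a → ∫ μ λ b → ∫ μ λ c → ∫ μ λ d → F a b c d

  ∫₄-mono : ∀ {F F′} → (∀ a b c d → F a b c d ≤ F′ a b c d) → ∫₄ F ≤ ∫₄ F′
  ∫₄-mono h = ∫-mono λ a → ∫-mono λ b → ∫-mono λ c → ∫-mono λ d → h a b c d

  ∫₄-⊟ : ∀ F F′ → ∫₄ (λ a b c d → F a b c d ⊟ F′ a b c d) ≡ ∫₄ F ⊟ ∫₄ F′
  ∫₄-⊟ F F′ = trans (∫-cong λ a → trans (∫-cong λ b → trans (∫-cong λ c → ∫-⊟ (F a b c) (F′ a b c)) (∫-⊟ _ _)) (∫-⊟ _ _)) (∫-⊟ _ _)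

  ∫₄-· : ∀ q F → ∫₄ (λ a b c d → q · F a b c d) ≡ q · ∫₄ F
  ∫₄-· q F = trans (∫-cong λ a → trans (∫-cong λ b → trans (∫-cong λ c → ∫-· q (F a b c)) (∫-· q _)) (∫-· q _)) (∫-· q _)

  ∫₄-sep : ∀ p q s t → ∫₄ (λ a b c d → p a · (q b · (s c · t d))) ≡ ∫ μ p · (∫ μ q · (∫ μ s · ∫ μ t))
  ∫₄-sep p q s t = trans (∫-cong λ a → trans (∫-cong λ b → trans (∫-cong λ c → trans (∫-· (p a) _) (cong (p a ·_) (trans (∫-· (q b) _) (cong (q b ·_) (∫-· (s c) t)))))
      (trans (∫-· (p a) _) (cong (p a ·_) (trans (∫-· (q b) _) (cong (q b ·_) (∫-·ʳ (∫ μ t) s))))))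
      (trans (∫-· (p a) _) (cong (p a ·_) (∫-·ʳ (∫ μ s · ∫ μ t) q)))) (∫-·ʳ (∫ μ q · (∫ μ s · ∫ μ t)) p)

  -- What remains of a bad step from `a ∙ s` to `b` once the weights that do not touch it are
  -- discarded.
  link : G → G → G → ℚ
  link s a b = (β (a ∙ s) · β b) · bad ((a ∙ s) ∙ b)

  link≥0 : ∀ s a b → 0ℚ ≤ link s a b
  link≥0 s a b = ·-nonNeg (·-nonNeg (β≥0 (a ∙ s)) (β≥0 b)) (bad≥0 ((a ∙ s) ∙ b))

  ∫link : ∀ s → (∫ μ λ a → ∫ μ λ b → link s a b) ≤ θ
  ∫link s = ≤-trans (≤-reflexive (trans (∫-cong λ a → cong (λ t → ∫ μ λ b → (β t · β b) · bad (t ∙ b)) (∙-comm a s))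
    (invariant s (λ t → ∫ μ λ b → (β t · β b) · bad (t ∙ b))))) bad≤θ

  ρρbad≤link : ∀ s t a b → (ρ s a · ρ t b) · bad ((a ∙ s) ∙ b) ≤ link s a b
  ρρbad≤link s t a b = ·-monoʳ (bad≥0 ((a ∙ s) ∙ b)) (·-mono (ρ≥0 s a) (β≥0 b) (ρ≤β′ s a) (ρ≤β t b))

  -- Each `sᵢ` is the difference of two points weighted by `β`: `a` and `a ∙ s₁`, `b` and `b ∙ s₂`,
  -- and so on round a cycle. The links `(a ∙ s₁) ∙ b`, ..., `(d ∙ s₄) ∙ a` multiply to
  -- `s₁ ∙ s₂ ∙ s₃ ∙ s₄`. Popularity makes such cycles plentiful, few of them contain a bad link,
  -- and each of the others contributes a factor `η` per link to `g⁴`.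
  module Path (s₁ s₂ s₃ s₄ : G) (h₁ : S s₁) (h₂ : S s₂) (h₃ : S s₃) (h₄ : S s₄) where

    B₁ B₂ B₃ B₄ : G → G → ℚ
    B₁ a b = bad ((a ∙ s₁) ∙ b)
    B₂ b c = bad ((b ∙ s₂) ∙ c)
    B₃ c d = bad ((c ∙ s₃) ∙ d)
    B₄ d a = bad ((d ∙ s₄) ∙ a)

    W : G → G → G → G → ℚ
    W a b c d = ρ s₁ a · (ρ s₂ b · (ρ s₃ c · ρ s₄ d))

    W≥0 : ∀ a b c d → 0ℚ ≤ W a b c d
    W≥0 a b c d = ·-nonNeg (ρ≥0 s₁ a) (·-nonNeg (ρ≥0 s₂ b) (·-nonNeg (ρ≥0 s₃ c) (ρ≥0 s₄ d)))

    W≤β : ∀ a b c d → W a b c d ≤ β a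
    W≤β a b c d = ≤-trans (·-≤ˡ (ρ≥0 s₁ a) (·-≤1 (ρ≥0 s₂ b) (ρ≤1 s₂ b) (·-≤1 (ρ≥0 s₃ c) (ρ≤1 s₃ c) (ρ≤1 s₄ d)))) (ρ≤β s₁ a)

    κ⁴≤ : (κ · κ) · (κ · κ) ≤ ∫₄ W
    κ⁴≤ = begin
      (κ · κ) · (κ · κ) ≡⟨ solve 1 (λ k → (k :* k) :* (k :* k) := k :* (k :* (k :* k))) refl κ ⟩
      κ · (κ · (κ · κ)) ≤⟨ ·-mono κ≥0 r³≥0 h₁ (·-mono κ≥0 r²≥0 h₂ (·-mono κ≥0 (≤-trans κ≥0 h₄) h₃ h₄)) ⟩
      r s₁ · (r s₂ · (r s₃ · r s₄)) ≡⟨ sym (∫₄-sep (ρ s₁) (ρ s₂) (ρ s₃) (ρ s₄)) ⟩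
      ∫₄ W ∎
      where
      r²≥0 = ·-nonNeg (≤-trans κ≥0 h₃) (≤-trans κ≥0 h₄)
      r³≥0 = ·-nonNeg (≤-trans κ≥0 h₂) r²≥0

    -- The two differences away from the link integrate to at most 1, and `ρ` bounded by `β` at the
    -- link leaves the bad pairs of `β`, of mass at most `θ`. The other three links differ only in
    -- the order of integration.
    bad₁ : ∫₄ (λ a b c d → W a b c d · B₁ a b) ≤ θ
    bad₁ = ≤-trans (∫-mono λ a → ∫-mono λ b → ≤-trans (∫-mono λ c → ≤-trans (∫-mono λ d → bound a b c d)
      (∫β·≤ (·-nonNeg (β≥0 c) (link≥0 s₁ a b)))) (∫β·≤ (link≥0 s₁ a b))) (∫link s₁)
      where
      bound : ∀ a b c d → W a b c d · B₁ a b ≤ β d · (β c · link s₁ a b)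
      bound a b c d = ≤-trans (≤-reflexive (solve 5 (λ p q s t m → (p :* (q :* (s :* t))) :* m := t :* (s :* ((p :* q) :* m)))
          refl (ρ s₁ a) (ρ s₂ b) (ρ s₃ c) (ρ s₄ d) (B₁ a b)))
        (·-mono (ρ≥0 s₄ d) (·-nonNeg (β≥0 c) (link≥0 s₁ a b)) (ρ≤β s₄ d) (·-mono (ρ≥0 s₃ c) (link≥0 s₁ a b) (ρ≤β s₃ c) (ρρbad≤link s₁ s₂ a b)))

    bad₂ : ∫₄ (λ a b c d → W a b c d · B₂ b c) ≤ θ
    bad₂ = ≤-trans (∫-mono λ a → ≤-trans (∫-mono λ b → ∫-mono λ c → ≤-trans (∫-mono λ d → bound a b c d)
      (∫β·≤ (·-nonNeg (β≥0 a) (link≥0 s₂ b c)))) (≤-trans (≤-reflexive (trans (∫-cong λ b → ∫-· (β a) _) (∫-· (β a) _))) (·-monoˡ (β≥0 a) (∫link s₂))))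
      (∫β·≤ (≤-trans (∫-nonNeg λ b → ∫-nonNeg λ c → link≥0 s₂ b c) (∫link s₂)))
      where
      bound : ∀ a b c d → W a b c d · B₂ b c ≤ β d · (β a · link s₂ b c)
      bound a b c d = ≤-trans (≤-reflexive (solve 5 (λ p q s t m → (p :* (q :* (s :* t))) :* m := t :* (p :* ((q :* s) :* m)))
          refl (ρ s₁ a) (ρ s₂ b) (ρ s₃ c) (ρ s₄ d) (B₂ b c)))
        (·-mono (ρ≥0 s₄ d) (·-nonNeg (β≥0 a) (link≥0 s₂ b c)) (ρ≤β s₄ d) (·-mono (ρ≥0 s₁ a) (link≥0 s₂ b c) (ρ≤β s₁ a) (ρρbad≤link s₂ s₃ b c)))

    bad₃ : ∫₄ (λ a b c d → W a b c d · B₃ c d) ≤ θ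
    bad₃ = ≤-trans (∫-mono λ a → ∫-mono λ b → ≤-trans (∫-mono λ c → ∫-mono λ d → bound a b c d)
        (≤-trans (≤-reflexive (trans (∫-cong λ c → ∫-· (β b · β a) _) (∫-· (β b · β a) _))) (·-monoˡ (·-nonNeg (β≥0 b) (β≥0 a)) (∫link s₃))))
      (≤-trans (∫-mono λ a → ≤-trans (≤-reflexive (∫-cong λ b → ·-assoc (β b) (β a) θ)) (∫β·≤ (·-nonNeg (β≥0 a) θ≥0))) (∫β·≤ θ≥0))
      where
      θ≥0 : 0ℚ ≤ θ
      θ≥0 = ≤-trans (∫-nonNeg λ c → ∫-nonNeg λ d → link≥0 s₃ c d) (∫link s₃)
      bound : ∀ a b c d → W a b c d · B₃ c d ≤ (β b · β a) · link s₃ c d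
      bound a b c d = ≤-trans (≤-reflexive (solve 5 (λ p q s t m → (p :* (q :* (s :* t))) :* m := (q :* p) :* ((s :* t) :* m))
          refl (ρ s₁ a) (ρ s₂ b) (ρ s₃ c) (ρ s₄ d) (B₃ c d)))
        (·-mono (·-nonNeg (ρ≥0 s₂ b) (ρ≥0 s₁ a)) (link≥0 s₃ c d) (·-mono (ρ≥0 s₂ b) (β≥0 a) (ρ≤β s₂ b) (ρ≤β s₁ a)) (ρρbad≤link s₃ s₄ c d))

    bad₄ : ∫₄ (λ a b c d → W a b c d · B₄ d a) ≤ θ
    bad₄ = ≤-trans (∫-mono λ a → ≤-trans (∫-mono λ b → ≤-trans (∫-mono λ c →
        ≤-trans (∫-mono λ d → bound a b c d) (≤-reflexive (trans (∫-cong λ d → sym (·-assoc (β c) (β b) (link s₄ d a))) (trans (∫-· (β c · β b) _) (·-assoc (β c) (β b) _)))))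
        (∫β·≤ (·-nonNeg (β≥0 b) (L≥0 a)))) (∫β·≤ (L≥0 a)))
      (≤-trans (≤-reflexive (∫-swap _)) (∫link s₄))
      where
      L≥0 : ∀ a → 0ℚ ≤ ∫ μ (λ d → link s₄ d a)
      L≥0 a = ∫-nonNeg λ d → link≥0 s₄ d a
      bound : ∀ a b c d → W a b c d · B₄ d a ≤ β c · (β b · link s₄ d a)
      bound a b c d = ≤-trans (≤-reflexive (solve 5 (λ p q s t m → (p :* (q :* (s :* t))) :* m := s :* (q :* ((t :* p) :* m)))
          refl (ρ s₁ a) (ρ s₂ b) (ρ s₃ c) (ρ s₄ d) (B₄ d a)))
        (·-mono (ρ≥0 s₃ c) (·-nonNeg (β≥0 b) (link≥0 s₄ d a)) (ρ≤β s₃ c) (·-mono (ρ≥0 s₂ b) (link≥0 s₄ d a) (ρ≤β s₂ b) (ρρbad≤link s₄ s₁ d a)))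

    G₁ G₂ G₃ G₄ : G → G → ℚ
    G₁ a b = g ((a ∙ s₁) ∙ b)
    G₂ b c = g ((b ∙ s₂) ∙ c)
    G₃ c d = g ((c ∙ s₃) ∙ d)
    G₄ d a = g ((d ∙ s₄) ∙ a)

    union-bound : ∀ {p q s t} → 0ℚ ≤ p → 0ℚ ≤ q → 0ℚ ≤ s → 0ℚ ≤ t → p ≤ 1ℚ → q ≤ 1ℚ → s ≤ 1ℚ → t ≤ 1ℚ →
      1ℚ ⊟ p ⊟ q ⊟ s ⊟ t ≤ ((1ℚ ⊟ p) · (1ℚ ⊟ q)) · ((1ℚ ⊟ s) · (1ℚ ⊟ t))
    union-bound {p} {q} {s} {t} p0 q0 s0 t0 p1 q1 s1 t1 =
      ≤-by (p · q ⊞ s · t ⊞ (1ℚ ⊟ (1ℚ ⊟ p) · (1ℚ ⊟ q)) · (1ℚ ⊟ (1ℚ ⊟ s) · (1ℚ ⊟ t)))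
        (⊞-nonNeg (⊞-nonNeg (·-nonNeg p0 q0) (·-nonNeg s0 t0)) (·-nonNeg (side p0 q0 p1 q1) (side s0 t0 s1 t1)))
        (solve 4 (λ p q s t → let u = (con 1ℚ :- p) :* (con 1ℚ :- q) ; v = (con 1ℚ :- s) :* (con 1ℚ :- t) in
          u :* v := (con 1ℚ :- p :- q :- s :- t) :+ (p :* q :+ s :* t :+ (con 1ℚ :- u) :* (con 1ℚ :- v))) refl p q s t)
      where
      side : ∀ {p q} → 0ℚ ≤ p → 0ℚ ≤ q → p ≤ 1ℚ → q ≤ 1ℚ → 0ℚ ≤ 1ℚ ⊟ (1ℚ ⊟ p) · (1ℚ ⊟ q)
      side {p} {q} p0 q0 p1 q1 = subst (0ℚ ≤_)
        (solve 2 (λ p q → p :+ q :* (con 1ℚ :- p) := con 1ℚ :- (con 1ℚ :- p) :* (con 1ℚ :- q)) refl p q)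
        (⊞-nonNeg p0 (·-nonNeg q0 (diff-nonNeg p1)))

    η⁴ : ℚ
    η⁴ = (η · η) · (η · η)

    pointwise : ∀ a b c d →
      η⁴ · (W a b c d ⊟ W a b c d · B₁ a b ⊟ W a b c d · B₂ b c ⊟ W a b c d · B₃ c d ⊟ W a b c d · B₄ d a)
      ≤ β a · (G₁ a b · (G₂ b c · (G₃ c d · G₄ d a)))
    pointwise a b c d = begin
      η⁴ · (w₀ ⊟ w₀ · p ⊟ w₀ · q ⊟ w₀ · s ⊟ w₀ · t)
        ≡⟨ solve 6 (λ e w p q s t → e :* (w :- w :* p :- w :* q :- w :* s :- w :* t) := e :* (w :* (con 1ℚ :- p :- q :- s :- t))) refl η⁴ w₀ p q s t ⟩
      η⁴ · (w₀ · (1ℚ ⊟ p ⊟ q ⊟ s ⊟ t))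
        ≤⟨ ·-monoˡ (0≤sq (η · η)) (·-monoˡ (W≥0 a b c d) (union-bound (bad≥0 _) (bad≥0 _) (bad≥0 _) (bad≥0 _) (bad≤1 _) (bad≤1 _) (bad≤1 _) (bad≤1 _))) ⟩
      η⁴ · (w₀ · (((1ℚ ⊟ p) · (1ℚ ⊟ q)) · ((1ℚ ⊟ s) · (1ℚ ⊟ t))))
        ≡⟨ solve 6 (λ e w p q s t → ((e :* e) :* (e :* e)) :* (w :* ((p :* q) :* (s :* t))) := w :* ((e :* p) :* ((e :* q) :* ((e :* s) :* (e :* t)))))
             refl η w₀ (1ℚ ⊟ p) (1ℚ ⊟ q) (1ℚ ⊟ s) (1ℚ ⊟ t) ⟩
      w₀ · (good p · (good q · (good s · good t)))
        ≤⟨ ·-mono (W≥0 a b c d) (·-nonNeg (g≥0 _) (·-nonNeg (g≥0 _) (·-nonNeg (g≥0 _) (g≥0 _)))) (W≤β a b c d)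
             (·-mono (good≥0 (bad≤1 _)) (·-nonNeg (g≥0 _) (·-nonNeg (g≥0 _) (g≥0 _))) (η·good≤g _)
             (·-mono (good≥0 (bad≤1 _)) (·-nonNeg (g≥0 _) (g≥0 _)) (η·good≤g _)
             (·-mono (good≥0 (bad≤1 _)) (g≥0 _) (η·good≤g _) (η·good≤g _)))) ⟩
      β a · (G₁ a b · (G₂ b c · (G₃ c d · G₄ d a))) ∎
      where
      w₀ = W a b c d
      p = B₁ a b
      q = B₂ b c
      s = B₃ c d
      t = B₄ d a
      good : ℚ → ℚ
      good x = η · (1ℚ ⊟ x)
      good≥0 : ∀ {x} → x ≤ 1ℚ → 0ℚ ≤ good x
      good≥0 h = ·-nonNeg η≥0 (diff-nonNeg h)

    x : G
    x = s₁ ∙ (s₂ ∙ (s₃ ∙ s₄))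

    -- Integrating the path d, c, b from the inside collapses the cycle to a convolution.
    collapse : ∫₄ (λ a b c d → β a · (G₁ a b · (G₂ b c · (G₃ c d · G₄ d a)))) ≡ ∫ μ (λ a → β a · g⁴ x)
    collapse = ∫-cong λ a → begin-equality
      (∫ μ λ b → ∫ μ λ c → ∫ μ λ d → β a · (G₁ a b · (G₂ b c · (G₃ c d · G₄ d a))))
        ≡⟨ (∫-cong λ b → ∫-cong λ c → trans (∫-· (β a) _) (cong (β a ·_) (trans (∫-· (G₁ a b) _) (cong (G₁ a b ·_) (trans (∫-· (G₂ b c) _)
             (cong (G₂ b c ·_) (trans (∫-cong λ d → cong (λ t → G₃ c d · g t) (∙-assoc d s₄ a)) (trans (conv-shift g g (c ∙ s₃) (s₄ ∙ a)) (cong g² (∙-assoc c s₃ (s₄ ∙ a))))))))))) ⟩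
      (∫ μ λ b → ∫ μ λ c → β a · (G₁ a b · (G₂ b c · g² (c ∙ (s₃ ∙ (s₄ ∙ a))))))
        ≡⟨ (∫-cong λ b → trans (∫-· (β a) _) (cong (β a ·_) (trans (∫-· (G₁ a b) _) (cong (G₁ a b ·_)
             (trans (conv-shift g g² (b ∙ s₂) (s₃ ∙ (s₄ ∙ a))) (cong g³ (∙-assoc b s₂ (s₃ ∙ (s₄ ∙ a))))))))) ⟩
      (∫ μ λ b → β a · (G₁ a b · g³ (b ∙ (s₂ ∙ (s₃ ∙ (s₄ ∙ a))))))
        ≡⟨ trans (∫-· (β a) _) (cong (β a ·_) (conv-shift g g³ (a ∙ s₁) (s₂ ∙ (s₃ ∙ (s₄ ∙ a))))) ⟩
      β a · g⁴ ((a ∙ s₁) ∙ (s₂ ∙ (s₃ ∙ (s₄ ∙ a))))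
        ≡⟨ cong (λ t → β a · g⁴ t) (closes a) ⟩
      β a · g⁴ x ∎
      where
      closes : ∀ a → (a ∙ s₁) ∙ (s₂ ∙ (s₃ ∙ (s₄ ∙ a))) ≡ x
      closes a = trans (cong (λ t → (a ∙ s₁) ∙ (s₂ ∙ t)) (trans (cong (s₃ ∙_) (∙-comm s₄ a)) (∙-swap s₃ a s₄)))
        (trans (cong ((a ∙ s₁) ∙_) (∙-swap s₂ a (s₃ ∙ s₄))) (∙-telescope a s₁ (s₂ ∙ (s₃ ∙ s₄))))

    g⁴-lower : η⁴ · ((κ · κ) · (κ · κ) ⊟ θ ⊟ θ ⊟ θ ⊟ θ) ≤ g⁴ x
    g⁴-lower = begin
      η⁴ · ((κ · κ) · (κ · κ) ⊟ θ ⊟ θ ⊟ θ ⊟ θ)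
        ≤⟨ ·-monoˡ (0≤sq (η · η)) (⊟-mono (⊟-mono (⊟-mono (⊟-mono κ⁴≤ bad₁) bad₂) bad₃) bad₄) ⟩
      η⁴ · (∫₄ W ⊟ ∫₄ (λ a b c d → W a b c d · B₁ a b) ⊟ ∫₄ (λ a b c d → W a b c d · B₂ b c)
        ⊟ ∫₄ (λ a b c d → W a b c d · B₃ c d) ⊟ ∫₄ (λ a b c d → W a b c d · B₄ d a))
        ≡⟨ cong (η⁴ ·_) (sym (trans (∫₄-⊟ _ _) (cong (_⊟ ∫₄ (λ a b c d → W a b c d · B₄ d a)) (trans (∫₄-⊟ _ _)
             (cong (_⊟ ∫₄ (λ a b c d → W a b c d · B₃ c d)) (trans (∫₄-⊟ _ _) (cong (_⊟ ∫₄ (λ a b c d → W a b c d · B₂ b c)) (∫₄-⊟ _ _)))))))) ⟩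
      η⁴ · ∫₄ (λ a b c d → W a b c d ⊟ W a b c d · B₁ a b ⊟ W a b c d · B₂ b c ⊟ W a b c d · B₃ c d ⊟ W a b c d · B₄ d a)
        ≡⟨ sym (∫₄-· η⁴ _) ⟩
      ∫₄ (λ a b c d → η⁴ · (W a b c d ⊟ W a b c d · B₁ a b ⊟ W a b c d · B₂ b c ⊟ W a b c d · B₃ c d ⊟ W a b c d · B₄ d a))
        ≤⟨ ∫₄-mono pointwise ⟩
      ∫₄ (λ a b c d → β a · (G₁ a b · (G₂ b c · (G₃ c d · G₄ d a))))
        ≡⟨ collapse ⟩
      ∫ μ (λ a → β a · g⁴ x)
        ≤⟨ ∫β·≤ (g⁴≥0 x) ⟩
      g⁴ x ∎

-- Natural numbers and powers of one half in ℚ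

fromℕ : ℕ → ℚ
fromℕ zero    = 0ℚ
fromℕ (suc n) = 1ℚ ⊞ fromℕ n

fromℕ≥0 : ∀ n → 0ℚ ≤ fromℕ n
fromℕ≥0 zero    = ≤-refl
fromℕ≥0 (suc n) = ⊞-nonNeg 0≤1 (fromℕ≥0 n)

fromℕ-mono : ∀ {m n} → m ℕ.≤ n → fromℕ m ≤ fromℕ n
fromℕ-mono {n = n} ℕ.z≤n = fromℕ≥0 n
fromℕ-mono (ℕ.s≤s h) = ⊞-mono ≤-refl (fromℕ-mono h)

halfPow : ℕ → ℚ
halfPow zero    = 1ℚ
halfPow (suc n) = ½ · halfPow n

halfPow>0 : ∀ n → 0ℚ < halfPow n
halfPow>0 zero    = 0<1
halfPow>0 (suc n) = ·-pos 0<½ (halfPow>0 n)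

halfPow≤1 : ∀ n → halfPow n ≤ 1ℚ
halfPow≤1 zero    = ≤-refl
halfPow≤1 (suc n) = ·-≤1 0≤½ (<⇒≤ (½-<1)) (halfPow≤1 n)
  where
  ½-<1 : ½ < 1ℚ
  ½-<1 = subst (_< 1ℚ) (·-idʳ ½) (½-< 0<1)

halfPow-anti : ∀ {m n} → m ℕ.≤ n → halfPow n ≤ halfPow m
halfPow-anti {n = n} ℕ.z≤n = halfPow≤1 n
halfPow-anti (ℕ.s≤s h) = ·-monoˡ 0≤½ (halfPow-anti h)

sumL-one : ∀ {X : Set} (xs : List X) → sumL xs (λ _ → 1ℚ) ≡ fromℕ (length xs)
sumL-one []       = refl
sumL-one (x ∷ xs) = cong (1ℚ ⊞_) (sumL-one xs)

∫-sumL : ∀ {X Y : Set} {μ : Measure X} (ys : List Y) (F : X → Y → ℚ) →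
  ∫ μ (λ x → sumL ys (F x)) ≡ sumL ys (λ y → ∫ μ (λ x → F x y))
∫-sumL []       F = ∫-0
∫-sumL (y ∷ ys) F = trans (∫-⊞ _ _) (cong (_ ⊞_) (∫-sumL ys F))

search : ∀ {X : Set} {P : X → Set} (xs : List X) → (∀ x → x ∈ xs) → (∀ x → Dec (P x)) → Dec (∃ P)
search xs complete P? with any? P? xs
... | yes a = yes (satisfied a)
... | no ¬a = no λ (x , p) → ¬a (lose (complete x) p)

-- Ruzsa covering: from popular differences to a subspace

record HeavySubspace {G : Set} (D : SelfDualWeight G) (κ τ : ℚ) : Set₁ where
  open SelfDualWeight D
  field
    V      : G → Set
    V?     : ∀ v → Dec (V v)
    V-ε    : V ε
    V-∙    : ∀ {u v} → V u → V v → V (u ∙ v)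
    heavy  : κ ≤ ∫ μ (λ v → ind (V? v) · w v)
    -- An upper bound on the measure of `V`, stated without division.
    small  : τ · ∫ μ (λ v → ind (V? v)) ≤ 1ℚ

FourfoldLower : ∀ {G : Set} → SelfDualWeight G → (G → Set) → (G → ℚ) → ℚ → Set
FourfoldLower D S h ℓ = ∀ s₁ s₂ s₃ s₄ → S s₁ → S s₂ → S s₃ → S s₄ → ℓ ≤ h (s₁ ∙ (s₂ ∙ (s₃ ∙ s₄)))
  where open SelfDualWeight D

-- As `h` has mass 1, `four` says that S+S+S+S has measure at most the reciprocal of `ℓ`: the small
-- growth hypothesis of the covering argument.
module Covering {G : Set} (D : SelfDualWeight G) (S : G → Set) (S? : ∀ x → Dec (S x))
  (h : G → ℚ) (h≥0 : ∀ x → 0ℚ ≤ h x) (h-mass : ∫ (SelfDualWeight.μ D) h ≡ 1ℚ) (ℓ : ℚ)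
  (four : FourfoldLower D S h ℓ) where
  open SelfDualWeight D
  open SelfDual D using (∙-cancel; ∙-idʳ; ∙-swap; ∙-telescope)

  S₂ S₃ : G → Set
  S₂ z = ∃ λ s → S s × S (s ∙ z)
  S₃ z = ∃ λ s → S s × S₂ (s ∙ z)

  S₂? : ∀ z → Dec (S₂ z)
  S₂? z = search (pts μ) complete λ s → S? s ×-dec S? (s ∙ z)

  S₃? : ∀ z → Dec (S₃ z)
  S₃? z = search (pts μ) complete λ s → S? s ×-dec S₂? (s ∙ z)

  four-S₂ : ∀ z → S₂ z → ℓ ≤ h z
  four-S₂ z (s , hs , hsz) = subst (λ t → ℓ ≤ h t) (trans (∙-cancel s (s ∙ (s ∙ z))) (∙-cancel s z)) (four s s s (s ∙ z) hs hs hs hsz)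

  four-S₃ : ∀ x z → S₃ x → S (x ∙ z) → ℓ ≤ h z
  four-S₃ x z (s , hs , t , ht , hu) hz = subst (λ e → ℓ ≤ h e) eq (four s t (t ∙ (s ∙ x)) (x ∙ z) hs ht hu hz)
    where
    eq : s ∙ (t ∙ ((t ∙ (s ∙ x)) ∙ (x ∙ z))) ≡ z
    eq = trans (cong (s ∙_) (trans (cong (t ∙_) (∙-assoc t (s ∙ x) (x ∙ z))) (trans (∙-cancel t _) (∙-assoc s x (x ∙ z)))))
         (trans (∙-cancel s _) (∙-cancel x z))

  -- The translates of `S` by these points are pairwise disjoint: a common point of two of them
  -- would put the difference of the translations into `S₂`.
  data Separated : List G → Set where
    []  : Separated []
    _∷_ : ∀ {x xs} → S₃ x × ¬ Any (λ x′ → S₂ (x ∙ x′)) xs → Separated xs → Separated (x ∷ xs)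

  greedy : ∀ (L : List G) → ∃ λ X → Separated X × (∀ {x} → x ∈ L → S₃ x → Any (λ x′ → S₂ (x ∙ x′)) X)
  greedy [] = [] , [] , λ ()
  greedy (y ∷ L) with greedy L | S₃? y
  ... | X , sep , cov | no ¬t = X , sep , λ { (here refl) t → ⊥-elim (¬t t) ; (there m) t → cov m t }
  ... | X , sep , cov | yes t with any? (λ x′ → S₂? (y ∙ x′)) X
  ...   | yes a = X , sep , λ { (here refl) _ → a ; (there m) t′ → cov m t′ }
  ...   | no ¬a = (y ∷ X) , ((t , ¬a) ∷ sep) , λ { (here refl) _ → here (self t) ; (there m) t′ → there (cov m t′) }
    where
    self : S₃ y → S₂ (y ∙ y)
    self (s , hs , _) = s , hs , subst S (trans (sym (∙-idʳ s)) (cong (s ∙_) (sym (∙-self y)))) hs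

  -- At most one translate contains `z`, and if one does, then `z` is a sum of four elements of `S`,
  -- where `h` is at least `ℓ`.
  packing : ∀ {X} → Separated X → 0ℚ ≤ ℓ → ∀ z → ℓ · sumL X (λ x → ind (S? (x ∙ z))) ≤ h z
  packing [] ℓ≥0 z = ≤-trans (≤-reflexive (·-zeroʳ ℓ)) (h≥0 z)
  packing {x ∷ X} ((t , ¬a) ∷ sep) ℓ≥0 z with S? (x ∙ z)
  ... | no _   = ≤-trans (≤-reflexive (cong (ℓ ·_) (⊞-idˡ _))) (packing sep ℓ≥0 z)
  ... | yes hx = ≤-trans (≤-reflexive (trans (cong (λ q → ℓ · (1ℚ ⊞ q)) (rest X ¬a)) (solve 1 (λ l → l :* (con 1ℚ :+ con 0ℚ) := l) refl ℓ)))
          (four-S₃ x z t hx)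
    where
    rest : ∀ X → ¬ Any (λ x′ → S₂ (x ∙ x′)) X → sumL X (λ x → ind (S? (x ∙ z))) ≡ 0ℚ
    rest []       _  = refl
    rest (x′ ∷ X) ¬a = trans (cong₂ _⊞_ (ind-no (S? (x′ ∙ z)) λ hx′ → ¬a (here (x ∙ z , hx , subst S (sym eq) hx′))) (rest X (¬a ∘ there)))
          (⊞-idˡ 0ℚ)
      where
      eq : (x ∙ z) ∙ (x ∙ x′) ≡ x′ ∙ z
      eq = trans (∙-telescope x z x′) (∙-comm z x′)

  size-bound : ∀ {X κ} → Separated X → 0ℚ ≤ ℓ → κ ≤ ∫ μ (λ x → ind (S? x)) → fromℕ (length X) · (ℓ · κ) ≤ 1ℚ
  size-bound {X} {κ} sep ℓ≥0 hκ = begin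
    fromℕ (length X) · (ℓ · κ) ≤⟨ ·-monoˡ (fromℕ≥0 (length X)) (·-monoˡ ℓ≥0 hκ) ⟩
    fromℕ (length X) · (ℓ · σ) ≡⟨ solve 3 (λ n l s → n :* (l :* s) := l :* (s :* n)) refl (fromℕ (length X)) ℓ σ ⟩
    ℓ · (σ · fromℕ (length X)) ≡⟨ cong (λ q → ℓ · (σ · q)) (sym (sumL-one X)) ⟩
    ℓ · (σ · sumL X (λ _ → 1ℚ)) ≡⟨ cong (ℓ ·_) (trans (sym (sumL-· X σ _)) (sumL-cong X λ x → trans (·-idʳ σ) (sym (invariant x _)))) ⟩
    ℓ · sumL X (λ x → ∫ μ (λ z → ind (S? (x ∙ z)))) ≡⟨ cong (ℓ ·_) (sym (∫-sumL X _)) ⟩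
    ℓ · ∫ μ (λ z → sumL X (λ x → ind (S? (x ∙ z)))) ≡⟨ sym (∫-· ℓ _) ⟩
    ∫ μ (λ z → ℓ · sumL X (λ x → ind (S? (x ∙ z)))) ≤⟨ ∫-mono (packing sep ℓ≥0) ⟩
    ∫ μ h ≡⟨ h-mass ⟩
    1ℚ ∎
    where σ = ∫ μ (λ x → ind (S? x))

  -- Listed with repetitions, so that the number of entries is exactly a power of 2.
  span : List G → List G
  span []      = ε ∷ []
  span (x ∷ X) = span X ++ L.map (x ∙_) (span X)

  ε∈span : ∀ X → ε ∈ span X
  ε∈span []      = here refl
  ε∈span (x ∷ X) = ∈-++⁺ˡ (ε∈span X)

  split : ∀ {x X y} → y ∈ span (x ∷ X) → (y ∈ span X) ⊎ (∃ λ y₀ → y₀ ∈ span X × y ≡ x ∙ y₀)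
  split {x} {X} m with ∈-++⁻ (span X) m
  ... | inj₁ m′ = inj₁ m′
  ... | inj₂ m′ = inj₂ (∈-map⁻ (x ∙_) m′)

  in-left : ∀ x X {y} → y ∈ span X → y ∈ span (x ∷ X)
  in-left x X = ∈-++⁺ˡ

  in-right : ∀ x X {y} → y ∈ span X → x ∙ y ∈ span (x ∷ X)
  in-right x X m = ∈-++⁺ʳ (span X) (∈-map⁺ (x ∙_) m)

  span-∙ : ∀ X {y z} → y ∈ span X → z ∈ span X → y ∙ z ∈ span X
  span-∙ [] (here refl) (here refl) = here (∙-self ε)
  span-∙ (x ∷ X) {y} {z} hy hz with split {x} {X} hy | split {x} {X} hz
  ... | inj₁ p              | inj₁ q              = in-left x X (span-∙ X p q)
  ... | inj₁ p              | inj₂ (z₀ , q , refl) = subst (_∈ span (x ∷ X)) (∙-swap x y z₀) (in-right x X (span-∙ X p q))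
  ... | inj₂ (y₀ , p , refl) | inj₁ q              = subst (_∈ span (x ∷ X)) (sym (∙-assoc x y₀ z)) (in-right x X (span-∙ X p q))
  ... | inj₂ (y₀ , p , refl) | inj₂ (z₀ , q , refl) = subst (_∈ span (x ∷ X)) (sym (∙-telescope x y₀ z₀)) (in-left x X (span-∙ X p q))

  gen∈span : ∀ {X x} → x ∈ X → x ∈ span X
  gen∈span {x ∷ X} (here refl) = subst (_∈ span (x ∷ X)) (∙-idʳ x) (in-right x X (ε∈span X))
  gen∈span {x ∷ X} (there m)   = in-left x X (gen∈span m)

  span-size : ∀ X → halfPow (length X) · sumL (span X) (λ _ → 1ℚ) ≡ 1ℚ
  span-size []      = solve 0 (con 1ℚ :* (con 1ℚ :+ con 0ℚ) := con 1ℚ) refl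
  span-size (x ∷ X) = trans (cong (halfPow (suc (length X)) ·_) (trans (sumL-++ (span X) _ _) (cong (sumL (span X) (λ _ → 1ℚ) ⊞_) (sumL-map (x ∙_) (span X) _))))
    (trans (solve 2 (λ a s → con ½ :* a :* (s :+ s) := a :* s) refl (halfPow (length X)) _) (span-size X))

  maximal : ∃ λ X → Separated X × (∀ {x} → x ∈ pts μ → S₃ x → Any (λ x′ → S₂ (x ∙ x′)) X)
  maximal = greedy (pts μ)

  X₀ : List G
  X₀ = proj₁ maximal

  -- The sum of `span X₀` and `S₂`. By maximality S+S+S lies in the sum of `X₀` and `S₂`, so adding
  -- an element of `S` does not lead out of `V`; that is what makes it a subspace.
  V : G → Set
  V v = Any (λ y → S₂ (v ∙ y)) (span X₀)

  V? : ∀ v → Dec (V v)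
  V? v = any? (λ y → S₂? (v ∙ y)) (span X₀)

  V-intro : ∀ {v y} → y ∈ span X₀ → S₂ (v ∙ y) → V v
  V-intro = lose

  V-elim : ∀ {v} → V v → ∃ λ y → y ∈ span X₀ × S₂ (v ∙ y)
  V-elim = find

  V-S : ∀ {s v} → S s → V v → V (s ∙ v)
  V-S {s} {v} hs hv = conclude (V-elim hv)
    where
    conclude : (∃ λ y → y ∈ span X₀ × S₂ (v ∙ y)) → V (s ∙ v)
    conclude (y , m , h₂) = step (find (proj₂ (proj₂ maximal) (complete (s ∙ (v ∙ y)))
        (s , hs , subst S₂ (sym (∙-cancel s (v ∙ y))) h₂)))
      where
      step : (∃ λ x → x ∈ X₀ × S₂ ((s ∙ (v ∙ y)) ∙ x)) → V (s ∙ v)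
      step (x , mx , hx) = V-intro (span-∙ X₀ m (gen∈span mx))
        (subst S₂ (trans (cong (_∙ x) (sym (∙-assoc s v y))) (∙-assoc (s ∙ v) y x)) hx)

  V-span : ∀ {y v} → y ∈ span X₀ → V v → V (y ∙ v)
  V-span {y} {v} m hv = conclude (V-elim hv)
    where
    conclude : (∃ λ z → z ∈ span X₀ × S₂ (v ∙ z)) → V (y ∙ v)
    conclude (z , mz , h₂) = V-intro (span-∙ X₀ m mz) (subst S₂ (sym (∙-telescope y v z)) h₂)

  -- `u` is the sum of an element of the span and two elements of `S`, and adding each of the three
  -- preserves `V`.
  V-∙ : ∀ {u v} → V u → V v → V (u ∙ v)
  V-∙ {u} {v} hu hv = conclude (V-elim hu)
    where
    conclude : (∃ λ y → y ∈ span X₀ × S₂ (u ∙ y)) → V (u ∙ v)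
    conclude (y , m , s , hs , hs′) = subst V eq (V-span m (V-S hs (V-S hs′ hv)))
      where
      eq : y ∙ (s ∙ ((s ∙ (u ∙ y)) ∙ v)) ≡ u ∙ v
      eq = trans (cong (λ t → y ∙ (s ∙ t)) (∙-assoc s (u ∙ y) v)) (trans (cong (y ∙_) (∙-cancel s ((u ∙ y) ∙ v)))
           (trans (cong (y ∙_) (trans (cong (_∙ v) (∙-comm u y)) (∙-assoc y u v))) (∙-cancel y (u ∙ v))))

  V-ε : (∃ S) → V ε
  V-ε (s , hs) = V-intro (ε∈span X₀) (s , hs , subst S (trans (sym (∙-idʳ s)) (cong (s ∙_) (sym (∙-self ε)))) hs)

  S⊆V : ∀ {s} → S s → V s
  S⊆V {s} hs = subst V (∙-idʳ s) (V-S hs (V-ε (s , hs)))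

  -- `V` is covered by the translates of `S₂` by the entries of the span, and `S₂` lies in S+S+S+S
  -- because `s ∙ s` vanishes.
  V-size : 0ℚ ≤ ℓ → (ℓ · halfPow (length X₀)) · ∫ μ (λ v → ind (V? v)) ≤ 1ℚ
  V-size ℓ≥0 = begin
    (ℓ · p) · ∫ μ (λ v → ind (V? v)) ≡⟨ solve 3 (λ l p v → (l :* p) :* v := p :* (l :* v)) refl ℓ p (∫ μ (λ v → ind (V? v))) ⟩
    p · (ℓ · ∫ μ (λ v → ind (V? v))) ≤⟨ ·-monoˡ (<⇒≤ (halfPow>0 (length X₀))) bound ⟩
    p · sumL (span X₀) (λ _ → 1ℚ) ≡⟨ span-size X₀ ⟩
    1ℚ ∎
    where
    p = halfPow (length X₀)
    count-≤ : ∀ v ys (d : Dec (Any (λ y → S₂ (v ∙ y)) ys)) → ind d ≤ sumL ys (λ y → ind (S₂? (v ∙ y)))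
    count-≤ v ys d = ind-≤ d (nonNeg ys) (one ys)
      where
      nonNeg : ∀ ys → 0ℚ ≤ sumL ys (λ y → ind (S₂? (v ∙ y)))
      nonNeg []       = ≤-refl
      nonNeg (y ∷ ys) = ⊞-nonNeg (ind≥0 (S₂? (v ∙ y))) (nonNeg ys)
      one : ∀ ys → Any (λ y → S₂ (v ∙ y)) ys → 1ℚ ≤ sumL ys (λ y → ind (S₂? (v ∙ y)))
      one (y ∷ ys) (here q)  = subst (_≤ ind (S₂? (v ∙ y)) ⊞ sumL ys (λ y → ind (S₂? (v ∙ y)))) (trans (⊞-idʳ _) (ind-yes (S₂? (v ∙ y)) q)) (⊞-mono ≤-refl (nonNeg ys))
      one (y ∷ ys) (there a) = subst (_≤ ind (S₂? (v ∙ y)) ⊞ sumL ys (λ y → ind (S₂? (v ∙ y)))) (⊞-idˡ 1ℚ) (⊞-mono (ind≥0 (S₂? (v ∙ y))) (one ys a))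
    ℓ·ind≤h : ∀ z → ℓ · ind (S₂? z) ≤ h z
    ℓ·ind≤h z with S₂? z
    ... | yes t = ≤-trans (≤-reflexive (·-idʳ ℓ)) (four-S₂ z t)
    ... | no _  = ≤-trans (≤-reflexive (·-zeroʳ ℓ)) (h≥0 z)
    bound : ℓ · ∫ μ (λ v → ind (V? v)) ≤ sumL (span X₀) (λ _ → 1ℚ)
    bound = begin
      ℓ · ∫ μ (λ v → ind (V? v)) ≤⟨ ·-monoˡ ℓ≥0 (∫-mono λ v → count-≤ v (span X₀) (V? v)) ⟩
      ℓ · ∫ μ (λ v → sumL (span X₀) (λ y → ind (S₂? (v ∙ y)))) ≡⟨ cong (ℓ ·_) (∫-sumL (span X₀) _) ⟩
      ℓ · sumL (span X₀) (λ y → ∫ μ (λ v → ind (S₂? (v ∙ y)))) ≡⟨ sym (sumL-· (span X₀) ℓ _) ⟩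
      sumL (span X₀) (λ y → ℓ · ∫ μ (λ v → ind (S₂? (v ∙ y)))) ≡⟨ sumL-cong (span X₀) (λ y → sym (∫-· ℓ _)) ⟩
      sumL (span X₀) (λ y → ∫ μ (λ v → ℓ · ind (S₂? (v ∙ y)))) ≤⟨ sumL-mono (span X₀) (λ y → ∫-mono λ v → ℓ·ind≤h (v ∙ y)) ⟩
      sumL (span X₀) (λ y → ∫ μ (λ v → h (v ∙ y))) ≡⟨ sumL-cong (span X₀) (λ y → trans (trans (∫-cong λ v → cong h (∙-comm v y)) (invariant y h)) h-mass) ⟩
      sumL (span X₀) (λ _ → 1ℚ) ∎

  S-nonempty : ∀ {κ} → 0ℚ < κ → κ ≤ ∫ μ (λ x → ind (S? x) · w x) → ∃ S
  S-nonempty κ>0 h = conclude (∫-pos _ (<-≤-trans κ>0 h))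
    where
    conclude : (∃ λ x → 0ℚ < ind (S? x) · w x) → ∃ S
    conclude (x , p) with S? x
    ... | yes s = x , s
    ... | no _  = ⊥-elim (<-irrefl (sym (·-zeroˡ (w x))) p)

  heavySubspace : ∀ {κ m} → 0ℚ < κ → 0ℚ < ℓ → κ ≤ ∫ μ (λ x → ind (S? x) · w x) → 1ℚ < fromℕ m · (ℓ · κ) →
    HeavySubspace D κ (ℓ · halfPow m)
  heavySubspace {κ} {m} κ>0 ℓ>0 S-mass m-large = record
    { V = V ; V? = V? ; V-ε = V-ε (S-nonempty κ>0 S-mass) ; V-∙ = V-∙
    ; heavy = ≤-trans S-mass (∫-mono λ x → ·-monoʳ (w≥0 x) (ind-≤ (S? x) (ind≥0 (V? x)) λ s → ≤-reflexive (sym (ind-yes (V? x) (S⊆V s)))))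
    ; small = ≤-trans (·-monoʳ (∫-nonNeg λ v → ind≥0 (V? v)) (·-monoˡ (<⇒≤ ℓ>0) (halfPow-anti size≤m))) (V-size (<⇒≤ ℓ>0))
    }
    where
    -- `S` has measure at least `κ` because `w` is at most 1, so more than `m` disjoint translates
    -- of it would force the mass of `h` above 1.
    size≤m : length X₀ ℕ.≤ m
    size≤m with length X₀ ℕₚ.≤? m
    ... | yes p = p
    ... | no ¬p = ⊥-elim (<-irrefl refl (<-≤-trans m-large
      (≤-trans (·-monoʳ (<⇒≤ (·-pos ℓ>0 κ>0)) (fromℕ-mono (ℕₚ.<⇒≤ (ℕₚ.≰⇒> ¬p))))
        (size-bound (proj₁ (proj₂ maximal)) (<⇒≤ ℓ>0) (≤-trans S-mass (∫-mono λ x → ·-≤ˡ (ind≥0 (S? x)) (w≤1 x)))))))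

-- The Archimedean property and the choice of constants

toℚᵘ-fromℕ : ∀ n → ℚ.toℚᵘ (fromℕ n) ℚᵘ.≃ ℚᵘ.mkℚᵘ (ℤ.+ n) 0
toℚᵘ-fromℕ zero    = ℚᵘₚ.≃-refl
toℚᵘ-fromℕ (suc n) = ℚᵘₚ.≃-trans (ℚᵘₚ.≃-trans (ℚᵘₚ.≃-reflexive (cong ℚ.toℚᵘ (⊞-def 1ℚ (fromℕ n)))) (ℚₚ.toℚᵘ-homo-+ 1ℚ (fromℕ n)))
  (ℚᵘₚ.≃-trans (ℚᵘₚ.+-congʳ ℚᵘ.1ℚᵘ (toℚᵘ-fromℕ n))
    (ℚᵘ.*≡* (cong (ℤ._* (ℤ.+ 1)) (cong (λ t → ℤ.+ 1 ℤ.+ t) (ℤₚ.*-identityʳ (ℤ.+ n))))))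

archimedean : ∀ p → 0ℚ < p → ∃ λ m → 1ℚ < fromℕ m · p
archimedean (ℚ.mkℚ (ℤ.+ zero) d c)      (ℚ.*<* (ℤ.+<+ ()))
archimedean (ℚ.mkℚ ℤ.-[1+ n ] d c)      (ℚ.*<* ())
archimedean p@(ℚ.mkℚ (ℤ.+ (suc n)) d c) _ = m , ℚₚ.toℚᵘ-cancel-< (ℚᵘₚ.<-respʳ-≃ (ℚᵘₚ.≃-sym eq) (ℚᵘ.*<* (ℤ.+<+ bound)))
  where
  -- `p` has denominator `suc d` and numerator at least 1, so one more copy than the denominator
  -- exceeds 1.
  m = suc (suc d)
  eq : ℚ.toℚᵘ (fromℕ m · p) ℚᵘ.≃ ℚᵘ.mkℚᵘ (ℤ.+ (m ℕ.* suc n)) d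
  eq = ℚᵘₚ.≃-trans (ℚᵘₚ.≃-reflexive (cong ℚ.toℚᵘ (·-def (fromℕ m) p))) (ℚᵘₚ.≃-trans (ℚₚ.toℚᵘ-homo-* (fromℕ m) p)
    (ℚᵘₚ.≃-trans (ℚᵘₚ.*-congʳ {ℚ.toℚᵘ p} (toℚᵘ-fromℕ m)) (ℚᵘ.*≡* (cong₂ (λ s t → s ℤ.* ℤ.+ suc t) (sym (ℤₚ.pos-* m (suc n))) (sym (ℕₚ.+-identityʳ d))))))
  bound : 1 ℕ.* suc d ℕ.< m ℕ.* suc n ℕ.* 1
  bound = subst₂ ℕ._<_ (sym (ℕₚ.*-identityˡ (suc d))) (sym (ℕₚ.*-identityʳ (m ℕ.* suc n)))
    (ℕₚ.≤-trans (ℕₚ.≤-reflexive (sym (ℕₚ.*-identityʳ m))) (ℕₚ.*-monoʳ-≤ m {1} {suc n} (ℕ.s≤s ℕ.z≤n)))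

-- `ω` bounds `γ y · γ y` from below, `κ` is the popularity threshold, `θ` the tolerated mass of bad
-- pairs, `η` the level of `g` below which a difference is bad, `ℓ` the lower bound for `g⁴`, `m`
-- the size of the covering family, and `τ` the reciprocal of the size of the subspace.
record Constants (δ : ℚ) : Set where
  field
    ω κ θ η ℓ : ℚ
    m         : ℕ
    ω>0       : 0ℚ < ω
    κ>0       : 0ℚ < κ
    θ>0       : 0ℚ < θ
    η>0       : 0ℚ < η
    ℓ>0       : 0ℚ < ℓ
    κ+κ≤ω     : κ ⊞ κ ≤ ω
    gap       : η ⊞ θ · ω < θ · (((δ · δ) · (δ · δ)) · ((δ · δ) · (δ · δ)))
    ℓ≤        : ℓ ≤ ((η · η) · (η · η)) · ((κ · κ) · (κ · κ) ⊟ θ ⊟ θ ⊟ θ ⊟ θ)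
    m-large   : 1ℚ < fromℕ m · (ℓ · κ)

  τ : ℚ
  τ = ℓ · halfPow m

  τ>0 : 0ℚ < τ
  τ>0 = ·-pos ℓ>0 (halfPow>0 m)

sq>0 : ∀ {p} → 0ℚ < p → 0ℚ < p · p
sq>0 h = ·-pos h h

gap-lemma : ∀ d θ → 0ℚ < d → 0ℚ < θ → ½ · (½ · (θ · d)) ⊞ θ · (½ · d) < θ · d
gap-lemma d θ d>0 θ>0 = subst₂ _<_ (cong (½ · (½ · (θ · d)) ⊞_) (solve 2 (λ θ d → con ½ :* (θ :* d) := θ :* (con ½ :* d)) refl θ d)) (½+½ (θ · d))
  (⊞-mono-<-≤ (½-< (·-pos 0<½ (·-pos θ>0 d>0))) (≤-refl {½ · (θ · d)}))

-- With `d` the eighth power of `δ`: `ω` is d/2 and `κ` is d/4; `θ` is κ⁴/8, so that four bad links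
-- still leave half of κ⁴; `η` is θd/4, so that `η ⊞ θ · ω` is three quarters of `θ · d`.
constants : ∀ {δ} → 0ℚ < δ → Constants δ
constants {δ} δ>0 = stage₁ _ refl (sq>0 (sq>0 (sq>0 δ>0)))
  where
  stage₃ : ∀ d θ κ → d ≡ ((δ · δ) · (δ · δ)) · ((δ · δ) · (δ · δ)) → 0ℚ < d → 0ℚ < κ → κ ⊞ κ ≤ ½ · d → 0ℚ < θ →
    (θ ⊞ θ ⊞ θ ⊞ θ) < (κ · κ) · (κ · κ) → Constants δ
  stage₃ d θ κ refl d>0 κ>0 κ≤ θ>0 θ< = record
    { ω = ½ · d ; κ = κ ; θ = θ ; η = η ; ℓ = ℓ ; m = proj₁ arch ; ω>0 = ·-pos 0<½ d>0 ; κ>0 = κ>0 ; θ>0 = θ>0 ; η>0 = η>0 ; ℓ>0 = ℓ>0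
    ; κ+κ≤ω = κ≤ ; gap = gap-lemma d θ d>0 θ>0 ; ℓ≤ = ≤-refl ; m-large = proj₂ arch }
    where
    η ℓ : ℚ
    η = ½ · (½ · (θ · d))
    ℓ = ((η · η) · (η · η)) · ((κ · κ) · (κ · κ) ⊟ θ ⊟ θ ⊟ θ ⊟ θ)
    η>0 : 0ℚ < η
    η>0 = ·-pos 0<½ (·-pos 0<½ (·-pos θ>0 d>0))
    diff>0 : 0ℚ < (κ · κ) · (κ · κ) ⊟ θ ⊟ θ ⊟ θ ⊟ θ
    diff>0 = subst₂ _<_ (⊞-inverseʳ (θ ⊞ θ ⊞ θ ⊞ θ)) (solve 2 (λ k t → k :- (t :+ t :+ t :+ t) := k :- t :- t :- t :- t) refl ((κ · κ) · (κ · κ)) θ)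
      (⊞-mono-<-≤ θ< (≤-refl {⊖ (θ ⊞ θ ⊞ θ ⊞ θ)}))
    ℓ>0 : 0ℚ < ℓ
    ℓ>0 = ·-pos (sq>0 (sq>0 η>0)) diff>0
    arch = archimedean (ℓ · κ) (·-pos ℓ>0 κ>0)

  stage₂ : ∀ d κ → d ≡ ((δ · δ) · (δ · δ)) · ((δ · δ) · (δ · δ)) → 0ℚ < d → 0ℚ < κ → κ ⊞ κ ≤ ½ · d → Constants δ
  stage₂ d κ eq d>0 κ>0 κ≤ = stage₃ d (½ · (½ · (½ · k⁴))) κ eq d>0 κ>0 κ≤ (·-pos 0<½ (·-pos 0<½ (·-pos 0<½ k⁴>0)))
    (subst (_< k⁴) (solve 1 (λ k → con ½ :* k := let t = con ½ :* (con ½ :* (con ½ :* k)) in t :+ t :+ t :+ t) refl k⁴) (½-< k⁴>0))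
    where
    k⁴ : ℚ
    k⁴ = (κ · κ) · (κ · κ)
    k⁴>0 : 0ℚ < k⁴
    k⁴>0 = sq>0 (sq>0 κ>0)

  stage₁ : ∀ d → d ≡ ((δ · δ) · (δ · δ)) · ((δ · δ) · (δ · δ)) → 0ℚ < d → Constants δ
  stage₁ d eq d>0 = stage₂ d (½ · (½ · d)) eq d>0 (·-pos 0<½ (·-pos 0<½ d>0)) (≤-reflexive (½+½ (½ · d)))

module FromConstants {δ : ℚ} (δ>0 : 0ℚ < δ) (C : Constants δ) where
  open Constants C

  module _ {G : Set} (D : SelfDualWeight G)
    (h : δ ≤ energy D) where
    open SelfDualWeight D
    open SelfDual D
    open Threshold η (<⇒≤ η>0)

    -- One inequality serves twice: without `badMass y` it gives `ω < γ y · γ y`, and without the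
    -- slack `θ · ω` it gives `badMass y ≤ θ`, as `γ y ≤ 1`.
    chosen : ∃ λ y → badMass y ⊞ θ · ω < θ · (γ y · γ y)
    chosen = choose (<⇒≤ δ>0) h (<⇒≤ θ>0) gap

    y : G
    y = proj₁ chosen

    κ≤ : κ ⊞ κ ≤ γ y · γ y
    κ≤ = ≤-trans κ+κ≤ω (<⇒≤ (·-cancelˡ-< (<⇒≤ θ>0)
      (≤-<-trans (≤-by (badMass y) (badMass≥0 y) (⊞-comm _ _)) (proj₂ chosen))))

    bad≤θ : badMass y ≤ θ
    bad≤θ = ≤-trans (≤-by (θ · ω) (<⇒≤ (·-pos θ>0 ω>0)) refl)
      (≤-trans (<⇒≤ (proj₂ chosen)) (·-≤ˡ (<⇒≤ θ>0) (·-≤1 (γ≥0 y) (γ≤1 y) (γ≤1 y))))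

    heavySubspace : HeavySubspace D κ τ
    heavySubspace = Covering.heavySubspace D P.S P.S? P.g⁴ P.g⁴≥0 P.g⁴-mass ℓ
      (λ s₁ s₂ s₃ s₄ h₁ h₂ h₃ h₄ → ≤-trans ℓ≤ (P.Path.g⁴-lower s₁ s₂ s₃ s₄ h₁ h₂ h₃ h₄)) {m = m} κ>0 ℓ>0 P.S-mass m-large
      where module P = Popular D η (<⇒≤ η>0) y κ θ (<⇒≤ κ>0) κ≤ bad≤θ

-- Fourier analysis on the cube

⊕-assoc : ∀ {n} (x y z : Cube n) → (x ⊕ y) ⊕ z ≡ x ⊕ (y ⊕ z)
⊕-assoc = Vₚ.zipWith-assoc 𝔹ₚ.xor-assoc

⊕-comm : ∀ {n} (x y : Cube n) → x ⊕ y ≡ y ⊕ x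
⊕-comm = Vₚ.zipWith-comm 𝔹ₚ.xor-comm

⊕-idˡ : ∀ {n} (x : Cube n) → 𝟎 ⊕ x ≡ x
⊕-idˡ = Vₚ.zipWith-identityˡ 𝔹ₚ.xor-identityˡ

⊕-idʳ : ∀ {n} (x : Cube n) → x ⊕ 𝟎 ≡ x
⊕-idʳ = Vₚ.zipWith-identityʳ 𝔹ₚ.xor-identityʳ

⊕-self : ∀ {n} (x : Cube n) → x ⊕ x ≡ 𝟎
⊕-self [] = refl
⊕-self (b ∷ x) = cong₂ _∷_ (𝔹ₚ.xor-same b) (⊕-self x)

⊕-cancel : ∀ {n} (x y : Cube n) → x ⊕ (x ⊕ y) ≡ y
⊕-cancel x y = trans (sym (⊕-assoc x x y)) (trans (cong (_⊕ y) (⊕-self x)) (⊕-idˡ y))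

⊕-swap : ∀ {n} (x y z : Cube n) → x ⊕ (y ⊕ z) ≡ y ⊕ (x ⊕ z)
⊕-swap x y z = trans (sym (⊕-assoc x y z)) (trans (cong (_⊕ z) (⊕-comm x y)) (⊕-assoc y x z))

⊕-interchange : ∀ {n} (x y z t : Cube n) → (x ⊕ y) ⊕ (z ⊕ t) ≡ (x ⊕ z) ⊕ (y ⊕ t)
⊕-interchange x y z t = trans (⊕-assoc x y (z ⊕ t)) (trans (cong (x ⊕_) (⊕-swap y z t)) (sym (⊕-assoc x z (y ⊕ t))))

allCube-complete : ∀ {n} (x : Cube n) → x ∈ allCube n
allCube-complete [] = here refl
allCube-complete (false ∷ x) = ∈-++⁺ˡ (∈-map⁺ (false ∷_) (allCube-complete x))
allCube-complete {suc n} (true ∷ x) = ∈-++⁺ʳ (L.map (false ∷_) (allCube n)) (∈-map⁺ (true ∷_) (allCube-complete x))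

sumL-cube : ∀ {n} (F : Cube (suc n) → ℚ) →
  sumL (allCube (suc n)) F ≡ sumL (allCube n) (λ x → F (false ∷ x)) ⊞ sumL (allCube n) (λ x → F (true ∷ x))
sumL-cube {n} F = trans (sumL-++ (L.map (false ∷_) (allCube n)) _ F) (cong₂ _⊞_ (sumL-map (false ∷_) (allCube n) F) (sumL-map (true ∷_) (allCube n) F))

sumL-translate : ∀ {n} (a : Cube n) (F : Cube n → ℚ) → sumL (allCube n) (λ x → F (a ⊕ x)) ≡ sumL (allCube n) F
sumL-translate [] F = refl
sumL-translate {suc n} (false ∷ a) F = trans (sumL-cube (λ x → F ((false ∷ a) ⊕ x))) (trans (cong₂ _⊞_ (sumL-translate a (λ x → F (false ∷ x))) (sumL-translate a (λ x → F (true ∷ x)))) (sym (sumL-cube F)))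
sumL-translate {suc n} (true  ∷ a) F = trans (sumL-cube (λ x → F ((true ∷ a) ⊕ x))) (trans (cong₂ _⊞_ (sumL-translate a (λ x → F (true ∷ x))) (sumL-translate a (λ x → F (false ∷ x))))
  (trans (⊞-comm _ _) (sym (sumL-cube F))))

-- Averages over points, sums over frequencies: with these normalisations inversion and Parseval
-- carry no constants.
avg cnt : ∀ n → Measure (Cube n)
avg n = measure (halfPow n) (<⇒≤ (halfPow>0 n)) (allCube n)
cnt n = measure 1ℚ 0≤1 (allCube n)

𝔼 : ∀ {n} → (Cube n → ℚ) → ℚ
𝔼 {n} = ∫ (avg n)

Σᶜ : ∀ {n} → (Cube n → ℚ) → ℚ
Σᶜ {n} = ∫ (cnt n)

∫-translate : ∀ {n} {q q≥0} (a : Cube n) (F : Cube n → ℚ) →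
  ∫ (measure q q≥0 (allCube n)) (λ x → F (a ⊕ x)) ≡ ∫ (measure q q≥0 (allCube n)) F
∫-translate {q = q} a F = trans (∫-def _ _) (trans (cong (q ·_) (sumL-translate a F)) (sym (∫-def _ F)))

𝔼-translate : ∀ {n} (a : Cube n) (F : Cube n → ℚ) → 𝔼 (λ x → F (a ⊕ x)) ≡ 𝔼 F
𝔼-translate = ∫-translate

Σᶜ-translate : ∀ {n} (a : Cube n) (F : Cube n → ℚ) → Σᶜ (λ x → F (a ⊕ x)) ≡ Σᶜ F
Σᶜ-translate = ∫-translate

𝔼-suc : ∀ {n} (F : Cube (suc n) → ℚ) → 𝔼 F ≡ ½ · 𝔼 (λ x → F (false ∷ x)) ⊞ ½ · 𝔼 (λ x → F (true ∷ x))
𝔼-suc {n} F = begin-equality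
  𝔼 F ≡⟨ ∫-def _ F ⟩
  ½ · halfPow n · sumL (allCube (suc n)) F ≡⟨ cong (½ · halfPow n ·_) (sumL-cube F) ⟩
  ½ · halfPow n · (s₀ ⊞ s₁) ≡⟨ solve 4 (λ h p a b → h :* p :* (a :+ b) := h :* (p :* a) :+ h :* (p :* b)) refl ½ (halfPow n) s₀ s₁ ⟩
  ½ · (halfPow n · s₀) ⊞ ½ · (halfPow n · s₁) ≡⟨ sym (cong₂ (λ a b → ½ · a ⊞ ½ · b) (∫-def (avg n) _) (∫-def (avg n) _)) ⟩
  ½ · 𝔼 (λ x → F (false ∷ x)) ⊞ ½ · 𝔼 (λ x → F (true ∷ x)) ∎
  where
  s₀ = sumL (allCube n) (λ x → F (false ∷ x))
  s₁ = sumL (allCube n) (λ x → F (true ∷ x))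

Σᶜ-suc : ∀ {n} (F : Cube (suc n) → ℚ) → Σᶜ F ≡ Σᶜ (λ x → F (false ∷ x)) ⊞ Σᶜ (λ x → F (true ∷ x))
Σᶜ-suc {n} F = trans (∫-def _ F) (trans (cong (1ℚ ·_) (sumL-cube F)) (trans (·-distribˡ 1ℚ _ _)
  (sym (cong₂ _⊞_ (∫-def (cnt n) _) (∫-def (cnt n) _)))))

𝔼-[] : ∀ (F : Cube 0 → ℚ) → 𝔼 F ≡ F []
𝔼-[] F = trans (∫-def _ F) (solve 1 (λ a → con 1ℚ :* (a :+ con 0ℚ) := a) refl (F []))

Σᶜ-[] : ∀ (F : Cube 0 → ℚ) → Σᶜ F ≡ F []
Σᶜ-[] F = trans (∫-def _ F) (solve 1 (λ a → con 1ℚ :* (a :+ con 0ℚ) := a) refl (F []))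

avg-prob : ∀ n → IsProb (avg n)
avg-prob zero = 𝔼-[] (λ _ → 1ℚ)
avg-prob (suc n) = trans (𝔼-suc {n} (λ _ → 1ℚ)) (trans (cong (λ t → ½ · t ⊞ ½ · t) (avg-prob n)) (½+½ 1ℚ))

dot : ∀ {n} → Cube n → Cube n → Bool
dot []      [] = false
dot (a ∷ x) (b ∷ y) = (a ∧ b) xor dot x y

dot-comm : ∀ {n} (x y : Cube n) → dot x y ≡ dot y x
dot-comm []      [] = refl
dot-comm (a ∷ x) (b ∷ y) = cong₂ _xor_ (𝔹ₚ.∧-comm a b) (dot-comm x y)

xor-interchange : ∀ a b c d → (a xor b) xor (c xor d) ≡ (a xor c) xor (b xor d)
xor-interchange = xor-∧-Solver.solve 4 (λ a b c d → (a :⊕ b) :⊕ (c :⊕ d) :≡ (a :⊕ c) :⊕ (b :⊕ d)) refl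
  where open xor-∧-Solver renaming (_:+_ to _:⊕_; _:=_ to _:≡_)

dot-⊕ʳ : ∀ {n} (x y z : Cube n) → dot x (y ⊕ z) ≡ dot x y xor dot x z
dot-⊕ʳ []      []      [] = refl
dot-⊕ʳ (a ∷ x) (b ∷ y) (c ∷ z) = trans (cong₂ _xor_ (𝔹ₚ.∧-distribˡ-xor a b c) (dot-⊕ʳ x y z))
  (xor-interchange (a ∧ b) (a ∧ c) (dot x y) (dot x z))

dot-⊕ˡ : ∀ {n} (x y z : Cube n) → dot (x ⊕ y) z ≡ dot x z xor dot y z
dot-⊕ˡ x y z = trans (dot-comm (x ⊕ y) z) (trans (dot-⊕ʳ z x y) (cong₂ _xor_ (dot-comm z x) (dot-comm z y)))

dot-𝟎ʳ : ∀ {n} (x : Cube n) → dot x 𝟎 ≡ false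
dot-𝟎ʳ [] = refl
dot-𝟎ʳ (a ∷ x) = cong₂ _xor_ (𝔹ₚ.∧-zeroʳ a) (dot-𝟎ʳ x)

χ : ∀ {n} → Cube n → Cube n → ℚ
χ ξ x = sgn (dot ξ x)

χ-⊕ʳ : ∀ {n} (ξ x y : Cube n) → χ ξ (x ⊕ y) ≡ χ ξ x · χ ξ y
χ-⊕ʳ ξ x y = trans (cong sgn (dot-⊕ʳ ξ x y)) (sgn-xor (dot ξ x) (dot ξ y))

χ-⊕ˡ : ∀ {n} (ξ η x : Cube n) → χ (ξ ⊕ η) x ≡ χ ξ x · χ η x
χ-⊕ˡ ξ η x = trans (cong sgn (dot-⊕ˡ ξ η x)) (sgn-xor (dot ξ x) (dot η x))

χ-sq : ∀ {n} (ξ x : Cube n) → χ ξ x · χ ξ x ≡ 1ℚ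
χ-sq ξ x = sgn-sq (dot ξ x)

χ-𝟎ʳ : ∀ {n} (ξ : Cube n) → χ ξ 𝟎 ≡ 1ℚ
χ-𝟎ʳ ξ = cong sgn (dot-𝟎ʳ ξ)

fourier : ∀ {n} → (Cube n → ℚ) → Cube n → ℚ
fourier F ξ = 𝔼 (λ k → F k · χ ξ k)

fourier-∷ : ∀ {n} (F : Cube (suc n) → ℚ) c ξ →
  fourier F (c ∷ ξ) ≡ fourier (λ k → ½ · F (false ∷ k) ⊞ (½ · sgn c) · F (true ∷ k)) ξ
fourier-∷ F c ξ = trans (𝔼-suc (λ k → F k · χ (c ∷ ξ) k)) (trans (cong₂ _⊞_ (sym (∫-· ½ _)) (sym (∫-· ½ _))) (trans (sym (∫-⊞ _ _))
  (∫-cong λ k → trans (cong₂ (λ s t → ½ · (F (false ∷ k) · s) ⊞ ½ · (F (true ∷ k) · t)) (cong sgn (cong (_xor dot ξ k) (𝔹ₚ.∧-zeroʳ c)))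
      (trans (cong sgn (cong (_xor dot ξ k) (𝔹ₚ.∧-identityʳ c))) (sgn-xor c (dot ξ k))))
    (solve 5 (λ h a b s x → h :* (a :* x) :+ h :* (b :* (s :* x)) := (h :* a :+ (h :* s) :* b) :* x) refl ½ (F (false ∷ k)) (F (true ∷ k)) (sgn c) (χ ξ k)))))

-- Induction on the dimension in place of orthogonality: the first coordinate replaces `F` by the
-- half-sum and the half-difference of its two restrictions, and these determine both.
fourier-inversion : ∀ {n} (F : Cube n → ℚ) l → Σᶜ (λ ξ → fourier F ξ · χ ξ l) ≡ F l
fourier-inversion F [] = trans (Σᶜ-[] _) (trans (cong (_· 1ℚ) (𝔼-[] (λ k → F k · χ [] k)))
  (trans (·-idʳ _) (·-idʳ (F []))))
fourier-inversion F (b ∷ l) = begin-equality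
  Σᶜ (λ ξ → fourier F ξ · χ ξ (b ∷ l))
    ≡⟨ Σᶜ-suc _ ⟩
  Σᶜ (λ ξ → fourier F (false ∷ ξ) · χ ξ l) ⊞ Σᶜ (λ ξ → fourier F (true ∷ ξ) · sgn (b xor dot ξ l))
    ≡⟨ cong₂ _⊞_ (trans (∫-cong λ ξ → cong (_· χ ξ l) (fourier-∷ F false ξ)) (fourier-inversion (F′ false) l))
         (trans (∫-cong λ ξ → trans (cong₂ _·_ (fourier-∷ F true ξ) (sgn-xor b (dot ξ l)))
          (solve 3 (λ a s x → a :* (s :* x) := s :* (a :* x)) refl (fourier (F′ true) ξ) (sgn b) (χ ξ l)))
          (trans (∫-· (sgn b) _) (cong (sgn b ·_) (fourier-inversion (F′ true) l)))) ⟩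
  F′ false l ⊞ sgn b · F′ true l
    ≡⟨ combine b ⟩
  F (b ∷ l) ∎
  where
  F′ : Bool → Cube _ → ℚ
  F′ c k = ½ · F (false ∷ k) ⊞ (½ · sgn c) · F (true ∷ k)
  combine : ∀ b → F′ false l ⊞ sgn b · F′ true l ≡ F (b ∷ l)
  combine false = solve 2 (λ p q → (con ½ :* p :+ (con ½ :* con 1ℚ) :* q) :+ con 1ℚ :* (con ½ :* p :+ (con ½ :* (:- con 1ℚ)) :* q) := p) refl (F (false ∷ l)) (F (true ∷ l))
  combine true = solve 2 (λ p q → (con ½ :* p :+ (con ½ :* con 1ℚ) :* q) :+ (:- con 1ℚ) :* (con ½ :* p :+ (con ½ :* (:- con 1ℚ)) :* q) := q) refl (F (false ∷ l)) (F (true ∷ l))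

parseval : ∀ {n} (F H : Cube n → ℚ) → Σᶜ (λ ξ → fourier F ξ · fourier H ξ) ≡ 𝔼 (λ x → F x · H x)
parseval F H = begin-equality
  Σᶜ (λ ξ → fourier F ξ · fourier H ξ) ≡⟨ (∫-cong λ ξ → sym (∫-· (fourier F ξ) _)) ⟩
  Σᶜ (λ ξ → 𝔼 (λ l → fourier F ξ · (H l · χ ξ l))) ≡⟨ ∫-swap _ ⟩
  𝔼 (λ l → Σᶜ (λ ξ → fourier F ξ · (H l · χ ξ l))) ≡⟨ (∫-cong λ l → trans (∫-cong λ ξ → solve 3 (λ a b c → a :* (b :* c) := b :* (a :* c)) refl (fourier F ξ) (H l) (χ ξ l))
          (trans (∫-· (H l) _) (trans (cong (H l ·_) (fourier-inversion F l)) (·-comm (H l) (F l))))) ⟩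
  𝔼 (λ x → F x · H x) ∎

-- Self-duality of the ambiguity function

-- The squared ambiguity function |𝔼ₓ f(x) f(x+h) (−1)^(ξ·x)|², whose square has integral the eighth power of the U³ norm.
module Ambiguity {n : ℕ} (f : Cube n → ℚ) (f² : ∀ x → f x · f x ≡ 1ℚ) where

  a : Cube n → Cube n → ℚ
  a h ξ = 𝔼 (λ x → (f x · f (x ⊕ h)) · χ ξ x)

  w : Cube n × Cube n → ℚ
  w (h , ξ) = a h ξ · a h ξ

  -- The mean of the second multiplicative derivative of `f`; its mean square over `h` and `k` is
  -- the eighth power of the U³ norm.
  Δ : Cube n → Cube n → ℚ
  Δ h k = 𝔼 (λ x → (f x · f (x ⊕ h)) · (f (x ⊕ k) · f ((x ⊕ k) ⊕ h)))

  Δ-sym : ∀ h k → Δ h k ≡ Δ k h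
  Δ-sym h k = ∫-cong λ x → trans (cong (λ t → (f x · f (x ⊕ h)) · (f (x ⊕ k) · f t)) (trans (⊕-assoc x k h) (trans (cong (x ⊕_) (⊕-comm k h)) (sym (⊕-assoc x h k)))))
    (solve 4 (λ a b c d → (a :* b) :* (c :* d) := (a :* c) :* (b :* d)) refl (f x) (f (x ⊕ h)) (f (x ⊕ k)) (f ((x ⊕ h) ⊕ k)))

  -- The power spectrum of `f x · f (x ⊕ h)` is the transform of its autocorrelation.
  w-fourier : ∀ h ξ → w (h , ξ) ≡ fourier (Δ h) ξ
  w-fourier h ξ = begin-equality
    a h ξ · a h ξ ≡⟨ sym (∫-sep A A) ⟩
    𝔼 (λ x → 𝔼 (λ y → A x · A y)) ≡⟨ (∫-cong λ x → sym (𝔼-translate x (λ y → A x · A y))) ⟩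
    𝔼 (λ x → 𝔼 (λ k → A x · A (x ⊕ k))) ≡⟨ ∫-swap _ ⟩
    𝔼 (λ k → 𝔼 (λ x → A x · A (x ⊕ k))) ≡⟨ (∫-cong λ k → trans (∫-cong λ x → step k x) (∫-·ʳ (χ ξ k) _)) ⟩
    fourier (Δ h) ξ ∎
    where
    A : Cube n → ℚ
    A x = (f x · f (x ⊕ h)) · χ ξ x
    step : ∀ k x → A x · A (x ⊕ k) ≡ ((f x · f (x ⊕ h)) · (f (x ⊕ k) · f ((x ⊕ k) ⊕ h))) · χ ξ k
    step k x = trans (cong (λ t → A x · ((f (x ⊕ k) · f ((x ⊕ k) ⊕ h)) · t)) (χ-⊕ʳ ξ x k))
      (trans (solve 4 (λ p q s t → (p :* s) :* (q :* (s :* t)) := (p :* q) :* t :* (s :* s)) refl (f x · f (x ⊕ h)) (f (x ⊕ k) · f ((x ⊕ k) ⊕ h)) (χ ξ x) (χ ξ k))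
        (trans (cong (((f x · f (x ⊕ h)) · (f (x ⊕ k) · f ((x ⊕ k) ⊕ h))) · χ ξ k ·_) (χ-sq ξ x)) (·-idʳ _)))

  Σw·χ : ∀ h k → Σᶜ (λ ξ → w (h , ξ) · χ ξ k) ≡ Δ h k
  Σw·χ h k = trans (∫-cong λ ξ → cong (_· χ ξ k) (w-fourier h ξ)) (fourier-inversion (Δ h) k)

  ff² : ∀ x y → (f x · f y) · (f x · f y) ≡ 1ℚ
  ff² x y = trans (solve 2 (λ a b → (a :* b) :* (a :* b) := (a :* a) :* (b :* b)) refl (f x) (f y)) (trans (cong₂ _·_ (f² x) (f² y)) (·-idˡ 1ℚ))

  Σw : ∀ h → Σᶜ (λ ξ → w (h , ξ)) ≡ 1ℚ
  Σw h = begin-equality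
    Σᶜ (λ ξ → w (h , ξ)) ≡⟨ (∫-cong λ ξ → sym (trans (cong (w (h , ξ) ·_) (χ-𝟎ʳ ξ)) (·-idʳ _))) ⟩
    Σᶜ (λ ξ → w (h , ξ) · χ ξ 𝟎) ≡⟨ Σw·χ h 𝟎 ⟩
    Δ h 𝟎 ≡⟨ (∫-cong λ x → trans (cong (λ t → (f x · f (x ⊕ h)) · (f t · f (t ⊕ h))) (⊕-idʳ x)) (ff² x (x ⊕ h))) ⟩
    𝔼 (λ _ → 1ℚ) ≡⟨ avg-prob n ⟩
    1ℚ ∎

  w≥0 : ∀ x → 0ℚ ≤ w x
  w≥0 (h , ξ) = 0≤sq (a h ξ)

  w≤1 : ∀ x → w x ≤ 1ℚ
  w≤1 (h , ξ) = ≤-trans (jensen (avg-prob n) _) (≤-reflexive (trans (∫-cong λ x →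
    trans (solve 2 (λ p s → (p :* s) :* (p :* s) := (p :* p) :* (s :* s)) refl (f x · f (x ⊕ h)) (χ ξ x))
      (trans (cong₂ _·_ (ff² x (x ⊕ h)) (χ-sq ξ x)) (·-idˡ 1ℚ))) (avg-prob n)))

  phase : Measure (Cube n × Cube n)
  phase = avg n ⊗ cnt n

  char : Cube n × Cube n → Cube n × Cube n → ℚ
  char (h , ξ) (k , η) = χ η h · χ ξ k

  -- Comes from the symmetry of `Δ`: `w (h , ξ)` is the transform of `Δ h k` in `k`, while `Δ k h`
  -- is recovered from `w (k , η)` by inversion.
  w-self-dual : ∀ h ξ → w (h , ξ) ≡ 𝔼 (λ k → Σᶜ (λ η → w (k , η) · (χ η h · χ ξ k)))
  w-self-dual h ξ = begin-equality
    w (h , ξ) ≡⟨ w-fourier h ξ ⟩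
    𝔼 (λ k → Δ h k · χ ξ k) ≡⟨ (∫-cong λ k → cong (_· χ ξ k) (trans (Δ-sym h k) (sym (Σw·χ k h)))) ⟩
    𝔼 (λ k → Σᶜ (λ η → w (k , η) · χ η h) · χ ξ k) ≡⟨ (∫-cong λ k → trans (sym (∫-·ʳ (χ ξ k) _)) (∫-cong λ η → ·-assoc (w (k , η)) (χ η h) (χ ξ k))) ⟩
    𝔼 (λ k → Σᶜ (λ η → w (k , η) · (χ η h · χ ξ k))) ∎

  ∫ww : ∫ phase (λ x → w x · w x) ≡ 𝔼 (λ h → 𝔼 (λ k → Δ h k · Δ h k))
  ∫ww = trans (∫-⊗ _) (∫-cong λ h → trans (∫-cong λ ξ → cong₂ _·_ (w-fourier h ξ) (w-fourier h ξ)) (parseval (Δ h) (Δ h)))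

  weight : SelfDualWeight (Cube n × Cube n)
  weight = record
    { _∙_ = λ { (h , ξ) (k , η) → h ⊕ k , ξ ⊕ η }
    ; ε = 𝟎 , 𝟎
    ; ∙-assoc = λ { (h , ξ) (k , η) (l , ζ) → cong₂ _,_ (⊕-assoc h k l) (⊕-assoc ξ η ζ) }
    ; ∙-comm = λ { (h , ξ) (k , η) → cong₂ _,_ (⊕-comm h k) (⊕-comm ξ η) }
    ; ∙-idˡ = λ { (h , ξ) → cong₂ _,_ (⊕-idˡ h) (⊕-idˡ ξ) }
    ; ∙-self = λ { (h , ξ) → cong₂ _,_ (⊕-self h) (⊕-self ξ) }
    ; μ = phase
    ; complete = λ { (h , ξ) → ∈-concatMap⁺ (λ x → L.map (x ,_) (allCube n)) (lose (allCube-complete h) (∈-map⁺ (h ,_) (allCube-complete ξ))) }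
    ; invariant = λ { (h , ξ) F → trans (∫-⊗ _) (trans (𝔼-translate h (λ k → Σᶜ (λ η → F (k , ξ ⊕ η))))
          (trans (∫-cong λ k → Σᶜ-translate ξ (λ η → F (k , η))) (sym (∫-⊗ F)))) }
    ; w = w
    ; w≥0 = w≥0
    ; w≤1 = w≤1
    ; w-mass = trans (∫-⊗ w) (trans (∫-cong Σw) (avg-prob n))
    ; char = char
    ; char-sym = λ { (h , ξ) (k , η) → ·-comm (χ η h) (χ ξ k) }
    ; char-∙ = λ { (h , ξ) (k , η) (l , ζ) → trans (cong₂ _·_ (χ-⊕ʳ ζ h k) (χ-⊕ˡ ξ η l))
          (solve 4 (λ a b c d → (a :* b) :* (c :* d) := (a :* c) :* (b :* d)) refl (χ ζ h) (χ ζ k) (χ ξ l) (χ η l)) }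
    ; self-dual = λ { (h , ξ) → trans (w-self-dual h ξ) (sym (∫-⊗ _)) }
    }

searchCube : ∀ {n} {P : Cube n → Set} → (∀ x → Dec (P x)) → Dec (∃ P)
searchCube {n} = search (allCube n) allCube-complete

-- Linear maps over the field of two elements

Additive : ∀ {n m} → (Cube n → Cube m) → Set
Additive M = ∀ x y → M (x ⊕ y) ≡ M x ⊕ M y

AdditiveForm : ∀ {n} → (Cube n → Bool) → Set
AdditiveForm α = ∀ x y → α (x ⊕ y) ≡ α x xor α y

-- Elimination on the first coordinate of the base: if `V` has a vector above first coordinate
-- `true`, one such vector fixes the value of `M` there; otherwise `M` ignores this coordinate.
section : ∀ {n m} (V : Cube n × Cube m → Set) → (∀ v → Dec (V v)) → V (𝟎 , 𝟎) →
  (∀ {h ξ k η} → V (h , ξ) → V (k , η) → V (h ⊕ k , ξ ⊕ η)) →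
  ∃ λ M → Additive M × (∀ {h ξ} → V (h , ξ) → V (h , M h))
section {zero} V V? V-ε V-⊕ = (λ _ → 𝟎) , (λ _ _ → sym (⊕-self 𝟎)) , λ { {[]} _ → V-ε }
section {suc n} V V? V-ε V-⊕
  with section (λ (h , ξ) → V (false ∷ h , ξ)) (λ (h , ξ) → V? (false ∷ h , ξ)) V-ε V-⊕
     | searchCube (λ h → searchCube (λ ξ → V? (true ∷ h , ξ)))
... | M , M-add , M-V | no ¬t = (λ { (_ ∷ h) → M h }) , (λ { (_ ∷ h) (_ ∷ k) → M-add h k }) ,
      λ { {false ∷ h} v → M-V v ; {true ∷ h} {ξ} v → ⊥-elim (¬t (h , ξ , v)) }
... | M , M-add , M-V | yes (h₁ , ξ₁ , v₁) = M′ , add , in-V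
  where
  M′ : Cube (suc n) → Cube _
  M′ (false ∷ h) = M h
  M′ (true  ∷ h) = M (h ⊕ h₁) ⊕ ξ₁
  add : Additive M′
  add (false ∷ h) (false ∷ k) = M-add h k
  add (false ∷ h) (true  ∷ k) = trans (cong (_⊕ ξ₁) (trans (cong M (⊕-assoc h k h₁)) (M-add h (k ⊕ h₁)))) (⊕-assoc (M h) (M (k ⊕ h₁)) ξ₁)
  add (true  ∷ h) (false ∷ k) = trans (cong (_⊕ ξ₁) (trans (cong M (trans (⊕-assoc h k h₁) (trans (⊕-swap h k h₁) (⊕-comm k (h ⊕ h₁))))) (M-add (h ⊕ h₁) k)))
    (trans (⊕-assoc (M (h ⊕ h₁)) (M k) ξ₁) (trans (cong (M (h ⊕ h₁) ⊕_) (⊕-comm (M k) ξ₁)) (sym (⊕-assoc (M (h ⊕ h₁)) ξ₁ (M k)))))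
  add (true  ∷ h) (true  ∷ k) = sym (trans (⊕-interchange (M (h ⊕ h₁)) ξ₁ (M (k ⊕ h₁)) ξ₁)
    (trans (cong₂ _⊕_ (sym (M-add (h ⊕ h₁) (k ⊕ h₁))) (⊕-self ξ₁)) (trans (⊕-idʳ _)
      (cong M (trans (⊕-interchange h h₁ k h₁) (trans (cong ((h ⊕ k) ⊕_) (⊕-self h₁)) (⊕-idʳ (h ⊕ k))))))))
  in-V : ∀ {h ξ} → V (h , ξ) → V (h , M′ h)
  in-V {false ∷ h} v = M-V v
  in-V {true  ∷ h} v = subst (λ t → V (true ∷ t , M (h ⊕ h₁) ⊕ ξ₁)) (trans (⊕-assoc h h₁ h₁) (trans (cong (h ⊕_) (⊕-self h₁)) (⊕-idʳ h)))
    (V-⊕ (M-V (V-⊕ v v₁)) v₁)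

riesz : ∀ {n} → (Cube n → Bool) → Cube n
riesz {zero}  α = []
riesz {suc n} α = α (true ∷ 𝟎) ∷ riesz (λ x → α (false ∷ x))

dot-riesz : ∀ {n} (α : Cube n → Bool) → AdditiveForm α → ∀ x → dot (riesz α) x ≡ α x
dot-riesz α h [] = sym (trans (h [] []) (𝔹ₚ.xor-same (α [])))
dot-riesz α h (false ∷ x) = trans (cong₂ _xor_ (𝔹ₚ.∧-zeroʳ (α (true ∷ 𝟎))) (dot-riesz (λ x → α (false ∷ x)) (λ x y → h (false ∷ x) (false ∷ y)) x)) refl
dot-riesz α h (true  ∷ x) = trans (cong₂ _xor_ (𝔹ₚ.∧-identityʳ (α (true ∷ 𝟎))) (dot-riesz (λ x → α (false ∷ x)) (λ x y → h (false ∷ x) (false ∷ y)) x))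
  (trans (sym (h (true ∷ 𝟎) (false ∷ x))) (cong (λ t → α (true ∷ t)) (⊕-idˡ x)))

scale : ∀ {n} → Bool → Cube n → Cube n
scale c v = if c then v else 𝟎

scale-xor : ∀ {n} c d (v : Cube n) → scale (c xor d) v ≡ scale c v ⊕ scale d v
scale-xor false d     v = sym (⊕-idˡ (scale d v))
scale-xor true  false v = sym (⊕-idʳ v)
scale-xor true  true  v = sym (⊕-self v)

dot-scale : ∀ {n} c (v x : Cube n) → dot (scale c v) x ≡ c ∧ dot v x
dot-scale false v x = trans (dot-comm 𝟎 x) (dot-𝟎ʳ x)
dot-scale true  v x = refl

perturb : ∀ {n} → (Cube n → Cube n) → (Cube n → Bool) → Cube n → Cube n → Cube n
perturb M α v h = M h ⊕ scale (α h) v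

perturb-additive : ∀ {n} {M : Cube n → Cube n} {α} v → Additive M → AdditiveForm α → Additive (perturb M α v)
perturb-additive {M = M} {α} v hM hα x y = trans (cong₂ _⊕_ (hM x y) (trans (cong (λ c → scale c v) (hα x y)) (scale-xor (α x) (α y) v)))
  (⊕-interchange (M x) (M y) (scale (α x) v) (scale (α y) v))

-- (𝔼ψ)² = 𝔼ψ for a character ψ.
character-mean≥0 : ∀ {n} (ψ : Cube n → ℚ) → (∀ x y → ψ (x ⊕ y) ≡ ψ x · ψ y) → 0ℚ ≤ 𝔼 ψ
character-mean≥0 {n} ψ h = subst (0ℚ ≤_) eq (0≤sq (𝔼 ψ))
  where
  eq : 𝔼 ψ · 𝔼 ψ ≡ 𝔼 ψ
  eq = begin-equality
    𝔼 ψ · 𝔼 ψ ≡⟨ sym (∫-sep ψ ψ) ⟩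
    𝔼 (λ x → 𝔼 (λ y → ψ x · ψ y)) ≡⟨ (∫-cong λ x → trans (∫-cong λ y → sym (h x y)) (𝔼-translate x ψ)) ⟩
    𝔼 (λ x → 𝔼 ψ) ≡⟨ ∫-const (avg-prob n) (𝔼 ψ) ⟩
    𝔼 ψ ∎

-- Translation by `x` turns the mean into its negative.
character-mean-0 : ∀ {n} (ψ : Cube n → ℚ) → (∀ x y → ψ (x ⊕ y) ≡ ψ x · ψ y) → ∀ x → ψ x ≡ ⊖ 1ℚ → 𝔼 ψ ≡ 0ℚ
character-mean-0 ψ h x hx = begin-equality
  𝔼 ψ ≡⟨ solve 1 (λ e → e := con ½ :* (e :+ e)) refl (𝔼 ψ) ⟩
  ½ · (𝔼 ψ ⊞ 𝔼 ψ) ≡⟨ cong (λ t → ½ · (𝔼 ψ ⊞ t)) (sym (𝔼-translate x ψ)) ⟩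
  ½ · (𝔼 ψ ⊞ 𝔼 (λ y → ψ (x ⊕ y))) ≡⟨ cong (λ t → ½ · (𝔼 ψ ⊞ t)) (trans (∫-cong λ y → trans (h x y) (cong (_· ψ y) hx)) (∫-· (⊖ 1ℚ) ψ)) ⟩
  ½ · (𝔼 ψ ⊞ ⊖ 1ℚ · 𝔼 ψ) ≡⟨ solve 1 (λ e → con ½ :* (e :+ (:- con 1ℚ) :* e) := con 0ℚ) refl (𝔼 ψ) ⟩
  0ℚ ∎

≤1-of-sq : ∀ {p} → p · p ≡ 1ℚ → p ≤ 1ℚ
≤1-of-sq {p} h = ≤-by (½ · ((1ℚ ⊟ p) · (1ℚ ⊟ p))) (·-nonNeg 0≤½ (0≤sq (1ℚ ⊟ p)))
  (trans (solve 0 (con 1ℚ := con ½ :* (con 1ℚ :+ con 1ℚ)) refl) (trans (cong (λ t → ½ · (1ℚ ⊞ t)) (sym h))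
    (trans (solve 1 (λ p → con ½ :* (con 1ℚ :+ p :* p) := p :+ con ½ :* ((con 1ℚ :- p) :* (con 1ℚ :- p))) refl p) refl)))

-- The mass of the weight on graphs of linear maps

module LinearPhase {n : ℕ} (f : Cube n → ℚ) (f² : ∀ x → f x · f x ≡ 1ℚ) where
  open Ambiguity f f²

  Ā : (Cube n → Cube n) → ℚ
  Ā M = 𝔼 (λ h → w (h , M h))

  Ā≥0 : ∀ M → 0ℚ ≤ Ā M
  Ā≥0 M = ∫-nonNeg λ h → w≥0 (h , M h)

  module _ {M : Cube n → Cube n} (M-add : Additive M) where

    χM-⊕ : ∀ p x y → χ (M (x ⊕ y)) p ≡ χ (M x) p · χ (M y) p
    χM-⊕ p x y = trans (cong (λ t → χ t p) (M-add x y)) (χ-⊕ˡ (M x) (M y) p)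

    twist : (Cube n → Bool) → Cube n → Cube n → ℚ
    twist α p q = 𝔼 (λ h → (χ q h · χ (M h) p) · sgn (α h))

    twist≥0 : ∀ {α} → AdditiveForm α → ∀ p q → 0ℚ ≤ twist α p q
    twist≥0 {α} hα p q = character-mean≥0 _ λ x y → trans
      (cong₂ _·_ (cong₂ _·_ (χ-⊕ʳ q x y) (χM-⊕ p x y)) (trans (cong sgn (hα x y)) (sgn-xor (α x) (α y))))
      (solve 6 (λ a b c d e f → ((a :* b) :* (c :* d)) :* (e :* f) := ((a :* c) :* e) :* ((b :* d) :* f)) refl
        (χ q x) (χ q y) (χ (M x) p) (χ (M y) p) (sgn (α x)) (sgn (α y)))

    -- Poisson summation on the graph of `M`: after self-duality the translation by `k` survives
    -- only as the sign `χ k p` in front of `twist`, which is nonnegative for additive `α`.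
    Ā-twisted : ∀ α k → 𝔼 (λ h → w (h , M h ⊕ k) · sgn (α h)) ≡ 𝔼 (λ p → Σᶜ (λ q → w (p , q) · (χ k p · twist α p q)))
    Ā-twisted α k = begin-equality
      𝔼 (λ h → w (h , M h ⊕ k) · sgn (α h))
        ≡⟨ (∫-cong λ h → trans (cong (_· sgn (α h)) (w-self-dual h (M h ⊕ k))) (trans (sym (∫-·ʳ (sgn (α h)) _)) (∫-cong λ p → sym (∫-·ʳ (sgn (α h)) _)))) ⟩
      𝔼 (λ h → 𝔼 (λ p → Σᶜ (λ q → (w (p , q) · (χ q h · χ (M h ⊕ k) p)) · sgn (α h))))
        ≡⟨ ∫-swap _ ⟩
      𝔼 (λ p → 𝔼 (λ h → Σᶜ (λ q → (w (p , q) · (χ q h · χ (M h ⊕ k) p)) · sgn (α h))))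
        ≡⟨ (∫-cong λ p → ∫-swap _) ⟩
      𝔼 (λ p → Σᶜ (λ q → 𝔼 (λ h → (w (p , q) · (χ q h · χ (M h ⊕ k) p)) · sgn (α h))))
        ≡⟨ (∫-cong λ p → ∫-cong λ q → trans (∫-cong λ h → trans (cong (λ t → (w (p , q) · (χ q h · t)) · sgn (α h)) (χ-⊕ˡ (M h) k p))
          (solve 5 (λ w a b c s → (w :* (a :* (b :* c))) :* s := (w :* c) :* ((a :* b) :* s)) refl (w (p , q)) (χ q h) (χ (M h) p) (χ k p) (sgn (α h))))
          (trans (∫-· (w (p , q) · χ k p) _) (·-assoc (w (p , q)) (χ k p) _))) ⟩
      𝔼 (λ p → Σᶜ (λ q → w (p , q) · (χ k p · twist α p q))) ∎

    Ā-twisted₀ : ∀ α → 𝔼 (λ h → w (h , M h) · sgn (α h)) ≡ 𝔼 (λ p → Σᶜ (λ q → w (p , q) · twist α p q))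
    Ā-twisted₀ α = trans (∫-cong λ h → cong (λ t → w (h , t) · sgn (α h)) (sym (⊕-idʳ (M h)))) (trans (Ā-twisted α 𝟎)
      (∫-cong λ p → ∫-cong λ q → cong (w (p , q) ·_) (trans (cong (_· twist α p q) (trans (cong sgn (dot-comm 𝟎 p)) (χ-𝟎ʳ p))) (·-idˡ _))))

    -- The signs `χ k p` multiply nonnegative quantities and are largest when all are 1, as they are
    -- for `k = 𝟎`.
    Ā-shift : ∀ k → 𝔼 (λ h → w (h , M h ⊕ k)) ≤ Ā M
    Ā-shift k = begin
      𝔼 (λ h → w (h , M h ⊕ k)) ≡⟨ (∫-cong λ h → sym (·-idʳ _)) ⟩
      𝔼 (λ h → w (h , M h ⊕ k) · sgn false) ≡⟨ Ā-twisted (λ _ → false) k ⟩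
      𝔼 (λ p → Σᶜ (λ q → w (p , q) · (χ k p · twist (λ _ → false) p q))) ≤⟨ (∫-mono λ p → ∫-mono λ q → ·-monoˡ (w≥0 (p , q)) (·-≤ʳ (twist≥0 {α = λ _ → false} (λ _ _ → refl) p q) (sgn≤1 (dot k p)))) ⟩
      𝔼 (λ p → Σᶜ (λ q → w (p , q) · twist (λ _ → false) p q)) ≡⟨ sym (Ā-twisted₀ (λ _ → false)) ⟩
      𝔼 (λ h → w (h , M h) · sgn false) ≡⟨ (∫-cong λ h → ·-idʳ _) ⟩
      Ā M ∎

    -- The two maps agree where `α` vanishes. The mass there is half the sum of the plain mass and
    -- the mass twisted by `sgn (α h)`, and self-duality makes the twisted mass nonnegative.
    Ā-perturb : ∀ {α} → AdditiveForm α → ∀ v → ½ · Ā M ≤ Ā (perturb M α v)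
    Ā-perturb {α} hα v = begin
      ½ · Ā M ≤⟨ ·-monoˡ 0≤½ (≤-by _ (subst (0ℚ ≤_) (sym (Ā-twisted₀ α)) (∫-nonNeg λ p → ∫-nonNeg λ q → ·-nonNeg (w≥0 (p , q)) (twist≥0 {α = α} hα p q))) refl) ⟩
      ½ · (Ā M ⊞ 𝔼 (λ h → w (h , M h) · sgn (α h))) ≡⟨ cong (½ ·_) (sym (∫-⊞ _ _)) ⟩
      ½ · 𝔼 (λ h → w (h , M h) ⊞ w (h , M h) · sgn (α h)) ≡⟨ sym (∫-· ½ _) ⟩
      𝔼 (λ h → ½ · (w (h , M h) ⊞ w (h , M h) · sgn (α h))) ≤⟨ ∫-mono pointwise ⟩
      Ā (perturb M α v) ∎
      where
      pointwise : ∀ h → ½ · (w (h , M h) ⊞ w (h , M h) · sgn (α h)) ≤ w (h , perturb M α v h)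
      pointwise h with α h
      ... | false = ≤-reflexive (trans (solve 1 (λ a → con ½ :* (a :+ a :* con 1ℚ) := a) refl (w (h , M h))) (cong (λ t → w (h , t)) (sym (⊕-idʳ (M h)))))
      ... | true = ≤-trans (≤-reflexive (solve 1 (λ a → con ½ :* (a :+ a :* (:- con 1ℚ)) := con 0ℚ) refl (w (h , M h)))) (w≥0 (h , M h ⊕ v))

  -- Each fibre of `V` is empty or a translate of the fibre over `𝟎`, of size `K`. So `K` translates
  -- of the graph of `M` cover `V`, whence `κ ≤ K · Ā M`. As `w` has mass 1 over each `h`, the
  -- projection of `V` has density at least `κ`, so `κ · K` is at most the measure of `V`. Together
  -- with `small` this removes `K`.
  fromSubspace : ∀ {κ τ} → 0ℚ ≤ κ → 0ℚ ≤ τ → HeavySubspace weight κ τ → ∃ λ M → Additive M × κ · (κ · τ) ≤ Ā M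
  fromSubspace {κ} {τ} κ≥0 τ≥0 H = M , M-add , final
    where
    open HeavySubspace H
    sec : ∃ λ M → Additive M × (∀ {h ξ} → V (h , ξ) → V (h , M h))
    sec = section V V? V-ε V-∙
    M : Cube n → Cube n
    M = proj₁ sec
    M-add : Additive M
    M-add = proj₁ (proj₂ sec)
    iV : Cube n → Cube n → ℚ
    iV h ξ = ind (V? (h , ξ))
    iV≥0 : ∀ h ξ → 0ℚ ≤ iV h ξ
    iV≥0 h ξ = ind≥0 (V? (h , ξ))
    K : ℚ
    K = Σᶜ (λ k → iV 𝟎 k)
    K≥0 : 0ℚ ≤ K
    K≥0 = ∫-nonNeg (iV≥0 𝟎)
    iV-mono : ∀ {h ξ k η} → (V (h , ξ) → V (k , η)) → iV h ξ ≤ iV k η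
    iV-mono {h} {ξ} {k} {η} i = ind-≤ (V? (h , ξ)) (iV≥0 k η) λ v → ≤-reflexive (sym (ind-yes (V? (k , η)) (i v)))
    toFibre : ∀ h ξ → V (h , M h ⊕ ξ) → V (𝟎 , ξ)
    toFibre h ξ v = subst V (cong₂ _,_ (⊕-self h) (⊕-cancel (M h) ξ)) (V-∙ (proj₂ (proj₂ sec) v) v)
    fromFibre : ∀ h ξ → V (h , M h) → V (𝟎 , ξ) → V (h , M h ⊕ ξ)
    fromFibre h ξ v u = subst V (cong (_, M h ⊕ ξ) (⊕-idʳ h)) (V-∙ v u)
    upper : κ ≤ K · Ā M
    upper = begin
      κ ≤⟨ heavy ⟩
      ∫ phase (λ v → ind (V? v) · w v) ≡⟨ ∫-⊗ _ ⟩
      𝔼 (λ h → Σᶜ (λ ξ → iV h ξ · w (h , ξ))) ≡⟨ (∫-cong λ h → sym (Σᶜ-translate (M h) _)) ⟩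
      𝔼 (λ h → Σᶜ (λ ξ → iV h (M h ⊕ ξ) · w (h , M h ⊕ ξ))) ≤⟨ (∫-mono λ h → ∫-mono λ ξ → ·-monoʳ (w≥0 (h , M h ⊕ ξ)) (iV-mono (toFibre h ξ))) ⟩
      𝔼 (λ h → Σᶜ (λ ξ → iV 𝟎 ξ · w (h , M h ⊕ ξ))) ≡⟨ ∫-swap _ ⟩
      Σᶜ (λ ξ → 𝔼 (λ h → iV 𝟎 ξ · w (h , M h ⊕ ξ))) ≡⟨ (∫-cong λ ξ → ∫-· (iV 𝟎 ξ) _) ⟩
      Σᶜ (λ ξ → iV 𝟎 ξ · 𝔼 (λ h → w (h , M h ⊕ ξ))) ≤⟨ (∫-mono λ ξ → ·-monoˡ (iV≥0 𝟎 ξ) (Ā-shift M-add ξ)) ⟩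
      Σᶜ (λ ξ → iV 𝟎 ξ · Ā M) ≡⟨ ∫-·ʳ (Ā M) _ ⟩
      K · Ā M ∎
    fibre : ∀ h → Σᶜ (λ ξ → iV h ξ · w (h , ξ)) · K ≤ Σᶜ (iV h)
    fibre h with V? (h , M h)
    ... | yes v = begin
      Σᶜ (λ ξ → iV h ξ · w (h , ξ)) · K ≤⟨ ·-≤ʳ K≥0 (≤-trans (∫-mono λ ξ → ·-≤ʳ (w≥0 (h , ξ)) (ind≤1 (V? (h , ξ)))) (≤-reflexive (Σw h))) ⟩
      Σᶜ (iV 𝟎) ≤⟨ ∫-mono (λ ξ → iV-mono (fromFibre h ξ v)) ⟩
      Σᶜ (λ ξ → iV h (M h ⊕ ξ)) ≡⟨ Σᶜ-translate (M h) (iV h) ⟩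
      Σᶜ (iV h) ∎
    ... | no ¬v = ≤-trans (≤-reflexive (trans (cong (_· K) (trans (∫-cong λ ξ → trans (cong (_· w (h , ξ)) (ind-no (V? (h , ξ)) λ v → ¬v (proj₂ (proj₂ sec) v))) (·-zeroˡ _)) ∫-0)) (·-zeroˡ K)))
      (∫-nonNeg (iV≥0 h))
    κK : κ · K ≤ ∫ phase (λ v → ind (V? v))
    κK = begin
      κ · K ≤⟨ ·-monoʳ K≥0 heavy ⟩
      ∫ phase (λ v → ind (V? v) · w v) · K ≡⟨ cong (_· K) (∫-⊗ _) ⟩
      𝔼 (λ h → Σᶜ (λ ξ → iV h ξ · w (h , ξ))) · K ≡⟨ sym (∫-·ʳ K _) ⟩
      𝔼 (λ h → Σᶜ (λ ξ → iV h ξ · w (h , ξ)) · K) ≤⟨ ∫-mono fibre ⟩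
      𝔼 (λ h → Σᶜ (iV h)) ≡⟨ sym (∫-⊗ _) ⟩
      ∫ phase (λ v → ind (V? v)) ∎
    final : κ · (κ · τ) ≤ Ā M
    final = begin
      κ · (κ · τ) ≤⟨ ·-monoʳ (·-nonNeg κ≥0 τ≥0) upper ⟩
      (K · Ā M) · (κ · τ) ≡⟨ solve 4 (λ k a c t → (k :* a) :* (c :* t) := (t :* (c :* k)) :* a) refl K (Ā M) κ τ ⟩
      (τ · (κ · K)) · Ā M ≤⟨ ·-monoʳ (Ā≥0 M) (·-monoˡ τ≥0 κK) ⟩
      (τ · ∫ phase (λ v → ind (V? v))) · Ā M ≤⟨ ·-≤ʳ (Ā≥0 M) small ⟩
      Ā M ∎

-- Making the linear map alternating

module Symmetrise {n : ℕ} (f : Cube n → ℚ) (f² : ∀ x → f x · f x ≡ 1ℚ) where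
  open Ambiguity f f²
  open LinearPhase f f²

  asym : (Cube n → Cube n) → Cube n → Cube n → Bool
  asym M x y = dot (M x) y xor dot (M y) x

  asym-sgn : ∀ M x y → sgn (asym M x y) ≡ χ (M x) y · χ (M y) x
  asym-sgn M x y = sgn-xor (dot (M x) y) (dot (M y) x)

  asym-sym : ∀ M x y → asym M x y ≡ asym M y x
  asym-sym M x y = 𝔹ₚ.xor-comm (dot (M x) y) (dot (M y) x)

  asym-alt : ∀ M x → asym M x x ≡ false
  asym-alt M x = 𝔹ₚ.xor-same (dot (M x) x)

  bias : (Cube n → Cube n) → Cube n → ℚ
  bias M d = 𝔼 (λ x → sgn (asym M x d))

  -- The proportion of vectors in the radical of the form asym M.
  radical : (Cube n → Cube n) → ℚ
  radical M = 𝔼 (bias M)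

  module _ {M : Cube n → Cube n} (M-add : Additive M) where

    asym-⊕ : ∀ x y z → asym M x (y ⊕ z) ≡ asym M x y xor asym M x z
    asym-⊕ x y z = trans (cong₂ _xor_ (dot-⊕ʳ (M x) y z) (trans (cong (λ t → dot t x) (M-add y z)) (dot-⊕ˡ (M y) (M z) x)))
      (xor-interchange (dot (M x) y) (dot (M x) z) (dot (M y) x) (dot (M z) x))

    asym-⊕ˡ : ∀ z x y → asym M (x ⊕ y) z ≡ asym M x z xor asym M y z
    asym-⊕ˡ z x y = trans (asym-sym M (x ⊕ y) z) (trans (asym-⊕ z x y) (cong₂ _xor_ (asym-sym M z x) (asym-sym M z y)))

    sgn-asym-⊕ˡ : ∀ z x y → sgn (asym M (x ⊕ y) z) ≡ sgn (asym M x z) · sgn (asym M y z)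
    sgn-asym-⊕ˡ z x y = trans (cong sgn (asym-⊕ˡ z x y)) (sgn-xor (asym M x z) (asym M y z))

    bias≥0 : ∀ d → 0ℚ ≤ bias M d
    bias≥0 d = character-mean≥0 _ (sgn-asym-⊕ˡ d)

    bias-1 : ∀ d → (∀ x → asym M x d ≡ false) → bias M d ≡ 1ℚ
    bias-1 d h = trans (∫-cong λ x → cong sgn (h x)) (avg-prob n)

    bias-0 : ∀ d x → asym M x d ≡ true → bias M d ≡ 0ℚ
    bias-0 d x h = character-mean-0 _ (sgn-asym-⊕ˡ d) x (cong sgn h)

    radical≤1 : radical M ≤ 1ℚ
    radical≤1 = ≤-trans (∫-mono λ d → ≤-trans (∫-mono λ x → sgn≤1 (asym M x d)) (≤-reflexive (avg-prob n))) (≤-reflexive (avg-prob n))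

    P : Cube n → Cube n → ℚ
    P e x = (f x · f (x ⊕ e)) · (χ (M x) x · χ (M e) x)

    P-sq : ∀ e x → P e x · P e x ≡ 1ℚ
    P-sq e x = trans (solve 3 (λ p a b → (p :* (a :* b)) :* (p :* (a :* b)) := (p :* p) :* ((a :* a) :* (b :* b))) refl (f x · f (x ⊕ e)) (χ (M x) x) (χ (M e) x))
      (trans (cong₂ _·_ (ff² x (x ⊕ e)) (cong₂ _·_ (χ-sq (M x) x) (χ-sq (M e) x))) (trans (cong (1ℚ ·_) (·-idˡ 1ℚ)) (·-idˡ 1ℚ)))

    PP≤1 : ∀ e x y → P e x · P e y ≤ 1ℚ
    PP≤1 e x y = ≤1-of-sq (trans (solve 2 (λ a b → (a :* b) :* (a :* b) := (a :* a) :* (b :* b)) refl (P e x) (P e y))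
      (trans (cong₂ _·_ (P-sq e x) (P-sq e y)) (·-idˡ 1ℚ)))

    -- The substitution h = x + y + e separates the variables up to the phase of asym M.
    Ā-bilinear : Ā M ≡ 𝔼 (λ e → 𝔼 (λ x → P e x · 𝔼 (λ y → P e y · sgn (asym M x y))))
    Ā-bilinear = begin-equality
      𝔼 (λ h → a h (M h) · a h (M h))
        ≡⟨ (∫-cong λ h → sym (∫-sep (A h) (A h))) ⟩
      𝔼 (λ h → 𝔼 (λ x → 𝔼 (λ y → A h x · A h y)))
        ≡⟨ trans (∫-swap _) (∫-cong λ x → ∫-swap _) ⟩
      𝔼 (λ x → 𝔼 (λ y → 𝔼 (λ h → A h x · A h y)))
        ≡⟨ (∫-cong λ x → ∫-cong λ y → trans (sym (𝔼-translate (x ⊕ y) _)) (∫-cong λ e → step x y e)) ⟩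
      𝔼 (λ x → 𝔼 (λ y → 𝔼 (λ e → P e x · (P e y · sgn (asym M x y)))))
        ≡⟨ trans (∫-cong λ x → ∫-swap _) (∫-swap _) ⟩
      𝔼 (λ e → 𝔼 (λ x → 𝔼 (λ y → P e x · (P e y · sgn (asym M x y)))))
        ≡⟨ (∫-cong λ e → ∫-cong λ x → ∫-· (P e x) _) ⟩
      𝔼 (λ e → 𝔼 (λ x → P e x · 𝔼 (λ y → P e y · sgn (asym M x y)))) ∎
      where
      A : Cube n → Cube n → ℚ
      A h x = (f x · f (x ⊕ h)) · χ (M h) x
      phase-split : ∀ x y e z → χ (M ((x ⊕ y) ⊕ e)) z ≡ (χ (M x) z · χ (M y) z) · χ (M e) z
      phase-split x y e z = trans (χM-⊕ M-add z (x ⊕ y) e) (cong (_· χ (M e) z) (χM-⊕ M-add z x y))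
      step : ∀ x y e → A ((x ⊕ y) ⊕ e) x · A ((x ⊕ y) ⊕ e) y ≡ P e x · (P e y · sgn (asym M x y))
      step x y e = begin-equality
        A ((x ⊕ y) ⊕ e) x · A ((x ⊕ y) ⊕ e) y
          ≡⟨ cong₂ _·_ (cong₂ (λ s t → (f x · f s) · t) (trans (cong (x ⊕_) (⊕-assoc x y e)) (⊕-cancel x (y ⊕ e))) (phase-split x y e x))
          (cong₂ (λ s t → (f y · f s) · t) (trans (cong (y ⊕_) (trans (⊕-assoc x y e) (⊕-swap x y e))) (⊕-cancel y (x ⊕ e))) (phase-split x y e y)) ⟩
        ((f x · f (y ⊕ e)) · ((χ (M x) x · χ (M y) x) · χ (M e) x)) · ((f y · f (x ⊕ e)) · ((χ (M x) y · χ (M y) y) · χ (M e) y))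
          ≡⟨ solve 10 (λ fx fye fy fxe a b c d e g → ((fx :* fye) :* ((a :* b) :* c)) :* ((fy :* fxe) :* ((d :* e) :* g)) :=
          ((fx :* fxe) :* (a :* c)) :* (((fy :* fye) :* (e :* g)) :* (d :* b))) refl
          (f x) (f (y ⊕ e)) (f y) (f (x ⊕ e)) (χ (M x) x) (χ (M y) x) (χ (M e) x) (χ (M x) y) (χ (M y) y) (χ (M e) y) ⟩
        P e x · (P e y · (χ (M x) y · χ (M y) x))
          ≡⟨ cong (λ t → P e x · (P e y · t)) (sym (asym-sgn M x y)) ⟩
        P e x · (P e y · sgn (asym M x y)) ∎

    Ā²≤radical : Ā M · Ā M ≤ radical M
    Ā²≤radical = begin
      Ā M · Ā M ≡⟨ cong (λ t → t · t) Ā-bilinear ⟩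
      𝔼 (λ e → 𝔼 (λ x → P e x · Q e x)) · 𝔼 (λ e → 𝔼 (λ x → P e x · Q e x)) ≤⟨ jensen (avg-prob n) _ ⟩
      𝔼 (λ e → 𝔼 (λ x → P e x · Q e x) · 𝔼 (λ x → P e x · Q e x)) ≤⟨ (∫-mono λ e → cauchy-schwarz-≤1 (avg-prob n) (P e) (Q e) (λ x → ≤-reflexive (P-sq e x))) ⟩
      𝔼 (λ e → 𝔼 (λ x → Q e x · Q e x)) ≡⟨ (∫-cong expand) ⟩
      𝔼 (λ e → 𝔼 (λ y → 𝔼 (λ z → (P e y · P e z) · bias M (y ⊕ z)))) ≤⟨ (∫-mono λ e → ∫-mono λ y → ∫-mono λ z → ·-≤ʳ (bias≥0 (y ⊕ z)) (PP≤1 e y z)) ⟩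
      𝔼 {n} (λ e → 𝔼 (λ y → 𝔼 (λ z → bias M (y ⊕ z)))) ≡⟨ (∫-cong λ e → ∫-cong λ y → 𝔼-translate y (bias M)) ⟩
      𝔼 {n} (λ e → 𝔼 {n} (λ y → radical M)) ≡⟨ trans (∫-cong λ e → ∫-const (avg-prob n) (radical M)) (∫-const (avg-prob n) (radical M)) ⟩
      radical M ∎
      where
      Q : Cube n → Cube n → ℚ
      Q e x = 𝔼 (λ y → P e y · sgn (asym M x y))
      expand : ∀ e → 𝔼 (λ x → Q e x · Q e x) ≡ 𝔼 (λ y → 𝔼 (λ z → (P e y · P e z) · bias M (y ⊕ z)))
      expand e = begin-equality
        𝔼 (λ x → Q e x · Q e x)
          ≡⟨ (∫-cong λ x → sym (∫-sep _ _)) ⟩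
        𝔼 (λ x → 𝔼 (λ y → 𝔼 (λ z → (P e y · sgn (asym M x y)) · (P e z · sgn (asym M x z)))))
          ≡⟨ trans (∫-swap _) (∫-cong λ y → ∫-swap _) ⟩
        𝔼 (λ y → 𝔼 (λ z → 𝔼 (λ x → (P e y · sgn (asym M x y)) · (P e z · sgn (asym M x z)))))
          ≡⟨ (∫-cong λ y → ∫-cong λ z → trans (∫-cong λ x → trans
          (solve 4 (λ a s b t → (a :* s) :* (b :* t) := (a :* b) :* (s :* t)) refl (P e y) (sgn (asym M x y)) (P e z) (sgn (asym M x z)))
          (cong ((P e y · P e z) ·_) (sym (trans (cong sgn (asym-⊕ x y z)) (sgn-xor (asym M x y) (asym M x z)))))) (∫-· (P e y · P e z) _)) ⟩
        𝔼 (λ y → 𝔼 (λ z → (P e y · P e z) · bias M (y ⊕ z))) ∎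

  -- `c` and `b` span a hyperbolic plane of `asym M`. The change adds to `asym M` the
  -- antisymmetrised product of the functionals `asym M b` and `asym M c`: it cancels the form at
  -- `c` and vanishes on the old radical.
  module Enlarge {M : Cube n → Cube n} (M-add : Additive M) (c b : Cube n) (c·b : asym M c b ≡ true) where

    form : Cube n → Bool
    form = asym M b

    v : Cube n
    v = riesz (asym M c)

    M′ : Cube n → Cube n
    M′ = perturb M form v

    M′-add : Additive M′
    M′-add = perturb-additive {α = form} v M-add (asym-⊕ M-add b)

    asym′ : ∀ x y → asym M′ x y ≡ asym M x y xor ((form x ∧ asym M c y) xor (form y ∧ asym M c x))
    asym′ x y = trans (cong₂ _xor_ (dotM′ x y) (dotM′ y x)) (xor-interchange (dot (M x) y) (form x ∧ asym M c y) (dot (M y) x) (form y ∧ asym M c x))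
      where
      dotM′ : ∀ x y → dot (M′ x) y ≡ dot (M x) y xor (form x ∧ asym M c y)
      dotM′ x y = trans (dot-⊕ˡ (M x) (scale (form x) v) y) (cong (dot (M x) y xor_)
        (trans (dot-scale (form x) v y) (cong (form x ∧_) (dot-riesz (asym M c) (asym-⊕ M-add c) y))))

    InRadical : Cube n → Set
    InRadical d = ∀ x → asym M x d ≡ false

    radical⊆ : ∀ d → InRadical d → ∀ x → asym M′ x d ≡ false
    radical⊆ d h x = trans (asym′ x d) (trans (cong₂ (λ s t → s xor ((form x ∧ t) xor (form d ∧ asym M c x))) (h x) (h c))
      (cong₂ _xor_ (𝔹ₚ.∧-zeroʳ (form x)) (cong (_∧ asym M c x) (h b))))

    c∈radical′ : ∀ x → asym M′ x c ≡ false
    c∈radical′ x = trans (asym′ x c) (trans (cong₂ (λ s t → asym M x c xor ((form x ∧ s) xor (t ∧ asym M c x))) (asym-alt M c) (trans (asym-sym M b c) c·b))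
      (trans (cong (λ s → asym M x c xor (s xor asym M c x)) (𝔹ₚ.∧-zeroʳ (form x))) (trans (cong (_xor asym M c x) (asym-sym M x c)) (𝔹ₚ.xor-same (asym M c x)))))

    -- Of the pair `d`, `c ⊕ d` only the first was radical before the change; afterwards both are.
    coset : ∀ d → InRadical d → bias M d ⊞ bias M (c ⊕ d) ≡ ½ · (bias M′ d ⊞ bias M′ (c ⊕ d))
    coset d h = trans (cong₂ _⊞_ (bias-1 M-add d h) (bias-0 M-add (c ⊕ d) b (trans (asym-⊕ M-add b c d) (cong₂ _xor_ (trans (asym-sym M b c) c·b) (h b)))))
      (trans (solve 0 (con 1ℚ :+ con 0ℚ := con ½ :* (con 1ℚ :+ con 1ℚ)) refl)
        (cong₂ (λ s t → ½ · (s ⊞ t)) (sym (bias-1 M′-add d (radical⊆ d h)))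
          (sym (bias-1 M′-add (c ⊕ d) λ x → trans (asym-⊕ M′-add x c d) (cong₂ _xor_ (c∈radical′ x) (radical⊆ d h x))))))

    inRadical? : ∀ d → InRadical d ⊎ (bias M d ≡ 0ℚ)
    inRadical? d with searchCube (λ x → asym M x d 𝔹ₚ.≟ true)
    ... | yes (x , h) = inj₂ (bias-0 M-add d x h)
    ... | no ¬h = inj₁ λ x → 𝔹ₚ.¬-not λ h → ¬h (x , h)

    pointwise : ∀ d → bias M d ⊞ bias M (c ⊕ d) ≤ ½ · (bias M′ d ⊞ bias M′ (c ⊕ d))
    pointwise d with inRadical? d | inRadical? (c ⊕ d)
    ... | inj₁ h | _ = ≤-reflexive (coset d h)
    ... | _      | inj₁ h = ≤-reflexive (subst (λ t → bias M t ⊞ bias M (c ⊕ d) ≡ ½ · (bias M′ t ⊞ bias M′ (c ⊕ d))) (⊕-cancel c d)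
        (trans (⊞-comm _ _) (trans (coset (c ⊕ d) h) (cong (½ ·_) (⊞-comm _ _)))))
    ... | inj₂ p | inj₂ q = ≤-trans (≤-reflexive (trans (cong₂ _⊞_ p q) (⊞-idˡ 0ℚ))) (·-nonNeg 0≤½ (⊞-nonNeg (bias≥0 M′-add d) (bias≥0 M′-add (c ⊕ d))))

    radical-doubles : radical M ⊞ radical M ≤ radical M′
    radical-doubles = begin
      radical M ⊞ radical M ≡⟨ cong (radical M ⊞_) (sym (𝔼-translate c (bias M))) ⟩
      𝔼 (bias M) ⊞ 𝔼 (λ d → bias M (c ⊕ d)) ≡⟨ sym (∫-⊞ _ _) ⟩
      𝔼 (λ d → bias M d ⊞ bias M (c ⊕ d)) ≤⟨ ∫-mono pointwise ⟩
      𝔼 (λ d → ½ · (bias M′ d ⊞ bias M′ (c ⊕ d))) ≡⟨ trans (∫-· ½ _) (cong (½ ·_) (trans (∫-⊞ _ _) (cong (radical M′ ⊞_) (𝔼-translate c (bias M′))))) ⟩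
      ½ · (radical M′ ⊞ radical M′) ≡⟨ solve 1 (λ r → con ½ :* (r :+ r) := r) refl (radical M′) ⟩
      radical M′ ∎

  -- The density of the radical doubles at each step and never exceeds 1, so a density above
  -- `halfPow m` leaves room for fewer than `m` steps, each of which costs at most a factor 2.
  symmetrise : ∀ m {M} → Additive M → halfPow m < radical M →
    ∃ λ M′ → Additive M′ × (∀ x y → asym M′ x y ≡ false) × halfPow m · Ā M ≤ Ā M′
  symmetrise zero    {M} M-add h = ⊥-elim (<-irrefl refl (<-≤-trans h (radical≤1 M-add)))
  symmetrise (suc m) {M} M-add h with searchCube (λ c → searchCube (λ b → asym M c b 𝔹ₚ.≟ true))
  ... | no ¬cb = M , M-add , (λ x y → 𝔹ₚ.¬-not λ q → ¬cb (x , y , q)) , ·-≤ʳ (Ā≥0 M) (halfPow≤1 (suc m))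
  ... | yes (c , b , c·b) = conclude (symmetrise m M′-add
          (subst (_< radical M′) (½+½ (halfPow m)) (<-≤-trans (⊞-mono-<-≤ h (<⇒≤ h)) radical-doubles)))
    where
    open Enlarge M-add c b c·b
    conclude : (∃ λ M″ → Additive M″ × (∀ x y → asym M″ x y ≡ false) × halfPow m · Ā M′ ≤ Ā M″) →
      ∃ λ M″ → Additive M″ × (∀ x y → asym M″ x y ≡ false) × halfPow (suc m) · Ā M ≤ Ā M″
    conclude (M″ , add , symm , bound) = M″ , add , symm , (begin
      ½ · halfPow m · Ā M ≡⟨ solve 3 (λ h p a → h :* p :* a := p :* (h :* a)) refl ½ (halfPow m) (Ā M) ⟩
      halfPow m · (½ · Ā M) ≤⟨ ·-monoˡ (<⇒≤ (halfPow>0 m)) (Ā-perturb M-add {α = form} (asym-⊕ M-add b) v) ⟩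
      halfPow m · Ā M′ ≤⟨ bound ⟩
      Ā M″ ∎)

  -- For symmetric `M` the diagonal `q` is additive, hence represented by a vector `d`. Adding `d`
  -- scaled by `q x` changes the diagonal by `q x ∧ q x`, which is `q x`, and so cancels it.
  alternate : ∀ {M} → Additive M → (∀ x y → asym M x y ≡ false) →
    ∃ λ M′ → Additive M′ × (∀ x → dot (M′ x) x ≡ false) × ½ · Ā M ≤ Ā M′
  alternate {M} M-add symm = perturb M q d , perturb-additive {α = q} d M-add q-add , alt , Ā-perturb M-add {α = q} q-add d
    where
    q : Cube n → Bool
    q x = dot (M x) x
    q-add : AdditiveForm q
    q-add x y = trans (trans (cong (λ t → dot t (x ⊕ y)) (M-add x y)) (dot-⊕ˡ (M x) (M y) (x ⊕ y)))
      (trans (cong₂ _xor_ (dot-⊕ʳ (M x) x y) (trans (dot-⊕ʳ (M y) x y) (𝔹ₚ.xor-comm (dot (M y) x) (q y))))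
        (trans (xor-interchange (q x) (dot (M x) y) (q y) (dot (M y) x)) (trans (cong ((q x xor q y) xor_) (symm x y)) (𝔹ₚ.xor-identityʳ _))))
    d : Cube n
    d = riesz q
    alt : ∀ x → dot (perturb M q d x) x ≡ false
    alt x = trans (dot-⊕ˡ (M x) (scale (q x) d) x) (trans (cong (q x xor_) (trans (dot-scale (q x) d x) (trans (cong (q x ∧_) (dot-riesz q q-add x)) (𝔹ₚ.∧-idem (q x)))))
      (𝔹ₚ.xor-same (q x)))

-- Quadratic forms with a prescribed polarisation

xorSum-cong : ∀ n {g h : Fin n → Bool} → (∀ i → g i ≡ h i) → xorSum n g ≡ xorSum n h
xorSum-cong zero    e = refl
xorSum-cong (suc n) e = cong₂ _xor_ (e Fz) (xorSum-cong n (e ∘ Fs))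

xorSum-dot : ∀ {n} (v x : Cube n) → xorSum n (λ i → lookup v i ∧ lookup x i) ≡ dot v x
xorSum-dot []      [] = refl
xorSum-dot (a ∷ v) (b ∷ x) = cong ((a ∧ b) xor_) (xorSum-dot v x)

quadForm : ∀ {n} → (Fin n → Fin n → Bool) → Cube n → Bool
quadForm {n} A x = xorSum n (λ i → xorSum n (λ j → A i j ∧ (lookup x i ∧ lookup x j)))

record Alternating {n : ℕ} (β : Cube n → Cube n → Bool) : Set where
  field
    addˡ : ∀ x y z → β (x ⊕ y) z ≡ β x z xor β y z
    addʳ : ∀ x y z → β x (y ⊕ z) ≡ β x y xor β x z
    alt  : ∀ x → β x x ≡ false

  β-sym : ∀ x y → β x y ≡ β y x
  β-sym x y = xor≡false⇒≡ (β x y) (β y x) (trans (sym (trans (addˡ x y (x ⊕ y)) (trans (cong₂ _xor_ (addʳ x x y) (addʳ y x y))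
    (trans (cong₂ (λ s t → (s xor β x y) xor (β y x xor t)) (alt x) (alt y)) (cong (β x y xor_) (𝔹ₚ.xor-identityʳ (β y x))))))) (alt (x ⊕ y)))
    where
    xor≡false⇒≡ : ∀ a b → a xor b ≡ false → a ≡ b
    xor≡false⇒≡ false b    h = sym h
    xor≡false⇒≡ true  true h = refl

border : ∀ {n} → Cube n → (Fin n → Fin n → Bool) → Fin (suc n) → Fin (suc n) → Bool
border v A Fz     Fz = false
border v A Fz     (Fs j) = lookup v j
border v A (Fs i) Fz = false
border v A (Fs i) (Fs j) = A i j

quadForm-border : ∀ {n} (v : Cube n) A b x → quadForm (border v A) (b ∷ x) ≡ (b ∧ dot v x) xor quadForm A x
quadForm-border {n} v A true  x = cong (_xor quadForm A x) (xorSum-dot v x)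
quadForm-border {n} v A false x = cong (_xor quadForm A x) (trans (xorSum-cong n λ j → 𝔹ₚ.∧-zeroʳ (lookup v j)) (xorSum-false n))
  where
  xorSum-false : ∀ n → xorSum n (λ _ → false) ≡ false
  xorSum-false zero = refl
  xorSum-false (suc n) = xorSum-false n

-- Halving is impossible in characteristic 2, so the matrix is the strictly upper triangular part of
-- the Gram matrix of `β`, built one row at a time.
polarised : ∀ {n} (β : Cube n → Cube n → Bool) → Alternating β →
  ∃ λ A → ∀ x y → quadForm A (x ⊕ y) ≡ (quadForm A x xor quadForm A y) xor β x y
polarised {zero} β alt = (λ ()) , λ { [] [] → sym (Alternating.alt alt []) }
polarised {suc n} β alternating = A , polar
  where
  open Alternating alternating
  e : Cube (suc n)
  e = true ∷ 𝟎
  β₀ : Cube n → Bool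
  β₀ x = β e (false ∷ x)
  βʳ : Cube n → Cube n → Bool
  βʳ x y = β (false ∷ x) (false ∷ y)
  rec : ∃ λ A → ∀ x y → quadForm A (x ⊕ y) ≡ (quadForm A x xor quadForm A y) xor βʳ x y
  rec = polarised βʳ record
    { addˡ = λ x y z → addˡ (false ∷ x) (false ∷ y) (false ∷ z)
    ; addʳ = λ x y z → addʳ (false ∷ x) (false ∷ y) (false ∷ z)
    ; alt = λ x → alt (false ∷ x) }
  A₀ = proj₁ rec
  v : Cube n
  v = riesz β₀
  β₀-⊕ : AdditiveForm β₀
  β₀-⊕ x y = addʳ e (false ∷ x) (false ∷ y)
  A = border v A₀
  value : ∀ b x → quadForm A (b ∷ x) ≡ (b ∧ β₀ x) xor quadForm A₀ x
  value b x = trans (quadForm-border v A₀ b x) (cong (λ t → (b ∧ t) xor quadForm A₀ x) (dot-riesz β₀ β₀-⊕ x))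
  splitˡ : ∀ b x z → β (b ∷ x) z ≡ (b ∧ β e z) xor β (false ∷ x) z
  splitˡ false x z = refl
  splitˡ true  x z = trans (cong (λ t → β (true ∷ t) z) (sym (⊕-idˡ x))) (addˡ e (false ∷ x) z)
  splitʳ : ∀ z c y → β z (c ∷ y) ≡ (c ∧ β z e) xor β z (false ∷ y)
  splitʳ z c y = trans (β-sym z (c ∷ y)) (trans (splitˡ c y z) (cong₂ (λ s t → (c ∧ s) xor t) (β-sym e z) (β-sym (false ∷ y) z)))
  β-value : ∀ b c x y → β (b ∷ x) (c ∷ y) ≡ (b ∧ β₀ y) xor ((c ∧ β₀ x) xor βʳ x y)
  β-value b c x y = trans (splitˡ b x (c ∷ y)) (cong₂ (λ s t → (b ∧ s) xor t)
    (trans (splitʳ e c y) (cong (_xor β₀ y) (trans (cong (c ∧_) (alt e)) (𝔹ₚ.∧-zeroʳ c))))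
    (trans (splitʳ (false ∷ x) c y) (cong (λ s → (c ∧ s) xor βʳ x y) (β-sym (false ∷ x) e))))
  polar : ∀ x y → quadForm A (x ⊕ y) ≡ (quadForm A x xor quadForm A y) xor β x y
  polar (b ∷ x) (c ∷ y) = trans (value (b xor c) (x ⊕ y))
    (trans (cong₂ (λ s t → ((b xor c) ∧ s) xor t) (β₀-⊕ x y) (proj₂ rec x y))
    (trans (algebra b c (β₀ x) (β₀ y) (quadForm A₀ x) (quadForm A₀ y) (βʳ x y))
    (sym (cong₂ _xor_ (cong₂ _xor_ (value b x) (value c y)) (β-value b c x y)))))
    where
    algebra : ∀ b c p q s t r → ((b xor c) ∧ (p xor q)) xor ((s xor t) xor r) ≡
      (((b ∧ p) xor s) xor ((c ∧ q) xor t)) xor ((b ∧ q) xor ((c ∧ p) xor r))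
    algebra = 𝔹.solve 7 (λ b c p q s t r → ((b 𝔹.:+ c) 𝔹.:* (p 𝔹.:+ q)) 𝔹.:+ ((s 𝔹.:+ t) 𝔹.:+ r) 𝔹.:=
      (((b 𝔹.:* p) 𝔹.:+ s) 𝔹.:+ ((c 𝔹.:* q) 𝔹.:+ t)) 𝔹.:+ ((b 𝔹.:* q) 𝔹.:+ ((c 𝔹.:* p) 𝔹.:+ r))) refl
      where module 𝔹 = xor-∧-Solver

-- If `p` and `⊖ p` were both at most `s`, then `p · p ≤ s · s ≤ s`, the last step because `s ≤ 1`.
square-root-cases : ∀ {s p} → 0ℚ ≤ s → s ≤ 1ℚ → s < p · p → (s < p) ⊎ (s < ⊖ p)
square-root-cases {s} {p} s≥0 s≤1 h with ℚₚ.≤-total 0ℚ p | s ℚₚ.<? p | s ℚₚ.<? (⊖ p)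
... | _      | yes q | _ = inj₁ q
... | _      | no _  | yes q = inj₂ q
... | inj₁ p≥0 | no ¬q | no _ = ⊥-elim (<-irrefl refl (<-≤-trans h (≤-trans (·-mono-sq p≥0 (≮⇒≥ ¬q)) (·-≤ˡ s≥0 s≤1))))
... | inj₂ p≤0 | no _  | no ¬q = ⊥-elim (<-irrefl refl (<-≤-trans h (≤-trans (≤-reflexive (solve 1 (λ p → p :* p := (:- p) :* (:- p)) refl p))
      (≤-trans (·-mono-sq (≤-trans (≤-reflexive (solve 0 (con 0ℚ := :- con 0ℚ) refl)) (⊖-mono p≤0)) (≮⇒≥ ¬q)) (·-≤ˡ s≥0 s≤1)))))

-- From an alternating map to correlation with a quadratic polynomial

module Integrate {n : ℕ} (f : Cube n → ℚ) (f² : ∀ x → f x · f x ≡ 1ℚ) where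
  open Ambiguity f f²
  open LinearPhase f f²

  correlation : QuadPoly n → ℚ
  correlation P = 𝔼 (λ x → f x · sgn (evalPoly P x))

  module Primitive {M : Cube n → Cube n} (A : Fin n → Fin n → Bool)
    (polar : ∀ x y → quadForm A (x ⊕ y) ≡ (quadForm A x xor quadForm A y) xor dot (M x) y) where

    q : Cube n → Bool
    q = quadForm A

    g : Cube n → ℚ
    g x = f x · sgn (q x)

    R : Cube n → ℚ
    R h = 𝔼 (λ x → g x · g (x ⊕ h))

    phase-q : ∀ h x → χ (M h) x ≡ sgn (q h) · (sgn (q x) · sgn (q (x ⊕ h)))
    phase-q h x = trans (cong sgn bool) (trans (sgn-xor (q h) (q x xor q (x ⊕ h))) (cong (sgn (q h) ·_) (sgn-xor (q x) (q (x ⊕ h)))))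
      where
      bool : dot (M h) x ≡ q h xor (q x xor q (x ⊕ h))
      bool = sym (trans (cong (λ t → q h xor (q x xor t)) (trans (cong q (⊕-comm x h)) (polar h x)))
        (𝔹.solve 3 (λ a b c → a 𝔹.:+ (b 𝔹.:+ ((a 𝔹.:+ b) 𝔹.:+ c)) 𝔹.:= c) refl (q h) (q x) (dot (M h) x)))
        where module 𝔹 = xor-∧-Solver

    a-R : ∀ h → a h (M h) ≡ sgn (q h) · R h
    a-R h = trans (∫-cong λ x → trans (cong ((f x · f (x ⊕ h)) ·_) (phase-q h x))
      (solve 5 (λ a b s t u → (a :* b) :* (s :* (t :* u)) := s :* ((a :* t) :* (b :* u))) refl (f x) (f (x ⊕ h)) (sgn (q h)) (sgn (q x)) (sgn (q (x ⊕ h)))))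
      (∫-· (sgn (q h)) _)

    fourier-R : ∀ ξ → fourier R ξ ≡ fourier g ξ · fourier g ξ
    fourier-R ξ = begin-equality
      𝔼 (λ h → R h · χ ξ h) ≡⟨ (∫-cong λ h → sym (∫-·ʳ (χ ξ h) _)) ⟩
      𝔼 (λ h → 𝔼 (λ x → (g x · g (x ⊕ h)) · χ ξ h)) ≡⟨ ∫-swap _ ⟩
      𝔼 (λ x → 𝔼 (λ h → (g x · g (x ⊕ h)) · χ ξ h)) ≡⟨ (∫-cong λ x → ∫-cong λ h → split x h) ⟩
      𝔼 (λ x → 𝔼 (λ h → (g x · χ ξ x) · (g (x ⊕ h) · χ ξ (x ⊕ h)))) ≡⟨ (∫-cong λ x → 𝔼-translate x (λ y → (g x · χ ξ x) · (g y · χ ξ y))) ⟩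
      𝔼 (λ x → 𝔼 (λ y → (g x · χ ξ x) · (g y · χ ξ y))) ≡⟨ ∫-sep _ _ ⟩
      fourier g ξ · fourier g ξ ∎
      where
      split : ∀ x h → (g x · g (x ⊕ h)) · χ ξ h ≡ (g x · χ ξ x) · (g (x ⊕ h) · χ ξ (x ⊕ h))
      split x h = sym (trans (cong (λ t → (g x · χ ξ x) · (g (x ⊕ h) · t)) (χ-⊕ʳ ξ x h))
        (trans (solve 4 (λ a s b t → (a :* s) :* (b :* (s :* t)) := ((a :* b) :* t) :* (s :* s)) refl (g x) (χ ξ x) (g (x ⊕ h)) (χ ξ h))
          (trans (cong (((g x · g (x ⊕ h)) · χ ξ h) ·_) (χ-sq ξ x)) (·-idʳ _))))

    Σĝ² : Σᶜ (λ ξ → fourier g ξ · fourier g ξ) ≡ 1ℚ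
    Σĝ² = trans (parseval g g) (trans (∫-cong λ x → trans (solve 2 (λ a s → (a :* s) :* (a :* s) := (a :* a) :* (s :* s)) refl (f x) (sgn (q x)))
      (trans (cong₂ _·_ (f² x) (sgn-sq (q x))) (·-idˡ 1ℚ))) (avg-prob n))

    -- The phase `χ (M h) x` is the derivative of `q` in direction `h` up to the sign `sgn (q h)`,
    -- which squaring removes; Parseval then gives the fourth moment of the transform of `g`.
    Ā-fourth : Ā M ≡ Σᶜ (λ ξ → (fourier g ξ · fourier g ξ) · (fourier g ξ · fourier g ξ))
    Ā-fourth = begin-equality
      𝔼 (λ h → a h (M h) · a h (M h)) ≡⟨ (∫-cong λ h → trans (cong (λ t → t · t) (a-R h)) (trans (solve 2 (λ s r → (s :* r) :* (s :* r) := (s :* s) :* (r :* r)) refl (sgn (q h)) (R h))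
          (trans (cong (_· (R h · R h)) (sgn-sq (q h))) (·-idˡ _)))) ⟩
      𝔼 (λ h → R h · R h) ≡⟨ sym (parseval R R) ⟩
      Σᶜ (λ ξ → fourier R ξ · fourier R ξ) ≡⟨ (∫-cong λ ξ → cong (λ t → t · t) (fourier-R ξ)) ⟩
      Σᶜ (λ ξ → (fourier g ξ · fourier g ξ) · (fourier g ξ · fourier g ξ)) ∎

    -- The squares `G ξ` sum to 1 and their mean with weights `G ξ` is `Ā M`, so some `G ξ` exceeds
    -- half of it.
    large-coefficient : 0ℚ < Ā M → ∃ λ ξ → ½ · Ā M < fourier g ξ · fourier g ξ
    large-coefficient Ā>0 = conclude (∫-pos (λ ξ → G ξ · (G ξ ⊟ ½ · Ā M)) (subst (0ℚ <_) (sym total) (·-pos 0<½ Ā>0)))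
      where
      G : Cube n → ℚ
      G ξ = fourier g ξ · fourier g ξ
      total : Σᶜ (λ ξ → G ξ · (G ξ ⊟ ½ · Ā M)) ≡ ½ · Ā M
      total = begin-equality
        Σᶜ (λ ξ → G ξ · (G ξ ⊟ ½ · Ā M)) ≡⟨ (∫-cong λ ξ → solve 2 (λ g a → g :* (g :- a) := g :* g :- g :* a) refl (G ξ) (½ · Ā M)) ⟩
        Σᶜ (λ ξ → G ξ · G ξ ⊟ G ξ · (½ · Ā M)) ≡⟨ ∫-⊟ _ _ ⟩
        Σᶜ (λ ξ → G ξ · G ξ) ⊟ Σᶜ (λ ξ → G ξ · (½ · Ā M)) ≡⟨ cong₂ _⊟_ (sym Ā-fourth) (trans (∫-·ʳ (½ · Ā M) G) (trans (cong (_· (½ · Ā M)) Σĝ²) (·-idˡ _))) ⟩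
        Ā M ⊟ ½ · Ā M ≡⟨ solve 1 (λ a → a :- con ½ :* a := con ½ :* a) refl (Ā M) ⟩
        ½ · Ā M ∎
      conclude : (∃ λ ξ → 0ℚ < G ξ · (G ξ ⊟ ½ · Ā M)) → ∃ λ ξ → ½ · Ā M < G ξ
      conclude (ξ , h) = ξ , subst₂ _<_ (⊞-idˡ _) (solve 2 (λ g a → (g :- a) :+ a := g) refl (G ξ) (½ · Ā M))
        (⊞-mono-<-≤ (·-cancelˡ-< (0≤sq (fourier g ξ)) (subst (_< G ξ · (G ξ ⊟ ½ · Ā M)) (sym (·-zeroʳ (G ξ))) h)) (≤-refl {½ · Ā M}))

    polynomial : Bool → Cube n → QuadPoly n
    polynomial c ξ = record { const = c ; lin = lookup ξ ; quad = A }

    correlation-value : ∀ c ξ → correlation (polynomial c ξ) ≡ sgn c · fourier g ξ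
    correlation-value c ξ = trans (∫-cong λ x → trans (cong (λ t → f x · t) (trans (cong (λ t → sgn (c xor (t xor q x))) (xorSum-dot ξ x))
        (trans (sgn-xor c (dot ξ x xor q x)) (cong (sgn c ·_) (sgn-xor (dot ξ x) (q x))))))
      (solve 4 (λ a c s t → a :* (c :* (s :* t)) := c :* ((a :* t) :* s)) refl (f x) (sgn c) (χ ξ x) (sgn (q x)))) (∫-· (sgn c) _)

    Ā≤1 : Ā M ≤ 1ℚ
    Ā≤1 = ≤-trans (∫-mono λ h → w≤1 (h , M h)) (≤-reflexive (avg-prob n))

    correlates : 0ℚ < Ā M → ∃ λ P → ½ · Ā M < correlation P
    correlates Ā>0 = conclude (large-coefficient Ā>0)
      where
      conclude : (∃ λ ξ → ½ · Ā M < fourier g ξ · fourier g ξ) → ∃ λ P → ½ · Ā M < correlation P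
      conclude (ξ , h) = pick (square-root-cases (·-nonNeg 0≤½ (Ā≥0 M)) (≤-trans (½-≤ (Ā≥0 M)) Ā≤1) h)
        where
        pick : (½ · Ā M < fourier g ξ) ⊎ (½ · Ā M < ⊖ fourier g ξ) → ∃ λ P → ½ · Ā M < correlation P
        pick (inj₁ p) = polynomial false ξ , subst (½ · Ā M <_) (sym (trans (correlation-value false ξ) (·-idˡ _))) p
        pick (inj₂ p) = polynomial true ξ , subst (½ · Ā M <_) (sym (trans (correlation-value true ξ) (solve 1 (λ a → (:- con 1ℚ) :* a := :- a) refl (fourier g ξ)))) p

  correlates : ∀ {M} → Additive M → (∀ x → dot (M x) x ≡ false) → 0ℚ < Ā M → ∃ λ P → ½ · Ā M < correlation P
  correlates {M} M-add M-alt = uncurry (Primitive.correlates {M}) (polarised (λ x y → dot (M x) y) record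
    { addˡ = λ x y z → trans (cong (λ t → dot t z) (M-add x y)) (dot-⊕ˡ (M x) (M y) z)
    ; addʳ = λ x y z → dot-⊕ʳ (M x) y z
    ; alt = M-alt })

-- The inverse theorem for the U³ norm

halfPow·fromℕ≤1 : ∀ m → halfPow m · fromℕ m ≤ 1ℚ
halfPow·fromℕ≤1 zero = ≤-trans (≤-reflexive (·-zeroʳ 1ℚ)) 0≤1
halfPow·fromℕ≤1 (suc m) = begin
  ½ · halfPow m · (1ℚ ⊞ fromℕ m) ≡⟨ solve 3 (λ h p n → h :* p :* (con 1ℚ :+ n) := h :* p :+ h :* (p :* n)) refl ½ (halfPow m) (fromℕ m) ⟩
  ½ · halfPow m ⊞ ½ · (halfPow m · fromℕ m) ≤⟨ ⊞-mono (·-monoˡ 0≤½ (halfPow≤1 m)) (·-monoˡ 0≤½ (halfPow·fromℕ≤1 m)) ⟩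
  ½ · 1ℚ ⊞ ½ · 1ℚ ≡⟨ ½+½ 1ℚ ⟩
  1ℚ ∎

halfPow-small : ∀ {p} → 0ℚ < p → ∃ λ m → halfPow m < p
halfPow-small {p} p>0 = conclude (archimedean p p>0)
  where
  conclude : (∃ λ m → 1ℚ < fromℕ m · p) → ∃ λ m → halfPow m < p
  conclude (m , h) = m , (begin-strict
    halfPow m ≡⟨ sym (·-idʳ _) ⟩
    halfPow m · 1ℚ <⟨ ·-monoˡ-< (halfPow>0 m) h ⟩
    halfPow m · (fromℕ m · p) ≡⟨ sym (·-assoc (halfPow m) (fromℕ m) p) ⟩
    halfPow m · fromℕ m · p ≤⟨ ·-≤ʳ (<⇒≤ p>0) (halfPow·fromℕ≤1 m) ⟩
    p ∎)

inverse-U³ : ∀ {δ} → 0ℚ < δ → ∃ λ ε₀ → 0ℚ < ε₀ × (∀ {n} (f : Cube n → ℚ) (f² : ∀ x → f x · f x ≡ 1ℚ) →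
  δ ≤ 𝔼 (λ h → 𝔼 (λ k → Ambiguity.Δ f f² h k · Ambiguity.Δ f f² h k)) → ∃ λ P → ε₀ < Integrate.correlation f f² P)
inverse-U³ {δ} δ>0 = ε₀ , ·-pos 0<½ (·-pos 0<½ (·-pos (halfPow>0 m) α>0)) , main
  where
  C : Constants δ
  C = constants δ>0
  κ τ α : ℚ
  κ = Constants.κ C
  τ = Constants.τ C
  α = κ · (κ · τ)
  α>0 : 0ℚ < α
  α>0 = ·-pos (Constants.κ>0 C) (·-pos (Constants.κ>0 C) (Constants.τ>0 C))
  small : ∃ λ m → halfPow m < α · α
  small = halfPow-small (·-pos α>0 α>0)
  m : ℕ
  m = proj₁ small
  ε₀ : ℚ
  -- `α` is the mass on the first graph. Symmetrising costs `halfPow m`, since the radical has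
  -- density at least `α · α`; one `½` pays for clearing the diagonal and one for picking a large
  -- coefficient.
  ε₀ = ½ · (½ · (halfPow m · α))
  main : ∀ {n} (f : Cube n → ℚ) (f² : ∀ x → f x · f x ≡ 1ℚ) →
    δ ≤ 𝔼 (λ h → 𝔼 (λ k → Ambiguity.Δ f f² h k · Ambiguity.Δ f f² h k)) → ∃ λ P → ε₀ < Integrate.correlation f f² P
  main {n} f f² h = linear (LP.fromSubspace (<⇒≤ (Constants.κ>0 C)) (<⇒≤ (Constants.τ>0 C))
      (FromConstants.heavySubspace δ>0 C A.weight (subst (δ ≤_) (sym A.∫ww) h)))
    where
    module A = Ambiguity f f²
    module LP = LinearPhase f f²
    module Sy = Symmetrise f f²
    alternating : ∀ {M} → Additive M × (∀ x → dot (M x) x ≡ false) × ½ · (halfPow m · α) ≤ LP.Ā M → ∃ λ P → ε₀ < Integrate.correlation f f² P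
    alternating {M} (M-add , M-alt , h) = conclude (Integrate.correlates f f² M-add M-alt (<-≤-trans (·-pos 0<½ (·-pos (halfPow>0 m) α>0)) h))
      where
      conclude : (∃ λ P → ½ · LP.Ā M < Integrate.correlation f f² P) → ∃ λ P → ε₀ < Integrate.correlation f f² P
      conclude (P , hP) = P , ≤-<-trans (·-monoˡ 0≤½ h) hP
    symmetric : (∃ λ M → Additive M × (∀ x y → Sy.asym M x y ≡ false) × halfPow m · α ≤ LP.Ā M) → ∃ λ P → ε₀ < Integrate.correlation f f² P
    symmetric (M , M-add , symm , h) = conclude (Sy.alternate M-add symm)
      where
      conclude : (∃ λ M′ → Additive M′ × (∀ x → dot (M′ x) x ≡ false) × ½ · LP.Ā M ≤ LP.Ā M′) → ∃ λ P → ε₀ < Integrate.correlation f f² P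
      conclude (M′ , add , alt , h′) = alternating (add , alt , ≤-trans (·-monoˡ 0≤½ h) h′)
    linear : (∃ λ M → Additive M × α ≤ LP.Ā M) → ∃ λ P → ε₀ < Integrate.correlation f f² P
    linear (M , M-add , h) = conclude (Sy.symmetrise m M-add (<-≤-trans (proj₂ small) (≤-trans (·-mono-sq (<⇒≤ α>0) h) (Sy.Ā²≤radical M-add))))
      where
      conclude : (∃ λ M′ → Additive M′ × (∀ x y → Sy.asym M′ x y ≡ false) × halfPow m · LP.Ā M ≤ LP.Ā M′) → ∃ λ P → ε₀ < Integrate.correlation f f² P
      conclude (M′ , add , symm , h′) = symmetric (M′ , add , symm , ≤-trans (·-monoˡ (<⇒≤ (halfPow>0 m)) h) h′)

-- Three applications of Cauchy-Schwarz

module GowersCauchySchwarz {n : ℕ} (f : Cube n → ℚ) (f² : ∀ x → f x · f x ≡ 1ℚ) where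
  open Ambiguity f f² using (Δ)

  Bounded : (Cube n → Cube n → ℚ) → Set
  Bounded K = ∀ x y → K x y · K x y ≤ 1ℚ

  cs₁ : ∀ (K Y : Cube n → ℚ) → (∀ x → K x · K x ≤ 1ℚ) →
    𝔼 (λ x → K x · Y x) · 𝔼 (λ x → K x · Y x) ≤ 𝔼 (λ x → Y x · Y x)
  cs₁ K Y h = cauchy-schwarz-≤1 (avg-prob n) K Y h

  cs₂ : ∀ (K Y : Cube n → Cube n → ℚ) → Bounded K →
    𝔼 (λ x → 𝔼 (λ y → K x y · Y x y)) · 𝔼 (λ x → 𝔼 (λ y → K x y · Y x y)) ≤ 𝔼 (λ x → 𝔼 (λ y → Y x y · Y x y))
  cs₂ K Y h = ≤-trans (jensen (avg-prob n) _) (∫-mono λ x → cs₁ (K x) (Y x) (h x))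

  ·-bounded : ∀ {p q} → p · p ≤ 1ℚ → q · q ≤ 1ℚ → (p · q) · (p · q) ≤ 1ℚ
  ·-bounded {p} {q} hp hq = ≤-trans (≤-reflexive (solve 2 (λ p q → (p :* q) :* (p :* q) := (p :* p) :* (q :* q)) refl p q)) (·-≤1 (0≤sq p) hp hq)

  four : Cube n → Cube n → Cube n → Cube n → Cube n → ℚ
  four a a′ b b′ c = (f ((a ⊕ b) ⊕ c) · f ((a′ ⊕ b) ⊕ c)) · (f ((a ⊕ b′) ⊕ c) · f ((a′ ⊕ b′) ⊕ c))

  four-Δ : ∀ a a′ b b′ → 𝔼 (four a a′ b b′) ≡ Δ (a ⊕ a′) (b ⊕ b′)
  four-Δ a a′ b b′ = trans (∫-cong λ c → cong₂ (λ s t → (f ((a ⊕ b) ⊕ c) · f s) · t) (sym (move₁ c)) (cong₂ (λ s t → f s · f t) (sym (move₂ c)) (sym (move₃ c))))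
    (𝔼-translate (a ⊕ b) (λ x → (f x · f (x ⊕ (a ⊕ a′))) · (f (x ⊕ (b ⊕ b′)) · f ((x ⊕ (b ⊕ b′)) ⊕ (a ⊕ a′)))))
    where
    move : ∀ x y c d → ((x ⊕ y) ⊕ c) ⊕ (x ⊕ d) ≡ (d ⊕ y) ⊕ c
    move x y c d = trans (cong (_⊕ (x ⊕ d)) (⊕-assoc x y c)) (trans (⊕-interchange x (y ⊕ c) x d)
      (trans (cong (_⊕ ((y ⊕ c) ⊕ d)) (⊕-self x)) (trans (⊕-idˡ _) (trans (⊕-comm (y ⊕ c) d) (sym (⊕-assoc d y c))))))
    move₁ : ∀ c → ((a ⊕ b) ⊕ c) ⊕ (a ⊕ a′) ≡ (a′ ⊕ b) ⊕ c
    move₁ c = move a b c a′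
    move₂ : ∀ c → ((a ⊕ b) ⊕ c) ⊕ (b ⊕ b′) ≡ (a ⊕ b′) ⊕ c
    move₂ c = trans (cong (λ t → (t ⊕ c) ⊕ (b ⊕ b′)) (⊕-comm a b)) (trans (move b a c b′) (cong (_⊕ c) (⊕-comm b′ a)))
    move₃ : ∀ c → (((a ⊕ b) ⊕ c) ⊕ (b ⊕ b′)) ⊕ (a ⊕ a′) ≡ (a′ ⊕ b′) ⊕ c
    move₃ c = trans (cong (_⊕ (a ⊕ a′)) (move₂ c)) (move a b′ c a′)

  module _ (K₁ K₂ K₃ : Cube n → Cube n → ℚ) (h₁ : Bounded K₁) (h₂ : Bounded K₂) (h₃ : Bounded K₃) where

    value : ℚ
    value = 𝔼 (λ a → 𝔼 (λ b → 𝔼 (λ c → K₁ b c · (K₂ a c · (K₃ a b · f ((a ⊕ b) ⊕ c))))))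

    pair : Cube n → Cube n → Cube n → Cube n → ℚ
    pair a a′ b c = f ((a ⊕ b) ⊕ c) · f ((a′ ⊕ b) ⊕ c)

    Y : Cube n → Cube n → ℚ
    Y b c = 𝔼 (λ a → K₂ a c · (K₃ a b · f ((a ⊕ b) ⊕ c)))

    Z : Cube n → Cube n → Cube n → ℚ
    Z a a′ c = 𝔼 (λ b → (K₃ a b · K₃ a′ b) · pair a a′ b c)

    -- Cauchy-Schwarz in `b`, `c` removes `K₁`, which does not depend on `a`, and doubles `a`.
    value² : value · value ≤ 𝔼 (λ a → 𝔼 (λ a′ → 𝔼 (λ c → (K₂ a c · K₂ a′ c) · Z a a′ c)))
    value² = begin
      value · value
        ≡⟨ cong (λ t → t · t) (trans (∫-swap _) (∫-cong λ b → trans (∫-swap _) (∫-cong λ c → ∫-· (K₁ b c) _))) ⟩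
      𝔼 (λ b → 𝔼 (λ c → K₁ b c · Y b c)) · 𝔼 (λ b → 𝔼 (λ c → K₁ b c · Y b c))
        ≤⟨ cs₂ K₁ Y h₁ ⟩
      𝔼 (λ b → 𝔼 (λ c → Y b c · Y b c))
        ≡⟨ (∫-cong λ b → ∫-cong λ c → trans (sym (∫-sep _ _)) (∫-cong λ a → ∫-cong λ a′ →
          solve 6 (λ p q s t u v → (p :* (q :* s)) :* (t :* (u :* v)) := (p :* t) :* ((q :* u) :* (s :* v))) refl
          (K₂ a c) (K₃ a b) (f ((a ⊕ b) ⊕ c)) (K₂ a′ c) (K₃ a′ b) (f ((a′ ⊕ b) ⊕ c)))) ⟩
      𝔼 (λ b → 𝔼 (λ c → 𝔼 (λ a → 𝔼 (λ a′ → (K₂ a c · K₂ a′ c) · ((K₃ a b · K₃ a′ b) · pair a a′ b c)))))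
        ≡⟨ (∫-cong λ b → trans (∫-swap _) (∫-cong λ a → ∫-swap _)) ⟩
      𝔼 (λ b → 𝔼 (λ a → 𝔼 (λ a′ → 𝔼 (λ c → (K₂ a c · K₂ a′ c) · ((K₃ a b · K₃ a′ b) · pair a a′ b c)))))
        ≡⟨ trans (∫-swap _) (∫-cong λ a → trans (∫-swap _) (∫-cong λ a′ → ∫-swap _)) ⟩
      𝔼 (λ a → 𝔼 (λ a′ → 𝔼 (λ c → 𝔼 (λ b → (K₂ a c · K₂ a′ c) · ((K₃ a b · K₃ a′ b) · pair a a′ b c)))))
        ≡⟨ (∫-cong λ a → ∫-cong λ a′ → ∫-cong λ c → ∫-· (K₂ a c · K₂ a′ c) _) ⟩
      𝔼 (λ a → 𝔼 (λ a′ → 𝔼 (λ c → (K₂ a c · K₂ a′ c) · Z a a′ c))) ∎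

    -- Cauchy-Schwarz in `a`, `a′`, `c` removes `K₂` and doubles `b`.
    value⁴ : (value · value) · (value · value) ≤ 𝔼 (λ a → 𝔼 (λ a′ → 𝔼 (λ b → 𝔼 (λ b′ → ((K₃ a b · K₃ a′ b) · (K₃ a b′ · K₃ a′ b′)) · 𝔼 (four a a′ b b′)))))
    value⁴ = begin
      (value · value) · (value · value)
        ≤⟨ ·-mono-sq (0≤sq value) value² ⟩
      𝔼 (λ a → 𝔼 (λ a′ → 𝔼 (λ c → (K₂ a c · K₂ a′ c) · Z a a′ c))) · 𝔼 (λ a → 𝔼 (λ a′ → 𝔼 (λ c → (K₂ a c · K₂ a′ c) · Z a a′ c)))
        ≤⟨ jensen (avg-prob n) _ ⟩
      𝔼 (λ a → 𝔼 (λ a′ → 𝔼 (λ c → (K₂ a c · K₂ a′ c) · Z a a′ c)) · 𝔼 (λ a′ → 𝔼 (λ c → (K₂ a c · K₂ a′ c) · Z a a′ c)))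
        ≤⟨ (∫-mono λ a → cs₂ (λ a′ c → K₂ a c · K₂ a′ c) (Z a) (λ a′ c → ·-bounded (h₂ a c) (h₂ a′ c))) ⟩
      𝔼 (λ a → 𝔼 (λ a′ → 𝔼 (λ c → Z a a′ c · Z a a′ c)))
        ≡⟨ (∫-cong λ a → ∫-cong λ a′ → trans (∫-cong λ c → trans (sym (∫-sep _ _)) (∫-cong λ b → ∫-cong λ b′ →
          solve 4 (λ p q s t → (p :* q) :* (s :* t) := (p :* s) :* (q :* t)) refl (K₃ a b · K₃ a′ b) (pair a a′ b c) (K₃ a b′ · K₃ a′ b′) (pair a a′ b′ c)))
          (trans (∫-swap _) (∫-cong λ b → trans (∫-swap _) (∫-cong λ b′ → ∫-· ((K₃ a b · K₃ a′ b) · (K₃ a b′ · K₃ a′ b′)) _)))) ⟩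
      𝔼 (λ a → 𝔼 (λ a′ → 𝔼 (λ b → 𝔼 (λ b′ → ((K₃ a b · K₃ a′ b) · (K₃ a b′ · K₃ a′ b′)) · 𝔼 (four a a′ b b′))))) ∎

    -- Cauchy-Schwarz in `a`, `a′`, `b`, `b′` removes `K₃`; what is left is the square of a mean
    -- over `c` that depends only on `a ⊕ a′` and `b ⊕ b′`.
    value⁸ : ((value · value) · (value · value)) · ((value · value) · (value · value)) ≤ 𝔼 (λ h → 𝔼 (λ k → Δ h k · Δ h k))
    value⁸ = begin
      ((value · value) · (value · value)) · ((value · value) · (value · value))
        ≤⟨ ·-mono-sq (0≤sq (value · value)) value⁴ ⟩
      𝔼 (λ a → W a) · 𝔼 (λ a → W a)
        ≤⟨ jensen (avg-prob n) W ⟩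
      𝔼 (λ a → W a · W a)
        ≤⟨ (∫-mono λ a → ≤-trans (jensen (avg-prob n) _) (∫-mono λ a′ → cs₂ (λ b b′ → (K₃ a b · K₃ a′ b) · (K₃ a b′ · K₃ a′ b′)) (λ b b′ → 𝔼 (four a a′ b b′))
          (λ b b′ → ·-bounded (·-bounded (h₃ a b) (h₃ a′ b)) (·-bounded (h₃ a b′) (h₃ a′ b′))))) ⟩
      𝔼 (λ a → 𝔼 (λ a′ → 𝔼 (λ b → 𝔼 (λ b′ → 𝔼 (four a a′ b b′) · 𝔼 (four a a′ b b′)))))
        ≡⟨ (∫-cong λ a → ∫-cong λ a′ → ∫-cong λ b → trans (∫-cong λ b′ → cong (λ t → t · t) (four-Δ a a′ b b′)) (𝔼-translate b (λ k → Δ (a ⊕ a′) k · Δ (a ⊕ a′) k))) ⟩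
      𝔼 (λ a → 𝔼 (λ a′ → 𝔼 {n} (λ b → 𝔼 (λ k → Δ (a ⊕ a′) k · Δ (a ⊕ a′) k))))
        ≡⟨ (∫-cong λ a → trans (∫-cong λ a′ → ∫-const (avg-prob n) _) (𝔼-translate a (λ h → 𝔼 (λ k → Δ h k · Δ h k)))) ⟩
      𝔼 {n} (λ a → 𝔼 (λ h → 𝔼 (λ k → Δ h k · Δ h k)))
        ≡⟨ ∫-const (avg-prob n) _ ⟩
      𝔼 (λ h → 𝔼 (λ k → Δ h k · Δ h k)) ∎
      where
      W : Cube n → ℚ
      W a = 𝔼 (λ a′ → 𝔼 (λ b → 𝔼 (λ b′ → ((K₃ a b · K₃ a′ b) · (K₃ a b′ · K₃ a′ b′)) · 𝔼 (four a a′ b b′))))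

-- Probabilities as integrals

/-·-fromℕ : ∀ c d .{{_ : ℕ.NonZero d}} → (ℤ.+ c ℚ./ d) · fromℕ d ≡ fromℕ c
/-·-fromℕ c (suc d) = ℚₚ.toℚᵘ-injective (ℚᵘₚ.≃-trans (ℚᵘₚ.≃-reflexive (cong ℚ.toℚᵘ (·-def (ℤ.+ c ℚ./ suc d) (fromℕ (suc d)))))
  (ℚᵘₚ.≃-trans (ℚₚ.toℚᵘ-homo-* (ℤ.+ c ℚ./ suc d) (fromℕ (suc d)))
  (ℚᵘₚ.≃-trans (ℚᵘₚ.*-cong (ℚₚ.toℚᵘ-fromℚᵘ (ℚᵘ.mkℚᵘ (ℤ.+ c) d)) (toℚᵘ-fromℕ (suc d)))
  (ℚᵘₚ.≃-trans (ℚᵘ.*≡* (trans (ℤₚ.*-identityʳ _) (cong (λ t → ℤ.+ c ℤ.* ℤ.+ suc t) (sym (trans (ℕₚ.*-identityʳ d) refl)))))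
  (ℚᵘₚ.≃-sym (toℚᵘ-fromℕ c))))))

fromℕ-+ : ∀ m n → fromℕ (m ℕ.+ n) ≡ fromℕ m ⊞ fromℕ n
fromℕ-+ zero    n = sym (⊞-idˡ _)
fromℕ-+ (suc m) n = trans (cong (1ℚ ⊞_) (fromℕ-+ m n)) (sym (⊞-assoc 1ℚ (fromℕ m) (fromℕ n)))

halfPow·2^ : ∀ k → halfPow k · fromℕ (2 ℕ.^ k) ≡ 1ℚ
halfPow·2^ zero = solve 0 (con 1ℚ :* (con 1ℚ :+ con 0ℚ) := con 1ℚ) refl
halfPow·2^ (suc k) = trans (cong (½ · halfPow k ·_) (trans (fromℕ-+ (2 ℕ.^ k) _) (cong (fromℕ (2 ℕ.^ k) ⊞_) (cong fromℕ (ℕₚ.+-identityʳ (2 ℕ.^ k))))))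
  (trans (solve 2 (λ p q → con ½ :* p :* (q :+ q) := p :* q) refl (halfPow k) (fromℕ (2 ℕ.^ k))) (halfPow·2^ k))

prob-value : ∀ c k → prob c k ≡ halfPow k · fromℕ c
prob-value c k = begin-equality
  prob c k ≡⟨ sym (·-idʳ _) ⟩
  prob c k · 1ℚ ≡⟨ cong (prob c k ·_) (sym (halfPow·2^ k)) ⟩
  prob c k · (halfPow k · fromℕ (2 ℕ.^ k)) ≡⟨ solve 3 (λ a b c → a :* (b :* c) := b :* (a :* c)) refl (prob c k) (halfPow k) (fromℕ (2 ℕ.^ k)) ⟩
  halfPow k · (prob c k · fromℕ (2 ℕ.^ k)) ≡⟨ cong (halfPow k ·_) (/-·-fromℕ c (2 ℕ.^ k) {{ℕₚ.m^n≢0 2 k}}) ⟩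
  halfPow k · fromℕ c ∎

fromℕ-count : ∀ {X : Set} (p : X → Bool) xs → fromℕ (count p xs) ≡ sumL xs (𝟙 ∘ p)
fromℕ-count p [] = refl
fromℕ-count p (x ∷ xs) with p x
... | true = cong (1ℚ ⊞_) (fromℕ-count p xs)
... | false = trans (fromℕ-count p xs) (sym (⊞-idˡ _))

halfPow-+ : ∀ m n → halfPow (m ℕ.+ n) ≡ halfPow m · halfPow n
halfPow-+ zero    n = sym (·-idˡ _)
halfPow-+ (suc m) n = trans (cong (½ ·_) (halfPow-+ m n)) (sym (·-assoc ½ (halfPow m) (halfPow n)))

tuples : ∀ n t → Measure (Vec (Cube n) t)
tuples n t = measure (halfPow (n ℕ.* t)) (<⇒≤ (halfPow>0 (n ℕ.* t))) (allTuples n t)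

𝕋 : ∀ {n t} → (Vec (Cube n) t → ℚ) → ℚ
𝕋 {n} {t} = ∫ (tuples n t)

𝕋-[] : ∀ {n} (F : Vec (Cube n) 0 → ℚ) → 𝕋 F ≡ F []
𝕋-[] {n} F = trans (∫-def _ F) (trans (cong (λ k → halfPow k · (F [] ⊞ 0ℚ)) (ℕₚ.*-zeroʳ n)) (solve 1 (λ a → con 1ℚ :* (a :+ con 0ℚ) := a) refl (F [])))

𝕋-suc : ∀ {n t} (F : Vec (Cube n) (suc t) → ℚ) → 𝕋 F ≡ 𝔼 (λ x → 𝕋 (λ xs → F (x ∷ xs)))
𝕋-suc {n} {t} F = begin-equality
  𝕋 F
    ≡⟨ ∫-def _ F ⟩
  halfPow (n ℕ.* suc t) · sumL (allTuples n (suc t)) F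
    ≡⟨ cong₂ _·_ (trans (cong halfPow (ℕₚ.*-suc n t)) (halfPow-+ n (n ℕ.* t)))
         (trans (sumL-concatMap _ (allCube n) F) (sumL-cong (allCube n) λ x → sumL-map (x ∷_) (allTuples n t) F)) ⟩
  halfPow n · halfPow (n ℕ.* t) · sumL (allCube n) (λ x → sumL (allTuples n t) (λ xs → F (x ∷ xs)))
    ≡⟨ trans (·-assoc (halfPow n) _ _) (cong (halfPow n ·_) (sym (sumL-· (allCube n) (halfPow (n ℕ.* t)) _))) ⟩
  halfPow n · sumL (allCube n) (λ x → halfPow (n ℕ.* t) · sumL (allTuples n t) (λ xs → F (x ∷ xs)))
    ≡⟨ cong (halfPow n ·_) (sumL-cong (allCube n) λ x → sym (∫-def (tuples n t) _)) ⟩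
  halfPow n · sumL (allCube n) (λ x → 𝕋 (λ xs → F (x ∷ xs)))
    ≡⟨ sym (∫-def (avg n) _) ⟩
  𝔼 (λ x → 𝕋 (λ xs → F (x ∷ xs))) ∎

tuples-prob : ∀ n t → IsProb (tuples n t)
tuples-prob n zero = 𝕋-[] {n} (λ _ → 1ℚ)
tuples-prob n (suc t) = trans (𝕋-suc {n} {t} (λ _ → 1ℚ)) (trans (∫-cong λ x → tuples-prob n t) (avg-prob n))

-- Serves to average over the three vertices of one edge while all other vertices are frozen.
resample : ∀ {n t} (i : Fin t) (F : Vec (Cube n) t → ℚ) → 𝕋 F ≡ 𝕋 (λ xs → 𝔼 (λ a → F (xs [ i ]≔ a)))
resample {n} {suc t} Fz F = begin-equality
  𝕋 F ≡⟨ 𝕋-suc F ⟩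
  𝔼 (λ a → 𝕋 (λ xs → F (a ∷ xs))) ≡⟨ ∫-swap _ ⟩
  𝕋 (λ xs → 𝔼 (λ a → F (a ∷ xs))) ≡⟨ sym (∫-const (avg-prob n) _) ⟩
  𝔼 {n} (λ x → 𝕋 (λ xs → 𝔼 (λ a → F (a ∷ xs)))) ≡⟨ sym (𝕋-suc _) ⟩
  𝕋 (λ xs → 𝔼 (λ a → F (xs [ Fz ]≔ a))) ∎
resample {n} {suc t} (Fs i) F = trans (𝕋-suc F) (trans (∫-cong λ x → resample i (λ xs → F (x ∷ xs))) (sym (𝕋-suc _)))

value : Sign → ℚ
value S.+ = 1ℚ
value S.- = ⊖ 1ℚ

value-* : ∀ a b → value (a S.* b) ≡ value a · value b
value-* S.+ b = sym (·-idˡ _)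
value-* S.- S.+ = sym (·-idʳ _)
value-* S.- S.- = sgn-xor true true

value-sq : ∀ a → value a · value a ≡ 1ℚ
value-sq S.+ = ·-idˡ 1ℚ
value-sq S.- = sgn-sq true

value-product : ∀ a b c d e g h → value (a S.* b S.* c S.* d S.* e S.* g S.* h) ≡
  value a · value b · value c · value d · value e · value g · value h
value-product a b c d e g h = trans (value-* (a S.* b S.* c S.* d S.* e S.* g) h) (cong (_· value h)
  (trans (value-* (a S.* b S.* c S.* d S.* e) g) (cong (_· value g)
  (trans (value-* (a S.* b S.* c S.* d) e) (cong (_· value e)
  (trans (value-* (a S.* b S.* c) d) (cong (_· value d)
  (trans (value-* (a S.* b) c) (cong (_· value c) (value-* a b))))))))))

𝟙-agree : ∀ a b → 𝟙 ⌊ a S.≟ b ⌋ ≡ ½ · (1ℚ ⊞ value a · value b)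
𝟙-agree S.+ S.+ = solve 0 (con 1ℚ := con ½ :* (con 1ℚ :+ con 1ℚ :* con 1ℚ)) refl
𝟙-agree S.+ S.- = solve 0 (con 0ℚ := con ½ :* (con 1ℚ :+ con 1ℚ :* (:- con 1ℚ))) refl
𝟙-agree S.- S.+ = solve 0 (con 0ℚ := con ½ :* (con 1ℚ :+ (:- con 1ℚ) :* con 1ℚ)) refl
𝟙-agree S.- S.- = solve 0 (con 1ℚ := con ½ :* (con 1ℚ :+ (:- con 1ℚ) :* (:- con 1ℚ))) refl

𝟙-not : ∀ b → 𝟙 (not b) ≡ 1ℚ ⊟ 𝟙 b
𝟙-not false = solve 0 (con 1ℚ := con 1ℚ :- con 0ℚ) refl
𝟙-not true = solve 0 (con 0ℚ := con 1ℚ :- con 1ℚ) refl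

𝟙-∧ : ∀ a b → 𝟙 (a ∧ b) ≡ 𝟙 a · 𝟙 b
𝟙-∧ false b = sym (·-zeroˡ (𝟙 b))
𝟙-∧ true  b = sym (·-idˡ (𝟙 b))

𝟙-sq≤1 : ∀ b → 𝟙 b · 𝟙 b ≤ 1ℚ
𝟙-sq≤1 b = ·-≤1 (𝟙≥0 b) (𝟙≤1 b) (𝟙≤1 b)

value-quadFn : ∀ {n} (P : QuadPoly n) x → value (quadFn P x) ≡ sgn (evalPoly P x)
value-quadFn P x with evalPoly P x
... | false = refl
... | true = refl

acceptProb-value : ∀ {n t} (H : Hypergraph3 t) (f : Cube n → Sign) → acceptProb H f ≡ 𝕋 (λ xs → 𝟙 (accepts H f xs))
acceptProb-value {n} {t} H f = trans (prob-value (count (accepts H f) (allTuples n t)) (n ℕ.* t)) (trans (cong (halfPow (n ℕ.* t) ·_) (fromℕ-count (accepts H f) (allTuples n t))) (sym (∫-def (tuples n t) _)))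

distance-value : ∀ {n} (f g : Cube n → Sign) → distance f g ≡ ½ ⊟ ½ · 𝔼 (λ x → value (f x) · value (g x))
distance-value {n} f g = begin-equality
  distance f g
    ≡⟨ trans (prob-value (count p (allCube n)) n) (trans (cong (halfPow n ·_) (fromℕ-count p (allCube n))) (sym (∫-def (avg n) _))) ⟩
  𝔼 (λ x → 𝟙 (not ⌊ f x S.≟ g x ⌋))
    ≡⟨ (∫-cong λ x → trans (𝟙-not ⌊ f x S.≟ g x ⌋) (trans (cong (1ℚ ⊟_) (𝟙-agree (f x) (g x)))
         (solve 1 (λ v → con 1ℚ :- con ½ :* (con 1ℚ :+ v) := con ½ :- con ½ :* v) refl (value (f x) · value (g x))))) ⟩
  𝔼 (λ x → ½ ⊟ ½ · (value (f x) · value (g x)))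
    ≡⟨ trans (∫-⊟ _ _) (cong₂ _⊟_ (∫-const (avg-prob n) ½) (∫-· ½ _)) ⟩
  ½ ⊟ ½ · 𝔼 (λ x → value (f x) · value (g x)) ∎
  where
  p : Cube n → Bool
  p x = not ⌊ f x S.≟ g x ⌋

-- Separating one edge from the others

Edge : ℕ → Set
Edge t = Fin t × Fin t × Fin t

Sorted : ∀ {t} → Edge t → Set
Sorted (i , j , k) = (i F.< j) × (j F.< k)

Misses : ∀ {t} → Fin t → Edge t → Set
Misses v (i , j , k) = (i ≢ v) × (j ≢ v) × (k ≢ v)

meets-or-misses : ∀ {t} v (e : Edge t) → let (i , j , k) = e in ((i ≡ v) ⊎ (j ≡ v) ⊎ (k ≡ v)) ⊎ Misses v e
meets-or-misses v (i , j , k) with i Fₚ.≟ v | j Fₚ.≟ v | k Fₚ.≟ v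
... | yes p | _     | _ = inj₁ (inj₁ p)
... | no _  | yes p | _ = inj₁ (inj₂ (inj₁ p))
... | no _  | no _  | yes p = inj₁ (inj₂ (inj₂ p))
... | no p  | no q  | no r = inj₂ (p , q , r)

-- An edge through all of `i`, `j`, `k` has no further vertex, and sortedness leaves only one way to
-- list the three.
misses-vertex : ∀ {t} {i j k : Fin t} {e : Edge t} → Sorted (i , j , k) → Sorted e → (i , j , k) ≢ e →
  Misses i e ⊎ Misses j e ⊎ Misses k e
misses-vertex {i = i} {j} {k} {e@(i′ , j′ , k′)} (i<j , j<k) (i′<j′ , j′<k′) e≢
  with meets-or-misses i e | meets-or-misses j e | meets-or-misses k e
... | inj₂ m | _      | _ = inj₁ m
... | inj₁ _ | inj₂ m | _ = inj₂ (inj₁ m)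
... | inj₁ _ | inj₁ _ | inj₂ m = inj₂ (inj₂ m)
... | inj₁ p | inj₁ q | inj₁ r = ⊥-elim (e≢ (middle p q r))
  where
  i′<k′ : i′ F.< k′
  i′<k′ = Fₚ.<-trans i′<j′ j′<k′
  i≥ : (i′ ≡ i) ⊎ (j′ ≡ i) ⊎ (k′ ≡ i) → i′ F.≤ i
  i≥ (inj₁ refl) = ℕₚ.≤-refl
  i≥ (inj₂ (inj₁ refl)) = ℕₚ.<⇒≤ i′<j′
  i≥ (inj₂ (inj₂ refl)) = ℕₚ.<⇒≤ i′<k′
  k≤ : (i′ ≡ k) ⊎ (j′ ≡ k) ⊎ (k′ ≡ k) → k F.≤ k′
  k≤ (inj₁ refl) = ℕₚ.<⇒≤ i′<k′
  k≤ (inj₂ (inj₁ refl)) = ℕₚ.<⇒≤ j′<k′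
  k≤ (inj₂ (inj₂ refl)) = ℕₚ.≤-refl
  outer : (i′ ≡ i) ⊎ (j′ ≡ i) ⊎ (k′ ≡ i) → (i′ ≡ k) ⊎ (j′ ≡ k) ⊎ (k′ ≡ k) → j′ ≡ j → (i , j , k) ≡ e
  outer (inj₁ refl)        (inj₁ refl)        refl = ⊥-elim (ℕₚ.<-irrefl refl (ℕₚ.<-trans i<j j<k))
  outer (inj₁ refl)        (inj₂ (inj₁ refl)) refl = ⊥-elim (ℕₚ.<-irrefl refl j<k)
  outer (inj₁ refl)        (inj₂ (inj₂ refl)) refl = refl
  outer (inj₂ (inj₁ refl)) _                  refl = ⊥-elim (ℕₚ.<-irrefl refl i<j)
  outer (inj₂ (inj₂ refl)) _                  refl = ⊥-elim (ℕₚ.<-irrefl refl (ℕₚ.<-trans i<j j′<k′))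
  middle : (i′ ≡ i) ⊎ (j′ ≡ i) ⊎ (k′ ≡ i) → (i′ ≡ j) ⊎ (j′ ≡ j) ⊎ (k′ ≡ j) → (i′ ≡ k) ⊎ (j′ ≡ k) ⊎ (k′ ≡ k) → (i , j , k) ≡ e
  middle p (inj₁ refl)        r = ⊥-elim (ℕₚ.<-irrefl refl (ℕₚ.<-≤-trans i<j (i≥ p)))
  middle p (inj₂ (inj₁ q))    r = outer p r q
  middle p (inj₂ (inj₂ refl)) r = ⊥-elim (ℕₚ.<-irrefl refl (ℕₚ.<-≤-trans j<k (k≤ r)))

module EdgeBound {n t : ℕ} (f : Cube n → Sign) where

  f̂ : Cube n → ℚ
  f̂ x = value (f x)

  f̂² : ∀ x → f̂ x · f̂ x ≡ 1ℚ
  f̂² x = value-sq (f x)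

  open GowersCauchySchwarz f̂ f̂² renaming (value to gowersValue)
  open Ambiguity f̂ f̂² using (Δ)

  edgeProduct : Cube n → Cube n → Cube n → ℚ
  edgeProduct a b c = f̂ a · f̂ b · f̂ c · f̂ (a ⊕ b) · f̂ (a ⊕ c) · f̂ (b ⊕ c) · f̂ ((a ⊕ b) ⊕ c) · f̂ 𝟎

  edgeValue : Vec (Cube n) t → Edge t → ℚ
  edgeValue xs (i , j , k) = edgeProduct (lookup xs i) (lookup xs j) (lookup xs k)

  𝟙-edgeTest : ∀ xs e → 𝟙 (edgeTest f xs e) ≡ ½ · (1ℚ ⊞ edgeValue xs e)
  𝟙-edgeTest xs (i , j , k) = trans (𝟙-agree (f a S.* f b S.* f c S.* f (a ⊕ b) S.* f (a ⊕ c) S.* f (b ⊕ c) S.* f ((a ⊕ b) ⊕ c)) (f 𝟎))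
    (cong (λ s → ½ · (1ℚ ⊞ s · f̂ 𝟎)) (value-product (f a) (f b) (f c) (f (a ⊕ b)) (f (a ⊕ c)) (f (b ⊕ c)) (f ((a ⊕ b) ⊕ c))))
    where
    a = lookup xs i
    b = lookup xs j
    c = lookup xs k

  all-tests : List (Edge t) → Vec (Cube n) t → Bool
  all-tests es xs = L.foldr (λ e r → edgeTest f xs e ∧ r) true es

  edgeTest-cong : ∀ (xs ys : Vec (Cube n) t) (e : Edge t) → (∀ v → (proj₁ e ≡ v) ⊎ (proj₁ (proj₂ e) ≡ v) ⊎ (proj₂ (proj₂ e) ≡ v) → lookup xs v ≡ lookup ys v) →
    edgeTest f xs e ≡ edgeTest f ys e
  edgeTest-cong xs ys (i , j , k) h = at (h i (inj₁ refl)) (h j (inj₂ (inj₁ refl))) (h k (inj₂ (inj₂ refl)))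
    where
    test : Cube n → Cube n → Cube n → Bool
    test a b c = ⌊ (f a S.* f b S.* f c S.* f (a ⊕ b) S.* f (a ⊕ c) S.* f (b ⊕ c) S.* f ((a ⊕ b) ⊕ c)) S.≟ f 𝟎 ⌋
    at : ∀ {a a′ b b′ c c′} → a ≡ a′ → b ≡ b′ → c ≡ c′ → test a b c ≡ test a′ b′ c′
    at refl refl refl = refl

  module _ (i j k : Fin t) (i<j : i F.< j) (j<k : j F.< k) (xs : Vec (Cube n) t) where

    i≢j : i ≢ j
    i≢j refl = ℕₚ.<-irrefl refl i<j
    j≢k : j ≢ k
    j≢k refl = ℕₚ.<-irrefl refl j<k
    i≢k : i ≢ k
    i≢k refl = ℕₚ.<-irrefl refl (ℕₚ.<-trans i<j j<k)

    place : Cube n → Cube n → Cube n → Vec (Cube n) t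
    place a b c = ((xs [ i ]≔ a) [ j ]≔ b) [ k ]≔ c

    place₁ : Cube n → Vec (Cube n) t
    place₁ a = xs [ i ]≔ a

    place₂ : Cube n → Cube n → Vec (Cube n) t
    place₂ a b = (xs [ i ]≔ a) [ j ]≔ b

    place-i : ∀ a b c → lookup (place a b c) i ≡ a
    place-i a b c = trans (Vₚ.lookup∘update′ i≢k (place₂ a b) c) (trans (Vₚ.lookup∘update′ i≢j (place₁ a) b) (Vₚ.lookup∘update i xs a))
    place-j : ∀ a b c → lookup (place a b c) j ≡ b
    place-j a b c = trans (Vₚ.lookup∘update′ j≢k (place₂ a b) c) (Vₚ.lookup∘update j (xs [ i ]≔ a) b)
    place-k : ∀ a b c → lookup (place a b c) k ≡ c
    place-k a b c = Vₚ.lookup∘update k (place₂ a b) c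

    update-agree : ∀ (ys zs : Vec (Cube n) t) u v x → (v ≢ u → lookup ys v ≡ lookup zs v) → lookup (ys [ u ]≔ x) v ≡ lookup (zs [ u ]≔ x) v
    update-agree ys zs u v x h with v Fₚ.≟ u
    ... | yes refl = trans (Vₚ.lookup∘update u ys x) (sym (Vₚ.lookup∘update u zs x))
    ... | no v≢u = trans (Vₚ.lookup∘update′ v≢u ys x) (trans (h v≢u) (sym (Vₚ.lookup∘update′ v≢u zs x)))

    avoid : ∀ {u : Fin t} {e : Edge t} {v} → Misses u e → (proj₁ e ≡ v) ⊎ (proj₁ (proj₂ e) ≡ v) ⊎ (proj₂ (proj₂ e) ≡ v) → v ≢ u
    avoid (p , q , r) (inj₁ refl) = p
    avoid (p , q , r) (inj₂ (inj₁ refl)) = q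
    avoid (p , q , r) (inj₂ (inj₂ refl)) = r

    miss-i : ∀ e → Misses i e → ∀ a b c → edgeTest f (place a b c) e ≡ edgeTest f (place 𝟎 b c) e
    miss-i e m a b c = edgeTest-cong (place a b c) (place 𝟎 b c) e λ v hv → update-agree (place₂ a b) (place₂ 𝟎 b) k v c λ _ → update-agree (place₁ a) (place₁ 𝟎) j v b λ _ →
      trans (Vₚ.lookup∘update′ (avoid m hv) xs a) (sym (Vₚ.lookup∘update′ (avoid m hv) xs 𝟎))
    miss-j : ∀ e → Misses j e → ∀ a b c → edgeTest f (place a b c) e ≡ edgeTest f (place a 𝟎 c) e
    miss-j e m a b c = edgeTest-cong (place a b c) (place a 𝟎 c) e λ v hv → update-agree (place₂ a b) (place₂ a 𝟎) k v c λ _ →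
      trans (Vₚ.lookup∘update′ (avoid m hv) (place₁ a) b) (sym (Vₚ.lookup∘update′ (avoid m hv) (place₁ a) 𝟎))
    miss-k : ∀ e → Misses k e → ∀ a b c → edgeTest f (place a b c) e ≡ edgeTest f (place a b 𝟎) e
    miss-k e m a b c = edgeTest-cong (place a b c) (place a b 𝟎) e λ v hv →
      trans (Vₚ.lookup∘update′ (avoid m hv) (place₂ a b) c) (sym (Vₚ.lookup∘update′ (avoid m hv) (place₂ a b) 𝟎))

    -- With the other vertices frozen, every other edge reads at most two of `a`, `b`, `c`, so its
    -- test is absorbed into the factor of one pair of variables.
    record Factored (es : List (Edge t)) : Set where
      field
        H₁ H₂ H₃ : Cube n → Cube n → ℚ
        b₁       : Bounded H₁
        b₂       : Bounded H₂
        b₃       : Bounded H₃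
        factors  : ∀ a b c → 𝟙 (all-tests es (place a b c)) ≡ H₁ b c · (H₂ a c · H₃ a b)

    1-bounded : Bounded (λ _ _ → 1ℚ)
    1-bounded _ _ = ≤-reflexive (·-idˡ 1ℚ)

    factored : ∀ es → All Sorted es → All (λ e → (i , j , k) ≢ e) es → Factored es
    factored [] _ _ = record { H₁ = λ _ _ → 1ℚ ; H₂ = λ _ _ → 1ℚ ; H₃ = λ _ _ → 1ℚ ; b₁ = 1-bounded ; b₂ = 1-bounded ; b₃ = 1-bounded
      ; factors = λ _ _ _ → solve 0 (con 1ℚ := con 1ℚ :* (con 1ℚ :* con 1ℚ)) refl }
    factored (e ∷ es) (s ∷ ss) (ne ∷ nes) = extend (misses-vertex (i<j , j<k) s ne)
      where
      open Factored (factored es ss nes)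
      split : ∀ a b c {r} → edgeTest f (place a b c) e ≡ r → 𝟙 (all-tests (e ∷ es) (place a b c)) ≡ 𝟙 r · (H₁ b c · (H₂ a c · H₃ a b))
      split a b c eq = trans (𝟙-∧ (edgeTest f (place a b c) e) (all-tests es (place a b c))) (cong₂ _·_ (cong 𝟙 eq) (factors a b c))
      extend : Misses i e ⊎ Misses j e ⊎ Misses k e → Factored (e ∷ es)
      -- The test does not read vertex `i`, so `𝟎` can stand for `a`.
      extend (inj₁ m) = record { H₁ = λ b c → 𝟙 (edgeTest f (place 𝟎 b c) e) · H₁ b c ; H₂ = H₂ ; H₃ = H₃
        ; b₁ = λ b c → ·-bounded (𝟙-sq≤1 (edgeTest f (place 𝟎 b c) e)) (b₁ b c) ; b₂ = b₂ ; b₃ = b₃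
        ; factors = λ a b c → trans (split a b c (miss-i e m a b c)) (sym (·-assoc _ (H₁ b c) _)) }
      extend (inj₂ (inj₁ m)) = record { H₁ = H₁ ; H₂ = λ a c → 𝟙 (edgeTest f (place a 𝟎 c) e) · H₂ a c ; H₃ = H₃
        ; b₁ = b₁ ; b₂ = λ a c → ·-bounded (𝟙-sq≤1 (edgeTest f (place a 𝟎 c) e)) (b₂ a c) ; b₃ = b₃
        ; factors = λ a b c → trans (split a b c (miss-j e m a b c))
          (solve 4 (λ t p q r → t :* (p :* (q :* r)) := p :* ((t :* q) :* r)) refl (𝟙 (edgeTest f (place a 𝟎 c) e)) (H₁ b c) (H₂ a c) (H₃ a b)) }
      extend (inj₂ (inj₂ m)) = record { H₁ = H₁ ; H₂ = H₂ ; H₃ = λ a b → 𝟙 (edgeTest f (place a b 𝟎) e) · H₃ a b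
        ; b₁ = b₁ ; b₂ = b₂ ; b₃ = λ a b → ·-bounded (𝟙-sq≤1 (edgeTest f (place a b 𝟎) e)) (b₃ a b)
        ; factors = λ a b c → trans (split a b c (miss-k e m a b c))
          (solve 4 (λ t p q r → t :* (p :* (q :* r)) := p :* (q :* (t :* r))) refl (𝟙 (edgeTest f (place a b 𝟎) e)) (H₁ b c) (H₂ a c) (H₃ a b)) }

    -- By contradiction, which avoids eighth roots: the eighth power of a value above `u` would be
    -- at least that of `u`, yet `value⁸` keeps it below.
    local-bound : ∀ es → All Sorted es → All (λ e → (i , j , k) ≢ e) es → ∀ {u} → 0ℚ ≤ u →
      𝔼 (λ h → 𝔼 (λ k → Δ h k · Δ h k)) < ((u · u) · (u · u)) · ((u · u) · (u · u)) →
      𝔼 (λ a → 𝔼 (λ b → 𝔼 (λ c → edgeValue (place a b c) (i , j , k) · 𝟙 (all-tests es (place a b c))))) ≤ u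
    local-bound es ss nes {u} u≥0 small = ≮⇒≥ λ u<X → <-irrefl refl (<-≤-trans small (≤-trans
      (·-mono-sq (0≤sq (u · u)) (·-mono-sq (0≤sq u) (·-mono-sq u≥0 (≤-trans (<⇒≤ u<X) (≤-reflexive eq))))) (value⁸ K₁ K₂ K₃ B₁ B₂ B₃)))
      where
      open Factored (factored es ss nes)
      K₁ K₂ K₃ : Cube n → Cube n → ℚ
      -- Only `f̂ ((a ⊕ b) ⊕ c)` involves all three variables; the other factors of `edgeProduct`
      -- are distributed over the pairs.
      K₁ b c = (f̂ b · f̂ c) · (f̂ (b ⊕ c) · H₁ b c)
      K₂ a c = (f̂ (a ⊕ c) · f̂ 𝟎) · H₂ a c
      K₃ a b = (f̂ a · f̂ (a ⊕ b)) · H₃ a b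
      f̂≤1 : ∀ x → f̂ x · f̂ x ≤ 1ℚ
      f̂≤1 x = ≤-reflexive (f̂² x)
      B₁ : Bounded K₁
      B₁ b c = ·-bounded (·-bounded (f̂≤1 b) (f̂≤1 c)) (·-bounded (f̂≤1 (b ⊕ c)) (b₁ b c))
      B₂ : Bounded K₂
      B₂ a c = ·-bounded (·-bounded (f̂≤1 (a ⊕ c)) (f̂≤1 𝟎)) (b₂ a c)
      B₃ : Bounded K₃
      B₃ a b = ·-bounded (·-bounded (f̂≤1 a) (f̂≤1 (a ⊕ b))) (b₃ a b)
      at-place : ∀ a b c → edgeValue (place a b c) (i , j , k) ≡ edgeProduct a b c
      at-place a b c = trans (cong (λ z → edgeProduct z (lookup (place a b c) j) (lookup (place a b c) k)) (place-i a b c))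
        (cong₂ (edgeProduct a) (place-j a b c) (place-k a b c))
      eq : 𝔼 (λ a → 𝔼 (λ b → 𝔼 (λ c → edgeValue (place a b c) (i , j , k) · 𝟙 (all-tests es (place a b c))))) ≡ gowersValue K₁ K₂ K₃ B₁ B₂ B₃
      eq = ∫-cong λ a → ∫-cong λ b → ∫-cong λ c → trans (cong₂ _·_ (at-place a b c) (factors a b c))
        (solve 11 (λ fa fb fc fab fac fbc fabc f0 p q r →
          (fa :* fb :* fc :* fab :* fac :* fbc :* fabc :* f0) :* (p :* (q :* r)) :=
          ((fb :* fc) :* (fbc :* p)) :* (((fac :* f0) :* q) :* (((fa :* fab) :* r) :* fabc))) refl
          (f̂ a) (f̂ b) (f̂ c) (f̂ (a ⊕ b)) (f̂ (a ⊕ c)) (f̂ (b ⊕ c)) (f̂ ((a ⊕ b) ⊕ c)) (f̂ 𝟎) (H₁ b c) (H₂ a c) (H₃ a b))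

  module _ {u : ℚ} (u≥0 : 0ℚ ≤ u) (small : 𝔼 (λ h → 𝔼 (λ k → Δ h k · Δ h k)) < ((u · u) · (u · u)) · ((u · u) · (u · u))) where

    edge-bound : ∀ e es → Sorted e → All Sorted es → All (e ≢_) es → 𝕋 (λ xs → edgeValue xs e · 𝟙 (all-tests es xs)) ≤ u
    edge-bound (i , j , k) es (i<j , j<k) ss nes = begin
      𝕋 F
        ≡⟨ trans (resample k F) (trans (resample j _) (resample i _)) ⟩
      𝕋 (λ xs → 𝔼 (λ a → 𝔼 (λ b → 𝔼 (λ c → F (((xs [ i ]≔ a) [ j ]≔ b) [ k ]≔ c)))))
        ≤⟨ (∫-mono λ xs → local-bound i j k i<j j<k xs es ss nes u≥0 small) ⟩
      𝕋 {n} {t} (λ xs → u)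
        ≡⟨ ∫-const (tuples-prob n t) u ⟩
      u ∎
      where
      F : Vec (Cube n) t → ℚ
      F xs = edgeValue xs (i , j , k) · 𝟙 (all-tests es xs)

    -- The error does not accumulate over the edges: the indicator of an edge carries a factor `½`,
    -- which halves both the inherited error and the new one, and two halves of `u` make `u`.
    accept-bound : ∀ es → All Sorted es → Unique es → 𝕋 (λ xs → 𝟙 (all-tests es xs)) ≤ halfPow (length es) ⊞ u
    accept-bound [] _ _ = ≤-trans (≤-reflexive (tuples-prob n t)) (≤-by u u≥0 refl)
    accept-bound (e ∷ es) (s ∷ ss) (ne ∷ un) = begin
      𝕋 (λ xs → 𝟙 (edgeTest f xs e ∧ all-tests es xs))
        ≡⟨ (∫-cong λ xs → trans (𝟙-∧ (edgeTest f xs e) (all-tests es xs)) (trans (cong (_· 𝟙 (all-tests es xs)) (𝟙-edgeTest xs e))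
          (solve 2 (λ v r → con ½ :* (con 1ℚ :+ v) :* r := con ½ :* (r :+ v :* r)) refl (edgeValue xs e) (𝟙 (all-tests es xs))))) ⟩
      𝕋 (λ xs → ½ · (𝟙 (all-tests es xs) ⊞ edgeValue xs e · 𝟙 (all-tests es xs)))
        ≡⟨ trans (∫-· ½ _) (cong (½ ·_) (∫-⊞ _ _)) ⟩
      ½ · (𝕋 (λ xs → 𝟙 (all-tests es xs)) ⊞ 𝕋 (λ xs → edgeValue xs e · 𝟙 (all-tests es xs)))
        ≤⟨ ·-monoˡ 0≤½ (⊞-mono (accept-bound es ss un) (edge-bound e es s ss ne)) ⟩
      ½ · ((halfPow (length es) ⊞ u) ⊞ u)
        ≡⟨ solve 2 (λ h u → con ½ :* ((h :+ u) :+ u) := con ½ :* h :+ u) refl (halfPow (length es)) u ⟩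
      halfPow (length (e ∷ es)) ⊞ u ∎

-- Perfect completeness

xorSum-xor : ∀ n (g h : Fin n → Bool) → xorSum n (λ i → g i xor h i) ≡ xorSum n g xor xorSum n h
xorSum-xor zero    g h = refl
xorSum-xor (suc n) g h = trans (cong ((g Fz xor h Fz) xor_) (xorSum-xor n (g ∘ Fs) (h ∘ Fs)))
  (xor-interchange (g Fz) (h Fz) (xorSum n (g ∘ Fs)) (xorSum n (h ∘ Fs)))

lookup-⊕ : ∀ {n} (x y : Cube n) i → lookup (x ⊕ y) i ≡ lookup x i xor lookup y i
lookup-⊕ x y i = Vₚ.lookup-zipWith _xor_ i x y

module Quadratic {n : ℕ} (P : QuadPoly n) where
  open QuadPoly P

  linear : Cube n → Bool
  linear x = xorSum n (λ i → lin i ∧ lookup x i)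

  linear-⊕ : ∀ x y → linear (x ⊕ y) ≡ linear x xor linear y
  linear-⊕ x y = trans (xorSum-cong n λ i → trans (cong (lin i ∧_) (lookup-⊕ x y i)) (𝔹ₚ.∧-distribˡ-xor (lin i) (lookup x i) (lookup y i)))
    (xorSum-xor n (λ i → lin i ∧ lookup x i) (λ i → lin i ∧ lookup y i))

  bilinear : Cube n → Cube n → Bool
  bilinear x y = xorSum n (λ i → xorSum n (λ j → quad i j ∧ (lookup x i ∧ lookup y j)))

  bilinear-cong : ∀ {x y x′ y′ x″ y″} → (∀ i j → lookup x i ∧ lookup y j ≡ (lookup x′ i ∧ lookup y′ j) xor (lookup x″ i ∧ lookup y″ j)) →
    bilinear x y ≡ bilinear x′ y′ xor bilinear x″ y″
  bilinear-cong {x} {y} {x′} {y′} {x″} {y″} h = trans (xorSum-cong n λ i → trans (xorSum-cong n λ j → trans (cong (quad i j ∧_) (h i j)) (𝔹ₚ.∧-distribˡ-xor (quad i j) _ _))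
    (xorSum-xor n (λ j → quad i j ∧ (lookup x′ i ∧ lookup y′ j)) (λ j → quad i j ∧ (lookup x″ i ∧ lookup y″ j))))
    (xorSum-xor n (λ i → xorSum n (λ j → quad i j ∧ (lookup x′ i ∧ lookup y′ j))) (λ i → xorSum n (λ j → quad i j ∧ (lookup x″ i ∧ lookup y″ j))))

  bilinear-⊕ˡ : ∀ x y z → bilinear (x ⊕ y) z ≡ bilinear x z xor bilinear y z
  bilinear-⊕ˡ x y z = bilinear-cong {x ⊕ y} {z} {x} {z} {y} {z} λ i j → trans (cong (_∧ lookup z j) (lookup-⊕ x y i)) (𝔹ₚ.∧-distribʳ-xor (lookup z j) (lookup x i) (lookup y i))

  bilinear-⊕ʳ : ∀ x y z → bilinear x (y ⊕ z) ≡ bilinear x y xor bilinear x z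
  bilinear-⊕ʳ x y z = bilinear-cong {x} {y ⊕ z} {x} {y} {x} {z} λ i j → trans (cong (lookup x i ∧_) (lookup-⊕ y z j)) (𝔹ₚ.∧-distribˡ-xor (lookup x i) (lookup y j) (lookup z j))

  p : Cube n → Bool
  p x = linear x xor bilinear x x

  s : Cube n → Cube n → Bool
  s x y = bilinear x y xor bilinear y x

  p-⊕ : ∀ x y → p (x ⊕ y) ≡ (p x xor p y) xor s x y
  p-⊕ x y = trans (cong₂ _xor_ (linear-⊕ x y) (trans (bilinear-⊕ˡ x y (x ⊕ y)) (cong₂ _xor_ (bilinear-⊕ʳ x x y) (bilinear-⊕ʳ y x y))))
    (𝔹.solve 6 (λ a b c d e g → (a 𝔹.:+ b) 𝔹.:+ ((c 𝔹.:+ d) 𝔹.:+ (e 𝔹.:+ g)) 𝔹.:= ((a 𝔹.:+ c) 𝔹.:+ (b 𝔹.:+ g)) 𝔹.:+ (d 𝔹.:+ e)) refl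
      (linear x) (linear y) (bilinear x x) (bilinear x y) (bilinear y x) (bilinear y y))
    where module 𝔹 = xor-∧-Solver

  s-⊕ˡ : ∀ x y z → s (x ⊕ y) z ≡ s x z xor s y z
  s-⊕ˡ x y z = trans (cong₂ _xor_ (bilinear-⊕ˡ x y z) (bilinear-⊕ʳ z x y)) (xor-interchange (bilinear x z) (bilinear y z) (bilinear z x) (bilinear z y))

  p-𝟎 : p 𝟎 ≡ false
  p-𝟎 = trans (cong p (sym (⊕-self 𝟎))) (trans (p-⊕ 𝟎 𝟎) (cong₂ _xor_ (𝔹ₚ.xor-same (p 𝟎)) (𝔹ₚ.xor-same (bilinear 𝟎 𝟎))))

  -- The third derivative of a polynomial of degree 2 vanishes: `p a`, `p b`, `p c` each occur four
  -- times, each polar term twice, and the constant seven times.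
  third-derivative : ∀ a b c → (((((evalPoly P a xor evalPoly P b) xor evalPoly P c) xor evalPoly P (a ⊕ b)) xor evalPoly P (a ⊕ c)) xor evalPoly P (b ⊕ c)) xor
    evalPoly P ((a ⊕ b) ⊕ c) ≡ evalPoly P 𝟎
  third-derivative a b c = trans
    (regroup (p-⊕ a b) (p-⊕ a c) (p-⊕ b c) (trans (p-⊕ (a ⊕ b) c) (cong₂ (λ t u → (t xor p c) xor u) (p-⊕ a b) (s-⊕ˡ a b c))))
    (trans (sym (𝔹ₚ.xor-identityʳ k)) (cong (k xor_) (sym p-𝟎)))
    where
    k = const
    module 𝔹 = xor-∧-Solver
    regroup : ∀ {u v w z} → u ≡ (p a xor p b) xor s a b → v ≡ (p a xor p c) xor s a c → w ≡ (p b xor p c) xor s b c →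
      z ≡ (((p a xor p b) xor s a b) xor p c) xor (s a c xor s b c) →
      ((((((k xor p a) xor (k xor p b)) xor (k xor p c)) xor (k xor u)) xor (k xor v)) xor (k xor w)) xor (k xor z) ≡ k
    regroup refl refl refl refl = 𝔹.solve 7 (λ k a b c ab ac bc →
      ((((((k 𝔹.:+ a) 𝔹.:+ (k 𝔹.:+ b)) 𝔹.:+ (k 𝔹.:+ c)) 𝔹.:+ (k 𝔹.:+ ((a 𝔹.:+ b) 𝔹.:+ ab))) 𝔹.:+ (k 𝔹.:+ ((a 𝔹.:+ c) 𝔹.:+ ac))) 𝔹.:+ (k 𝔹.:+ ((b 𝔹.:+ c) 𝔹.:+ bc)))
        𝔹.:+ (k 𝔹.:+ ((((a 𝔹.:+ b) 𝔹.:+ ab) 𝔹.:+ c) 𝔹.:+ (ac 𝔹.:+ bc))) 𝔹.:= k) refl k (p a) (p b) (p c) (s a b) (s a c) (s b c)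

signOf : Bool → Sign
signOf b = if b then S.- else S.+

signOf-xor : ∀ a b → signOf (a xor b) ≡ signOf a S.* signOf b
signOf-xor false b = refl
signOf-xor true  false = refl
signOf-xor true  true = refl

signOf-product : ∀ a b c d e g h → signOf a S.* signOf b S.* signOf c S.* signOf d S.* signOf e S.* signOf g S.* signOf h ≡
  signOf ((((((a xor b) xor c) xor d) xor e) xor g) xor h)
signOf-product a b c d e g h = sym (trans (signOf-xor (((((a xor b) xor c) xor d) xor e) xor g) h) (cong (S._* signOf h)
  (trans (signOf-xor ((((a xor b) xor c) xor d) xor e) g) (cong (S._* signOf g)
  (trans (signOf-xor (((a xor b) xor c) xor d) e) (cong (S._* signOf e)
  (trans (signOf-xor ((a xor b) xor c) d) (cong (S._* signOf d)
  (trans (signOf-xor (a xor b) c) (cong (S._* signOf c) (signOf-xor a b)))))))))))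

module Complete {n t : ℕ} (f : Cube n → Sign) (P : QuadPoly n) (f≡P : ∀ x → f x ≡ quadFn P x) where

  passes : ∀ a b c → f a S.* f b S.* f c S.* f (a ⊕ b) S.* f (a ⊕ c) S.* f (b ⊕ c) S.* f ((a ⊕ b) ⊕ c) ≡ f 𝟎
  passes a b c = trans (substitute (f≡P a) (f≡P b) (f≡P c) (f≡P (a ⊕ b)) (f≡P (a ⊕ c)) (f≡P (b ⊕ c)) (f≡P ((a ⊕ b) ⊕ c)))
    (trans (signOf-product (evalPoly P a) (evalPoly P b) (evalPoly P c) (evalPoly P (a ⊕ b)) (evalPoly P (a ⊕ c)) (evalPoly P (b ⊕ c)) (evalPoly P ((a ⊕ b) ⊕ c)))
      (trans (cong signOf (Quadratic.third-derivative P a b c)) (sym (f≡P 𝟎))))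
    where
    substitute : ∀ {a b c d e g h a′ b′ c′ d′ e′ g′ h′} → a ≡ a′ → b ≡ b′ → c ≡ c′ → d ≡ d′ → e ≡ e′ → g ≡ g′ → h ≡ h′ →
      a S.* b S.* c S.* d S.* e S.* g S.* h ≡ a′ S.* b′ S.* c′ S.* d′ S.* e′ S.* g′ S.* h′
    substitute refl refl refl refl refl refl refl = refl

  ≟-true : ∀ {a b : Sign} → a ≡ b → ⌊ a S.≟ b ⌋ ≡ true
  ≟-true {S.+} refl = refl
  ≟-true {S.-} refl = refl

  accepts-true : ∀ (es : List (Edge t)) xs → L.foldr (λ e r → edgeTest f xs e ∧ r) true es ≡ true
  accepts-true []                 xs = refl
  accepts-true ((i , j , k) ∷ es) xs = cong₂ _∧_ (≟-true (passes (lookup xs i) (lookup xs j) (lookup xs k))) (accepts-true es xs)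

completeness : ∀ {n t} (H : Hypergraph3 t) (f : Cube n → Sign) → IsQuadratic f → acceptProb H f ≡ 1ℚ
completeness {n} {t} H f (P , h) = trans (acceptProb-value H f)
  (trans (∫-cong λ xs → cong 𝟙 (Complete.accepts-true f P h (Hypergraph3.edges H) xs)) (tuples-prob n t))

-- Soundness and the error function

acceptProb≤1 : ∀ {n t} (H : Hypergraph3 t) (f : Cube n → Sign) → acceptProb H f ≤ 1ℚ
acceptProb≤1 {n} {t} H f = ≤-trans (≤-reflexive (acceptProb-value H f)) (≤-trans (∫-mono λ xs → 𝟙≤1 (accepts H f xs)) (≤-reflexive (tuples-prob n t)))

prob-1 : ∀ k → prob 1 k ≡ halfPow k
prob-1 k = trans (prob-value 1 k) (trans (cong (halfPow k ·_) (⊞-idʳ 1ℚ)) (·-idʳ _))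

Far : ∀ {n} → (Cube n → Sign) → ℚ → Set
Far {n} f ε = (P : QuadPoly n) → ½ - ε ≤ distance f (quadFn P)

soundness′ : ∀ {u} → 0ℚ < u → ∃ λ ε₁ → 0ℚ < ε₁ × (∀ {n t} (H : Hypergraph3 t) (f : Cube n → Sign) {ε} → ε < ε₁ → Far f ε →
  acceptProb H f ≤ prob 1 (numEdges H) + u)
-- The distance is `½` minus half the correlation, hence the factor `½`.
soundness′ {u} u>0 = ½ · ε₀ , ·-pos 0<½ (proj₁ (proj₂ inverse)) , main
  where
  δ : ℚ
  -- The eighth power that three applications of Cauchy-Schwarz call for.
  δ = ((u · u) · (u · u)) · ((u · u) · (u · u))
  inverse = inverse-U³ {δ} (sq>0 (sq>0 (sq>0 u>0)))
  ε₀ : ℚ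
  ε₀ = proj₁ inverse
  main : ∀ {n t} (H : Hypergraph3 t) (f : Cube n → Sign) {ε} → ε < ½ · ε₀ → Far f ε → acceptProb H f ≤ prob 1 (numEdges H) + u
  main {n} {t} H f {ε} ε< far = begin
    acceptProb H f ≡⟨ acceptProb-value H f ⟩
    𝕋 (λ xs → 𝟙 (accepts H f xs)) ≤⟨ EB.accept-bound (<⇒≤ u>0) small (Hypergraph3.edges H) (All.map (λ {e} q → q) (Hypergraph3.sorted H)) (Hypergraph3.unique H) ⟩
    halfPow (numEdges H) ⊞ u ≡⟨ trans (cong (_⊞ u) (sym (prob-1 (numEdges H)))) (⊞-def _ u) ⟩
    prob 1 (numEdges H) + u ∎
    where
    module EB = EdgeBound {n} {t} f
    U : ℚ
    U = 𝔼 (λ h → 𝔼 (λ k → Ambiguity.Δ EB.f̂ EB.f̂² h k · Ambiguity.Δ EB.f̂ EB.f̂² h k))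
    contradictory : (∃ λ P → ε₀ < Integrate.correlation EB.f̂ EB.f̂² P) → ⊥
    contradictory (P , h) = <-irrefl refl (begin-strict
      ½ · ε₀ <⟨ ·-monoˡ-< 0<½ h ⟩
      ½ · c ≡⟨ solve 2 (λ c e → con ½ :* c := (con ½ :- e) :- (con ½ :- con ½ :* c) :+ e) refl c ε ⟩
      (½ ⊟ ε) ⊟ (½ ⊟ ½ · c) ⊞ ε ≤⟨ ⊞-mono (⊟-mono far′ (≤-refl {½ ⊟ ½ · c})) (<⇒≤ ε<) ⟩
      (½ ⊟ ½ · c) ⊟ (½ ⊟ ½ · c) ⊞ ½ · ε₀ ≡⟨ solve 2 (λ d e → d :- d :+ e := e) refl (½ ⊟ ½ · c) (½ · ε₀) ⟩
      ½ · ε₀ ∎)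
      where
      c : ℚ
      c = Integrate.correlation EB.f̂ EB.f̂² P
      far′ : ½ ⊟ ε ≤ ½ ⊟ ½ · c
      far′ = subst₂ _≤_ (sym (trans (⊞-def ½ (⊖ ε)) (cong (½ +_) (⊖-def ε))))
        (trans (distance-value f (quadFn P)) (cong (λ t → ½ ⊟ ½ · t) (∫-cong λ x → cong (value (f x) ·_) (value-quadFn P x)))) (far P)
    small : U < δ
    small = ≰⇒> λ h → contradictory (proj₂ (proj₂ inverse) EB.f̂ EB.f̂² h)

opaque
  -- Sealed so that the thresholds are never evaluated.
  soundness : ∀ {u} → 0ℚ < u → ∃ λ ε₁ → 0ℚ < ε₁ × (∀ {n t} (H : Hypergraph3 t) (f : Cube n → Sign) {ε} → ε < ε₁ → Far f ε →
    acceptProb H f ≤ prob 1 (numEdges H) + u)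
  soundness = soundness′

-- φ ε is the least 2^(−m), m < N, for which soundness with error 2^(−m) applies at ε; the
-- condition ε < 2^(−m) makes a bound N in terms of ε alone sufficient.
Admissible : ℕ → ℚ → Set
Admissible m ε = ε < proj₁ (soundness (halfPow>0 m)) × ε < halfPow m

admissible? : ∀ m ε → Dec (Admissible m ε)
admissible? m ε = (ε ℚₚ.<? proj₁ (soundness (halfPow>0 m))) ×-dec (ε ℚₚ.<? halfPow m)

descend : ℕ → ℚ → ℚ
-- With no admissible level left the error is 1, which is sound for every `f`.
descend zero    ε = 1ℚ
descend (suc m) ε with admissible? m ε
... | yes _ = halfPow m
... | no _ = descend m ε

descend≥0 : ∀ m ε → 0ℚ ≤ descend m ε
descend≥0 zero    ε = 0≤1
descend≥0 (suc m) ε with admissible? m ε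
... | yes _ = <⇒≤ (halfPow>0 m)
... | no _ = descend≥0 m ε

descend-small : ∀ N {m ε} → m ℕ.< N → Admissible m ε → descend N ε ≤ halfPow m
descend-small (suc N) {m} {ε} (ℕ.s≤s m≤N) adm with admissible? N ε
... | yes _ = halfPow-anti m≤N
... | no ¬a with ℕₚ.m≤n⇒m<n∨m≡n m≤N
...   | inj₁ m<N = descend-small N m<N adm
...   | inj₂ refl = ⊥-elim (¬a adm)

descend-value : ∀ N ε → descend N ε ≡ 1ℚ ⊎ ∃ λ m → Admissible m ε × descend N ε ≡ halfPow m
descend-value zero    ε = inj₁ refl
descend-value (suc N) ε with admissible? N ε
... | yes a = inj₂ (N , a , refl)
... | no _ = descend-value N ε

-- An admissible `m` has `ε < halfPow m`, so it lies below any `N` with `halfPow N < ε`, and a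
-- search below such an `N` misses none.
depth : ∀ {ε} → 0ℚ < ε → ℕ
depth ε>0 = proj₁ (halfPow-small ε>0)

φ : ℚ → ℚ
φ ε with 0ℚ ℚₚ.<? ε
... | yes ε>0 = descend (depth ε>0) ε
-- A convention; the limit runs through positive `ε`.
... | no _ = 0ℚ

φ-value : ∀ ε → 0ℚ < ε → φ ε ≡ 1ℚ ⊎ ∃ λ m → Admissible m ε × φ ε ≡ halfPow m
φ-value ε ε>0 with 0ℚ ℚₚ.<? ε
... | yes p = descend-value (depth p) ε
... | no ¬p = ⊥-elim (¬p ε>0)

φ-sound : ∀ {n t} (H : Hypergraph3 t) (f : Cube n → Sign) ε → 0ℚ < ε → Far f ε → acceptProb H f ≤ prob 1 (numEdges H) + φ ε
φ-sound H f ε ε>0 far = cases (φ-value ε ε>0)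
  where
  cases : φ ε ≡ 1ℚ ⊎ (∃ λ m → Admissible m ε × φ ε ≡ halfPow m) → acceptProb H f ≤ prob 1 (numEdges H) + φ ε
  cases (inj₁ e) = begin
    acceptProb H f ≤⟨ acceptProb≤1 H f ⟩
    1ℚ ≤⟨ ≤-by (halfPow (numEdges H)) (<⇒≤ (halfPow>0 (numEdges H))) (⊞-comm _ _) ⟩
    halfPow (numEdges H) ⊞ 1ℚ ≡⟨ cong₂ _⊞_ (sym (prob-1 (numEdges H))) (sym e) ⟩
    prob 1 (numEdges H) ⊞ φ ε ≡⟨ ⊞-def _ (φ ε) ⟩
    prob 1 (numEdges H) + φ ε ∎
  cases (inj₂ (m , a , e)) = begin
    acceptProb H f ≤⟨ proj₂ (proj₂ (soundness (halfPow>0 m))) H f (proj₁ a) far ⟩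
    prob 1 (numEdges H) + halfPow m ≡⟨ cong (prob 1 (numEdges H) +_) (sym e) ⟩
    prob 1 (numEdges H) + φ ε ∎

φ≥0 : ∀ ε → 0ℚ ≤ φ ε
φ≥0 ε with 0ℚ ℚₚ.<? ε
... | yes p = descend≥0 (depth p) ε
... | no _ = ≤-refl

φ-≤ : ∀ {m ε} → 0ℚ < ε → Admissible m ε → φ ε ≤ halfPow m
φ-≤ {m} {ε} ε>0 adm with 0ℚ ℚₚ.<? ε
... | no ¬p = ⊥-elim (¬p ε>0)
... | yes p = descend-small (depth p) {m} (ℕₚ.≰⇒> λ d≤m → <-irrefl refl
  (<-≤-trans (proj₂ adm) (≤-trans (halfPow-anti d≤m) (<⇒≤ (proj₂ (halfPow-small p)))))) adm

φ-vanishes : ∀ δ → 0ℚ < δ → ∃ λ η → 0ℚ < η × (∀ ε → 0ℚ < ε → ε < η → ∣ φ ε ∣ < δ)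
φ-vanishes δ δ>0 = η , η>0 , λ ε ε>0 ε<η → subst (_< δ) (sym (ℚₚ.0≤p⇒∣p∣≡p (φ≥0 ε)))
  (≤-<-trans (φ-≤ {m} ε>0 (<-≤-trans ε<η (ℚₚ.p⊓q≤p a (halfPow m)) , <-≤-trans ε<η (ℚₚ.p⊓q≤q a (halfPow m)))) (proj₂ (halfPow-small δ>0)))
  where
  m : ℕ
  m = proj₁ (halfPow-small δ>0)
  a η : ℚ
  a = proj₁ (soundness (halfPow>0 m))
  a>0 : 0ℚ < a
  a>0 = proj₁ (proj₂ (soundness (halfPow>0 m)))
  -- Below this minimum both conditions of `Admissible m` hold.
  η = a ℚ.⊓ halfPow m
  η>0 : 0ℚ < η
  η>0 with ℚₚ.⊓-sel a (halfPow m)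
  ... | inj₁ e = subst (0ℚ <_) (sym e) a>0
  ... | inj₂ e = subst (0ℚ <_) (sym e) (halfPow>0 m)

theorem3p3 : (t : ℕ) (H : Hypergraph3 t) →
    ((n : ℕ) (f : Cube n → Sign) → IsQuadratic f → acceptProb H f ≡ 1ℚ)
    × ∃ λ (φ : ℚ → ℚ) →
    (∀ δ → 0ℚ < δ → ∃ λ η → 0ℚ < η × (∀ ε → 0ℚ < ε → ε < η → ∣ φ ε ∣ < δ))
    × ((n : ℕ) (f : Cube n → Sign) (ε : ℚ) → 0ℚ < ε →
    ((P : QuadPoly n) → ½ - ε ≤ distance f (quadFn P)) →
    acceptProb H f ≤ prob 1 (numEdges H) + φ ε)
theorem3p3 t H = (λ n → completeness H) , φ , φ-vanishes , (λ n → φ-sound H)
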